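{- The model of $\mathrm{SCI}_{\mathtt{mk},\mathtt{ran}}$ in $\mathbf{MonRel}$ is fully abstract. That is, for any closed terms $M$ and $N$ of $\mathrm{SCI}_{\mathtt{mk},\mathtt{ran}}$ of the same type, $[\![M]\!]=[\![N]\!]$ if and only if $M\cong_{\mathtt{mk},\mathtt{ran}}N$, where $\cong_{\mathtt{mk},\mathtt{ran}}$ is contextual equivalence of $\mathrm{SCI}_{\mathtt{mk},\mathtt{ran}}$.
   Context: **The language SCI.** Types: $A::=\mathtt{nat}\mid\mathtt{comm}\mid\mathtt{var}\mid A\multimap A$ (the first three are the base types). Terms: $M::=n\mid M\odot M\mid\mathtt{skip}\mid M;M\mid M:=M\mid\,!M\mid\mathtt{while}\ M\ \mathtt{do}\ M\mid\mathtt{ifzero}\ M\ \mathtt{then}\ M\ \mathtt{else}\ M\mid x\mid\lambda x^A.M\mid MM\mid\mathtt{new}\ x\ \mathtt{in}\ M$, where $n\in\mathbb N$, $x$ is an identifier, and $\odot$ ranges over a fixed collection of arithmetic operations on $\mathbb N$ including $+$ and (truncated) $-$. Terms are taken up to $\alpha$-equivalence ($\lambda x$ and $\mathtt{new}\ x$ bind $x$). A context $\Gamma$ is a list $x_1:A_1,\dots,x_n:A_n$ with distinct identifiers. **Typing** (all judgments must be well-formed, so $\Gamma,\Delta$ have disjoint identifiers in the application rule): $x:A\vdash x:A$; if $\Gamma,x:A\vdash M:B$ then $\Gamma\vdash\lambda x^A.M:A\multimap B$; if $\Gamma\vdash M:A\multimap B$ and $\Delta\vdash N:A$ then $\Gamma,\Delta\vdash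 MN:B$; weakening (from $\Gamma\vdash M:B$ infer $\Gamma,x:A\vdash M:B$); exchange (permuting $\Gamma$); $\vdash n:\mathtt{nat}$; $\vdash\mathtt{skip}:\mathtt{comm}$; and, with the same $\Gamma$ in all premises and conclusion: $M\odot N:\mathtt{nat}$ if $M,N:\mathtt{nat}$; $M;N:B$ if $M:\mathtt{comm}$, $N:B$, $B$ a base type; $M:=N:\mathtt{comm}$ if $M:\mathtt{var}$, $N:\mathtt{nat}$; $!M:\mathtt{nat}$ if $M:\mathtt{var}$; $\mathtt{while}\ M\ \mathtt{do}\ N:\mathtt{comm}$ if $M:\mathtt{nat}$, $N:\mathtt{comm}$; $\mathtt{ifzero}\ M\ \mathtt{then}\ N_1\ \mathtt{else}\ N_2:B$ if $M:\mathtt{nat}$, $N_1,N_2:B$, $B$ a base type; and $\Gamma\vdash\mathtt{new}\ x\ \mathtt{in}\ M:B$ if $\Gamma,x:\mathtt{var}\vdash M:B$ with $B\in\{\mathtt{comm},\mathtt{nat}\}$. **Operational semantics.** Judgments $\sigma,M\Downarrow\sigma',V$, where $M,V$ are typed in a context $\Gamma$ of $\mathtt{var}$-typed identifiers, $\sigma,\sigma'$ are stores (functions from the identifiers of $\Gamma$ to $\mathbb N$), and $V$ is a value: a numeral, $\mathtt{skip}$, an identifier, or a $\lambda$-abstraction. $(\sigma\mid x\mapsto n)$ is $\sigma$ updated/extended to send $x$ to $n$. Rules: $\sigma,V\Downarrow\sigma,V$; if $\sigma,M\Downarrow\sigma',\lambda x^A.M'$ and $\sigma',M'[N/x]\Downarrow\sigma'',V$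 then $\sigma,MN\Downarrow\sigma'',V$; if $\sigma,M_1\Downarrow\sigma',n_1$ and $\sigma',M_2\Downarrow\sigma'',n_2$ then $\sigma,M_1\odot M_2\Downarrow\sigma'',n_1\odot n_2$; if $\sigma,N\Downarrow\sigma',n$ and $\sigma',M\Downarrow\sigma'',x$ then $\sigma,M:=N\Downarrow(\sigma''\mid x\mapsto n),\mathtt{skip}$; if $\sigma,M\Downarrow\sigma',x$ then $\sigma,!M\Downarrow\sigma',\sigma'(x)$; if $\sigma,M\Downarrow\sigma',\mathtt{skip}$ and $\sigma',N\Downarrow\sigma'',V$ then $\sigma,M;N\Downarrow\sigma'',V$; if $\sigma,M\Downarrow\sigma',n$ with $n\neq0$ then $\sigma,\mathtt{while}\ M\ \mathtt{do}\ N\Downarrow\sigma',\mathtt{skip}$; if $\sigma,M\Downarrow\sigma',0$, $\sigma',N\Downarrow\sigma'',\mathtt{skip}$ and $\sigma'',\mathtt{while}\ M\ \mathtt{do}\ N\Downarrow\sigma''',\mathtt{skip}$ then $\sigma,\mathtt{while}\ M\ \mathtt{do}\ N\Downarrow\sigma''',\mathtt{skip}$; $\mathtt{ifzero}$ evaluates its guard and then the first branch (guard value $0$) or the second (guard value $\neq0$), threading the store; if $(\sigma\mid x\mapsto0),M\Downarrow(\sigma'\mid x\mapsto n),V$ then $\sigma,\mathtt{new}\ x\ \mathtt{in}\ M\Downarrow\sigma',V$ (with $x$ not in the domain of $\sigma,\sigma'$). For closed terms the empty store is omitted. **Extension.** $\mathrm{SCI}_{\mathtt{mk},\mathtt{ran}}$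 is SCI plus two constructs. (i) $\Gamma\vdash\mathtt{random}:\mathtt{nat}$, with $\sigma,\mathtt{random}\Downarrow\sigma,n$ for every $n\in\mathbb N$. (ii) $\Gamma\vdash\mathtt{mkvar}\ M\ N:\mathtt{var}$ if $\Gamma\vdash M:\mathtt{nat}\multimap\mathtt{comm}$ and $\Gamma\vdash N:\mathtt{nat}$; $\mathtt{mkvar}\ M\ N$ is a value (evaluates to itself), and: if $\sigma,N\Downarrow\sigma',n$, $\sigma',M\Downarrow\sigma'',\mathtt{mkvar}\ M_1\ M_2$ and $\sigma'',M_1n\Downarrow\sigma''',V$ then $\sigma,M:=N\Downarrow\sigma''',V$; if $\sigma,M\Downarrow\sigma',\mathtt{mkvar}\ M_1\ M_2$ and $\sigma',M_2\Downarrow\sigma'',V$ then $\sigma,!M\Downarrow\sigma'',V$. **Contextual equivalence.** For $\Gamma\vdash M,N:A$ in $\mathrm{SCI}_{\mathtt{mk},\mathtt{ran}}$, $M\cong_{\mathtt{mk},\mathtt{ran}}N$ iff for every context (term with a hole, possibly capturing) $C[-]$ of $\mathrm{SCI}_{\mathtt{mk},\mathtt{ran}}$ with $\vdash C[M],C[N]:B$, $B\in\{\mathtt{comm},\mathtt{nat}\}$, and every value $\vdash V:B$: $C[M]\Downarrow V\iff C[N]\Downarrow V$. **Denotational semantics.** Put $\alpha\mathtt{nat}=\mathbb N$, $\alpha\mathtt{comm}=\{*\}$, $\alpha\mathtt{var}=\{\mathsf{read}(n),\mathsf{write}(n)\mid n\in\mathbb N\}$, $\alpha(A\multimap B)=(\alpha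 A)^*\times\alpha B$; $X^*$ is the free monoid of finite sequences, $\varepsilon$ the empty sequence. For $\Gamma=x_1:A_1,\dots,x_n:A_n$, $[\![\Gamma\vdash M:B]\!]\subseteq(\alpha A_1)^*\times\cdots\times(\alpha A_n)^*\times\alpha B$; elements are written $(\vec s,b)$, and $\vec s\,\vec s'$ is componentwise concatenation. Clauses: $[\![x:A\vdash x:A]\!]=\{(a,a)\mid a\in\alpha A\}$; $[\![\lambda x^A.M]\!]=\{(\vec s,(s,b))\mid(\vec s,s,b)\in[\![M]\!]\}$; $[\![MN]\!]=\{(\vec s,\vec t^{\,1}\cdots\vec t^{\,k},b)\mid\exists a_1,\dots,a_k.\ (\vec s,(a_1\cdots a_k,b))\in[\![M]\!],\ (\vec t^{\,i},a_i)\in[\![N]\!]\ (1\le i\le k)\}$; weakening inserts $\varepsilon$ for the new identifier; exchange permutes components; $[\![n]\!]=\{n\}$; $[\![\mathtt{skip}]\!]=\{*\}$; $[\![M_1\odot M_2]\!]=\{(\vec s\,\vec s',m_1\odot m_2)\mid(\vec s,m_1)\in[\![M_1]\!],(\vec s',m_2)\in[\![M_2]\!]\}$; $[\![M;N]\!]=\{(\vec s\,\vec s',b)\mid(\vec s,*)\in[\![M]\!],(\vec s',b)\in[\![N]\!]\}$; $[\![M:=N]\!]=\{(\vec s\,\vec s',*)\mid\exists n.\,(\vec s,n)\in[\![N]\!],(\vec s',\mathsf{write}(n))\in[\![M]\!]\}$; $[\![!M]\!]=\{(\vec s,n)\mid(\vec s,\mathsf{read}(n))\in[\![M]\!]\}$;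 $[\![\mathtt{while}\ M\ \mathtt{do}\ N]\!]=\{(\vec s^{\,1}\vec t^{\,1}\cdots\vec s^{\,j}\vec t^{\,j}\vec s,*)\mid j\ge0,\ \forall i.\,(\vec s^{\,i},0)\in[\![M]\!]\wedge(\vec t^{\,i},*)\in[\![N]\!],\ \exists m\ne0.\,(\vec s,m)\in[\![M]\!]\}$; $[\![\mathtt{ifzero}\ M\ \mathtt{then}\ N_1\ \mathtt{else}\ N_2]\!]=\{(\vec s\,\vec t,b)\mid(\vec s,0)\in[\![M]\!],(\vec t,b)\in[\![N_1]\!]\}\cup\{(\vec s\,\vec t,b)\mid\exists m\ne0.\,(\vec s,m)\in[\![M]\!],(\vec t,b)\in[\![N_2]\!]\}$; $[\![\mathtt{new}\ x\ \mathtt{in}\ M]\!]=\{(\vec s,b)\mid\exists s.\,(\vec s,s,b)\in[\![M]\!],\ s\text{ a cell trace}\}$, where $s\in(\alpha\mathtt{var})^*$ is a cell trace iff every $\mathsf{read}(n)$ in $s$ carries the value of the most recent preceding $\mathsf{write}$, or $0$ if there is none; $[\![\mathtt{random}]\!]=\{(\vec\varepsilon,n)\mid n\in\mathbb N\}$; $[\![\mathtt{mkvar}\ M\ N]\!]=\{(\vec s,\mathsf{write}(n))\mid(\vec s,*)\in[\![Mn]\!]\}\cup\{(\vec s,\mathsf{read}(n))\mid(\vec s,n)\in[\![N]\!]\}$. **MonRel.** Objects are monoids; morphisms $P\to Q$ are relations $R\subseteq P\times Q$ with $e_P\,R\,e_Q$; $a_iRb_i$ ($i=1,2$) implies $a_1a_2\,R\,b_1b_2$;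 $a\,R\,e_Q$ implies $a=e_P$; $a\,R\,b_1b_2$ implies $a=a_1a_2$ for some $a_i$ with $a_iRb_i$. Composition is relational. A morphism into a free monoid $X^*$ is determined by its restriction to $P\times X$, which may be arbitrary, so $[\![\Gamma\vdash M:B]\!]$ is the same thing as a $\mathbf{MonRel}$-morphism $(\alpha A_1)^*\times\cdots\times(\alpha A_n)^*\to(\alpha B)^*$ (product monoid as source). -}

module Defs where

open import Algebra.Bundles using (Monoid)
open import Data.Fin.Base using (Fin; zero; suc; _↑ˡ_; _↑ʳ_)
open import Data.Fin.Permutation using (_⟨$⟩ʳ_)
open import Data.List.Base as List using (List; replicate)
open import Data.List.Properties using (++-assoc; ++-identityʳ; ++-monoid)
open import Data.Nat.Base using (ℕ; zero; suc; _+_; _∸_)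
open import Data.Product.Base using (∃; ∃₂; _×_; _,_; proj₁; proj₂)
open import Data.Sum.Base using (_⊎_)
open import Data.Unit.Base using (⊤; tt)
open import Data.Vec.Base using (Vec; []; _∷_; _++_; lookup; _[_]≔_)
open import Data.Vec.Functional.Relation.Binary.Permutation using (_↭_)
open import Data.Vec.Relation.Unary.All using (All; []; _∷_)
open import Data.Vec.Relation.Unary.All.Properties using (++⁺; lookup⁺; lookup⁻)
open import Function.Base using (_∘_)
open import Function.Bundles using (_⇔_)
open import Function.Definitions using (Injective)
open import Level using (0ℓ)
open import Relation.Binary.PropositionalEquality
  using (_≡_; _≢_; refl; cong₂; subst; isEquivalence)

private
  variable
    k l m n : ℕ

------------------------------------------------------------------------
-- The category MonRel

-- Monoids are setoid-based, so a morphism must also respect the equalities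
-- of its source and target.
record MonRel (P Q : Monoid 0ℓ 0ℓ) : Set₁ where
  private
    module P = Monoid P
    module Q = Monoid Q
  field
    Rel      : P.Carrier → Q.Carrier → Set
    respects : ∀ {a a′ b b′} → a P.≈ a′ → b Q.≈ b′ → Rel a b → Rel a′ b′
    unit     : Rel P.ε Q.ε
    multiply : ∀ {a₁ a₂ b₁ b₂} → Rel a₁ b₁ → Rel a₂ b₂ →
               Rel (a₁ P.∙ a₂) (b₁ Q.∙ b₂)
    reflectε : ∀ {a} → Rel a Q.ε → a P.≈ P.ε
    split    : ∀ {a b₁ b₂} → Rel a (b₁ Q.∙ b₂) →
               ∃₂ λ a₁ a₂ → a P.≈ a₁ P.∙ a₂ × Rel a₁ b₁ × Rel a₂ b₂

infix 4 _≋_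

_≋_ : {P Q : Monoid 0ℓ 0ℓ} → MonRel P Q → MonRel P Q → Set
R ≋ R′ = ∀ a b → MonRel.Rel R a b ⇔ MonRel.Rel R′ a b

-- Ext P R relates p to x₁ ⋯ xₖ iff p = p₁ ∙ ⋯ ∙ pₖ with R pᵢ xᵢ for every i;
-- it is the morphism P → X* whose restriction to P × X is R.
data Ext (P : Monoid 0ℓ 0ℓ) {X : Set} (R : Monoid.Carrier P → X → Set) :
         Monoid.Carrier P → List X → Set where
  []  : ∀ {p} → let open Monoid P in
        p ≈ ε → Ext P R p List.[]
  _∷_ : ∀ {p p₁ p₂ x xs} → let open Monoid P in
        p ≈ p₁ ∙ p₂ × R p₁ x → Ext P R p₂ xs → Ext P R p (x List.∷ xs)

extend : (P : Monoid 0ℓ 0ℓ) {X : Set} → (Monoid.Carrier P → X → Set) →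
         MonRel P (++-monoid X)
extend P {X} R = record
  { Rel      = Ext P R
  ; respects = resp
  ; unit     = [] P.refl
  ; multiply = mult
  ; reflectε = λ { ([] p≈ε) → p≈ε }
  ; split    = λ {_} {xs} → spl xs
  }
  where
  module P = Monoid P
  open P using (_≈_; _∙_)

  resp : ∀ {p p′ xs xs′} → p ≈ p′ → xs ≡ xs′ → Ext P R p xs → Ext P R p′ xs′
  resp p≈p′ refl ([] p≈ε)       = [] (P.trans (P.sym p≈p′) p≈ε)
  resp p≈p′ refl ((eq , r) ∷ e) = (P.trans (P.sym p≈p′) eq , r) ∷ e

  mult : ∀ {p q xs ys} → Ext P R p xs → Ext P R q ys →
         Ext P R (p ∙ q) (xs List.++ ys)
  mult ([] p≈ε) f =
    resp (P.trans (P.sym (P.identityˡ _)) (P.∙-congʳ (P.sym p≈ε))) refl f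
  mult ((eq , r) ∷ e) f =
    (P.trans (P.∙-congʳ eq) (P.assoc _ _ _) , r) ∷ mult e f

  spl : ∀ {p} xs {ys} → Ext P R p (xs List.++ ys) →
        ∃₂ λ p₁ p₂ → p ≈ p₁ ∙ p₂ × Ext P R p₁ xs × Ext P R p₂ ys
  spl List.[] e = _ , _ , P.sym (P.identityˡ _) , [] P.refl , e
  spl (x List.∷ xs) ((eq , r) ∷ e) with spl xs e
  ... | _ , _ , eq′ , e₁ , e₂ =
    _ , _ , P.trans eq (P.trans (P.∙-congˡ eq′) (P.sym (P.assoc _ _ _))) ,
    (P.refl , r) ∷ e₁ , e₂

------------------------------------------------------------------------
-- Types

infixr 7 _⊸_

data Ty : Set where
  nat comm var : Ty
  _⊸_          : Ty → Ty → Ty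

data Base : Ty → Set where
  nat  : Base nat
  comm : Base comm
  var  : Base var

data Ground : Ty → Set where
  nat  : Ground nat
  comm : Ground comm

-- The fixed collection of arithmetic operations: codes for binary operations
-- on ℕ, among them addition and truncated subtraction.
record Arithmetic : Set₁ where
  field
    Op        : Set
    apply     : Op → ℕ → ℕ → ℕ
    add sub   : Op
    apply-add : ∀ x y → apply add x y ≡ x + y
    apply-sub : ∀ x y → apply sub x y ≡ x ∸ y

module SCI (𝒜 : Arithmetic) where

  open Arithmetic 𝒜

  ----------------------------------------------------------------------
  -- Terms

  infix  9 `_ #_
  infixl 8 _·_
  infix  8 !_
  infix  6 _≔_
  infixr 5 _⨾_

  -- α-equivalence classes are represented by well-scoped de Bruijn terms.
  data Tm (n : ℕ) : Set where
    `_                  : Fin n → Tm n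
    ƛ                   : Ty → Tm (suc n) → Tm n
    _·_                 : Tm n → Tm n → Tm n
    #_                  : ℕ → Tm n
    op                  : Op → Tm n → Tm n → Tm n
    skip                : Tm n
    _⨾_                 : Tm n → Tm n → Tm n
    _≔_                 : Tm n → Tm n → Tm n
    !_                  : Tm n → Tm n
    while               : Tm n → Tm n → Tm n
    ifzero              : Tm n → Tm n → Tm n → Tm n
    new                 : Tm (suc n) → Tm n
    random              : Tm n
    mkvar               : Tm n → Tm n → Tm n

  ext : (Fin m → Fin n) → Fin (suc m) → Fin (suc n)
  ext ρ zero    = zero
  ext ρ (suc i) = suc (ρ i)

  rename : (Fin m → Fin n) → Tm m → Tm n
  rename ρ (` i)                   = ` ρ i
  rename ρ (ƛ A M)                 = ƛ A (rename (ext ρ) M)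
  rename ρ (M · N)                 = rename ρ M · rename ρ N
  rename ρ (# x)                   = # x
  rename ρ (op o M N)              = op o (rename ρ M) (rename ρ N)
  rename ρ skip                    = skip
  rename ρ (M ⨾ N)                 = rename ρ M ⨾ rename ρ N
  rename ρ (M ≔ N)                 = rename ρ M ≔ rename ρ N
  rename ρ (! M)                   = ! rename ρ M
  rename ρ (while M N)             = while (rename ρ M) (rename ρ N)
  rename ρ (ifzero M N₁ N₂) =
    ifzero (rename ρ M) (rename ρ N₁) (rename ρ N₂)
  rename ρ (new M)                 = new (rename (ext ρ) M)
  rename ρ random                  = random
  rename ρ (mkvar M N)             = mkvar (rename ρ M) (rename ρ N)

  exts : (Fin m → Tm n) → Fin (suc m) → Tm (suc n)
  exts θ zero    = ` zero
  exts θ (suc i) = rename suc (θ i)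

  substitute : (Fin m → Tm n) → Tm m → Tm n
  substitute θ (` i)                   = θ i
  substitute θ (ƛ A M)                 = ƛ A (substitute (exts θ) M)
  substitute θ (M · N)                 = substitute θ M · substitute θ N
  substitute θ (# x)                   = # x
  substitute θ (op o M N)              = op o (substitute θ M) (substitute θ N)
  substitute θ skip                    = skip
  substitute θ (M ⨾ N)                 = substitute θ M ⨾ substitute θ N
  substitute θ (M ≔ N)                 = substitute θ M ≔ substitute θ N
  substitute θ (! M)                   = ! substitute θ M
  substitute θ (while M N)             = while (substitute θ M) (substitute θ N)
  substitute θ (ifzero M N₁ N₂) =
    ifzero (substitute θ M) (substitute θ N₁) (substitute θ N₂)
  substitute θ (new M)                 = new (substitute (exts θ) M)
  substitute θ random                  = random
  substitute θ (mkvar M N)             = mkvar (substitute θ M) (substitute θ N)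

  infix 9 _[_/0]

  _[_/0] : Tm (suc n) → Tm n → Tm n
  M [ N /0] = substitute (λ { zero → N ; (suc i) → ` i }) M

  ----------------------------------------------------------------------
  -- Typing

  infix 3 _⊢_∶_

  -- The context Γ , x : A is A ∷ Γ.  In exch, p exhibits Δ as a permutation
  -- of Γ: position i of Γ is moved to position proj₁ p ⟨$⟩ʳ i of Δ.
  data _⊢_∶_ : Vec Ty n → Tm n → Ty → Set where
    ax     : ∀ {A} → A ∷ [] ⊢ ` zero ∶ A
    lam    : ∀ {Γ : Vec Ty n} {A B M} →
             A ∷ Γ ⊢ M ∶ B → Γ ⊢ ƛ A M ∶ A ⊸ B
    app    : ∀ {Γ : Vec Ty m} {Δ : Vec Ty n} {A B M N} →
             Γ ⊢ M ∶ A ⊸ B → Δ ⊢ N ∶ A →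
             Γ ++ Δ ⊢ rename (_↑ˡ n) M · rename (m ↑ʳ_) N ∶ B
    weak   : ∀ {Γ : Vec Ty n} {A B M} →
             Γ ⊢ M ∶ B → A ∷ Γ ⊢ rename suc M ∶ B
    exch   : ∀ {Γ : Vec Ty m} {Δ : Vec Ty n} {B M} →
             (p : lookup Δ ↭ lookup Γ) →
             Γ ⊢ M ∶ B → Δ ⊢ rename (proj₁ p ⟨$⟩ʳ_) M ∶ B
    num    : ∀ x → [] ⊢ # x ∶ nat
    skip   : [] ⊢ skip ∶ comm
    op     : ∀ {Γ : Vec Ty n} {M N} o →
             Γ ⊢ M ∶ nat → Γ ⊢ N ∶ nat → Γ ⊢ op o M N ∶ nat
    seq    : ∀ {Γ : Vec Ty n} {B M N} → Base B →
             Γ ⊢ M ∶ comm → Γ ⊢ N ∶ B → Γ ⊢ M ⨾ N ∶ B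
    assign : ∀ {Γ : Vec Ty n} {M N} →
             Γ ⊢ M ∶ var → Γ ⊢ N ∶ nat → Γ ⊢ M ≔ N ∶ comm
    deref  : ∀ {Γ : Vec Ty n} {M} →
             Γ ⊢ M ∶ var → Γ ⊢ ! M ∶ nat
    while  : ∀ {Γ : Vec Ty n} {M N} →
             Γ ⊢ M ∶ nat → Γ ⊢ N ∶ comm → Γ ⊢ while M N ∶ comm
    ifzero : ∀ {Γ : Vec Ty n} {B M N₁ N₂} → Base B →
             Γ ⊢ M ∶ nat → Γ ⊢ N₁ ∶ B → Γ ⊢ N₂ ∶ B →
             Γ ⊢ ifzero M N₁ N₂ ∶ B
    new    : ∀ {Γ : Vec Ty n} {B M} → Ground B →
             var ∷ Γ ⊢ M ∶ B → Γ ⊢ new M ∶ B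
    random : ∀ {Γ : Vec Ty n} → Γ ⊢ random ∶ nat
    mkvar  : ∀ {Γ : Vec Ty n} {M N} →
             Γ ⊢ M ∶ nat ⊸ comm → Γ ⊢ N ∶ nat → Γ ⊢ mkvar M N ∶ var

  ----------------------------------------------------------------------
  -- Operational semantics

  data Value {n : ℕ} : Tm n → Set where
    num   : ∀ {x} → Value (# x)
    skip  : Value skip
    ident : ∀ {i} → Value (` i)
    lam   : ∀ {A M} → Value (ƛ A M)
    mkvar : ∀ {M N} → Value (mkvar M N)

  Store : ℕ → Set
  Store = Vec ℕ

  infix 3 _∣_⇓_∣_

  -- Defined on all well-scoped terms; a term in scope n is meant to be typed
  -- in the context of n identifiers of type var.
  data _∣_⇓_∣_ {n : ℕ} : Store n → Tm n → Store n → Tm n → Set where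
    value    : ∀ {σ V} → Value V → σ ∣ V ⇓ σ ∣ V
    app      : ∀ {σ σ′ σ″ A M M′ N V} →
               σ ∣ M ⇓ σ′ ∣ ƛ A M′ → σ′ ∣ M′ [ N /0] ⇓ σ″ ∣ V →
               σ ∣ M · N ⇓ σ″ ∣ V
    op       : ∀ {σ σ′ σ″ o M₁ M₂ x₁ x₂} →
               σ ∣ M₁ ⇓ σ′ ∣ # x₁ → σ′ ∣ M₂ ⇓ σ″ ∣ # x₂ →
               σ ∣ op o M₁ M₂ ⇓ σ″ ∣ # apply o x₁ x₂
    assign   : ∀ {σ σ′ σ″ M N i x} →
               σ ∣ N ⇓ σ′ ∣ # x → σ′ ∣ M ⇓ σ″ ∣ ` i →
               σ ∣ M ≔ N ⇓ σ″ [ i ]≔ x ∣ skip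
    deref    : ∀ {σ σ′ M i} →
               σ ∣ M ⇓ σ′ ∣ ` i → σ ∣ ! M ⇓ σ′ ∣ # lookup σ′ i
    seq      : ∀ {σ σ′ σ″ M N V} →
               σ ∣ M ⇓ σ′ ∣ skip → σ′ ∣ N ⇓ σ″ ∣ V → σ ∣ M ⨾ N ⇓ σ″ ∣ V
    while-≢0 : ∀ {σ σ′ M N x} →
               σ ∣ M ⇓ σ′ ∣ # x → x ≢ 0 → σ ∣ while M N ⇓ σ′ ∣ skip
    while-0  : ∀ {σ σ′ σ″ σ‴ M N} →
               σ ∣ M ⇓ σ′ ∣ # 0 → σ′ ∣ N ⇓ σ″ ∣ skip →
               σ″ ∣ while M N ⇓ σ‴ ∣ skip →
               σ ∣ while M N ⇓ σ‴ ∣ skip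
    ifzero-0 : ∀ {σ σ′ σ″ M N₁ N₂ V} →
               σ ∣ M ⇓ σ′ ∣ # 0 → σ′ ∣ N₁ ⇓ σ″ ∣ V →
               σ ∣ ifzero M N₁ N₂ ⇓ σ″ ∣ V
    ifzero-≢0 : ∀ {σ σ′ σ″ M N₁ N₂ V x} →
               σ ∣ M ⇓ σ′ ∣ # x → x ≢ 0 → σ′ ∣ N₂ ⇓ σ″ ∣ V →
               σ ∣ ifzero M N₁ N₂ ⇓ σ″ ∣ V
    -- The value V may not mention the new identifier, which leaves scope.
    new      : ∀ {σ σ′ M V x} →
               0 ∷ σ ∣ M ⇓ x ∷ σ′ ∣ rename suc V → σ ∣ new M ⇓ σ′ ∣ V
    random   : ∀ {σ} x → σ ∣ random ⇓ σ ∣ # x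
    assign-mkvar : ∀ {σ σ′ σ″ σ‴ M N M₁ M₂ V x} →
               σ ∣ N ⇓ σ′ ∣ # x → σ′ ∣ M ⇓ σ″ ∣ mkvar M₁ M₂ →
               σ″ ∣ M₁ · # x ⇓ σ‴ ∣ V →
               σ ∣ M ≔ N ⇓ σ‴ ∣ V
    deref-mkvar : ∀ {σ σ′ σ″ M M₁ M₂ V} →
               σ ∣ M ⇓ σ′ ∣ mkvar M₁ M₂ → σ′ ∣ M₂ ⇓ σ″ ∣ V →
               σ ∣ ! M ⇓ σ″ ∣ V

  infix 3 _⇓_

  _⇓_ : Tm 0 → Tm 0 → Set
  M ⇓ V = [] ∣ M ⇓ [] ∣ V

  ----------------------------------------------------------------------
  -- Contextual equivalence

  -- Context m n: terms in scope n with one hole for a term in scope m.  The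
  -- hole carries the binding, by the identifiers in scope there, of the free
  -- identifiers of the term put into it; distinct identifiers stay distinct.
  data Context (m n : ℕ) : Set where
    □                 : (ρ : Fin m → Fin n) → Injective _≡_ _≡_ ρ → Context m n
    ƛ                 : Ty → Context m (suc n) → Context m n
    _·ˡ_              : Context m n → Tm n → Context m n
    _·ʳ_              : Tm n → Context m n → Context m n
    opˡ               : Op → Context m n → Tm n → Context m n
    opʳ               : Op → Tm n → Context m n → Context m n
    _⨾ˡ_              : Context m n → Tm n → Context m n
    _⨾ʳ_              : Tm n → Context m n → Context m n
    _≔ˡ_              : Context m n → Tm n → Context m n
    _≔ʳ_              : Tm n → Context m n → Context m n
    !_                : Context m n → Context m n
    whileˡ            : Context m n → Tm n → Context m n
    whileʳ            : Tm n → Context m n → Context m n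
    ifzero₁           : Context m n → Tm n → Tm n → Context m n
    ifzero₂           : Tm n → Context m n → Tm n → Context m n
    ifzero₃           : Tm n → Tm n → Context m n → Context m n
    new               : Context m (suc n) → Context m n
    mkvarˡ            : Context m n → Tm n → Context m n
    mkvarʳ            : Tm n → Context m n → Context m n

  infix 9 _⟨_⟩

  _⟨_⟩ : Context m n → Tm m → Tm n
  □ ρ _ ⟨ M ⟩                 = rename ρ M
  ƛ A C ⟨ M ⟩                 = ƛ A (C ⟨ M ⟩)
  (C ·ˡ N) ⟨ M ⟩              = C ⟨ M ⟩ · N
  (N ·ʳ C) ⟨ M ⟩              = N · C ⟨ M ⟩
  opˡ o C N ⟨ M ⟩             = op o (C ⟨ M ⟩) N
  opʳ o N C ⟨ M ⟩             = op o N (C ⟨ M ⟩)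
  (C ⨾ˡ N) ⟨ M ⟩              = C ⟨ M ⟩ ⨾ N
  (N ⨾ʳ C) ⟨ M ⟩              = N ⨾ C ⟨ M ⟩
  (C ≔ˡ N) ⟨ M ⟩              = C ⟨ M ⟩ ≔ N
  (N ≔ʳ C) ⟨ M ⟩              = N ≔ C ⟨ M ⟩
  (! C) ⟨ M ⟩                 = ! C ⟨ M ⟩
  (whileˡ C N) ⟨ M ⟩          = while (C ⟨ M ⟩) N
  (whileʳ N C) ⟨ M ⟩          = while N (C ⟨ M ⟩)
  (ifzero₁ C N₁ N₂) ⟨ M ⟩     = ifzero (C ⟨ M ⟩) N₁ N₂
  (ifzero₂ N C N₂) ⟨ M ⟩      = ifzero N (C ⟨ M ⟩) N₂
  (ifzero₃ N N₁ C) ⟨ M ⟩      = ifzero N N₁ (C ⟨ M ⟩)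
  new C ⟨ M ⟩                 = new (C ⟨ M ⟩)
  mkvarˡ C N ⟨ M ⟩            = mkvar (C ⟨ M ⟩) N
  mkvarʳ N C ⟨ M ⟩            = mkvar N (C ⟨ M ⟩)

  infix 4 _≅_

  _≅_ : Tm m → Tm m → Set
  _≅_ {m} M N =
    (C : Context m 0) {B : Ty} → Ground B →
    [] ⊢ C ⟨ M ⟩ ∶ B → [] ⊢ C ⟨ N ⟩ ∶ B →
    ∀ V → Value V → [] ⊢ V ∶ B →
    (C ⟨ M ⟩ ⇓ V) ⇔ (C ⟨ N ⟩ ⇓ V)

  ----------------------------------------------------------------------
  -- Denotational semantics

  data Access : Set where
    read write : ℕ → Access

  α : Ty → Set
  α nat     = ℕ
  α comm    = ⊤
  α var     = Access
  α (A ⊸ B) = List (α A) × α B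

  -- (α A₁)* × ⋯ × (α Aₙ)* with componentwise concatenation.
  Seqs : Vec Ty n → Set
  Seqs = All (List ∘ α)

  infixr 7 _∙_

  _∙_ : {Γ : Vec Ty n} → Seqs Γ → Seqs Γ → Seqs Γ
  []      ∙ []      = []
  (s ∷ ss) ∙ (t ∷ ts) = (s List.++ t) ∷ (ss ∙ ts)

  ε : {Γ : Vec Ty n} → Seqs Γ
  ε {Γ = []}    = []
  ε {Γ = A ∷ Γ} = List.[] ∷ ε

  private
    ∙-assoc : {Γ : Vec Ty n} (s t u : Seqs Γ) → (s ∙ t) ∙ u ≡ s ∙ (t ∙ u)
    ∙-assoc []       []       []       = refl
    ∙-assoc (s ∷ ss) (t ∷ ts) (u ∷ us) =
      cong₂ _∷_ (++-assoc s t u) (∙-assoc ss ts us)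

    ∙-identityˡ : {Γ : Vec Ty n} (s : Seqs Γ) → ε ∙ s ≡ s
    ∙-identityˡ []       = refl
    ∙-identityˡ (s ∷ ss) = cong₂ _∷_ refl (∙-identityˡ ss)

    ∙-identityʳ : {Γ : Vec Ty n} (s : Seqs Γ) → s ∙ ε ≡ s
    ∙-identityʳ []       = refl
    ∙-identityʳ (s ∷ ss) = cong₂ _∷_ (++-identityʳ s) (∙-identityʳ ss)

  seqs : Vec Ty n → Monoid 0ℓ 0ℓ
  seqs Γ = record
    { Carrier  = Seqs Γ
    ; _≈_      = _≡_
    ; _∙_      = _∙_
    ; ε        = ε
    ; isMonoid = record
      { isSemigroup = record
        { isMagma = record
          { isEquivalence = isEquivalence
          ; ∙-cong        = cong₂ _∙_
          }
        ; assoc = ∙-assoc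
        }
      ; identity = ∙-identityˡ , ∙-identityʳ
      }
    }

  permute : {Γ : Vec Ty m} {Δ : Vec Ty n} →
            lookup Δ ↭ lookup Γ → Seqs Δ → Seqs Γ
  permute (π , eq) s =
    lookup⁻ (λ i → subst (List ∘ α) (eq i) (lookup⁺ s (π ⟨$⟩ʳ i)))

  -- CellFrom x s: s is a possible history of a cell currently holding x.
  data CellFrom : ℕ → List Access → Set where
    []     : ∀ {x} → CellFrom x List.[]
    read∷  : ∀ {x s} → CellFrom x s → CellFrom x (read x List.∷ s)
    write∷ : ∀ {x y s} → CellFrom y s → CellFrom x (write y List.∷ s)

  CellTrace : List Access → Set
  CellTrace = CellFrom 0

  data Loop {Γ : Vec Ty n} (G : Seqs Γ → ℕ → Set) (B : Seqs Γ → ⊤ → Set) :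
            Seqs Γ → Set where
    exit : ∀ {s x} → x ≢ 0 → G s x → Loop G B s
    iter : ∀ {u s t s′} → u ≡ s ∙ t ∙ s′ →
           G s 0 → B t tt → Loop G B s′ → Loop G B u

  -- In the mkvar clause, the trace (s , *) of the application of the first
  -- argument to the numeral x is written out: the argument of a trace of
  -- type nat ⊸ comm is then a sequence of copies of x.
  ⟦_⟧ : {Γ : Vec Ty n} {M : Tm n} {B : Ty} →
        Γ ⊢ M ∶ B → Seqs Γ → α B → Set
  ⟦ ax ⟧             (s ∷ []) a       = s ≡ List.[ a ]
  ⟦ lam d ⟧          s        (t , b) = ⟦ d ⟧ (t ∷ s) b
  ⟦ app {Γ = Γ} {Δ = Δ} d e ⟧ u b     =
    ∃₂ λ (s : Seqs Γ) (t : Seqs Δ) → u ≡ ++⁺ s t ×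
    ∃ λ as → ⟦ d ⟧ s (as , b) × Ext (seqs Δ) ⟦ e ⟧ t as
  ⟦ weak d ⟧         (t ∷ s)  b       = t ≡ List.[] × ⟦ d ⟧ s b
  ⟦ exch p d ⟧       s        b       = ⟦ d ⟧ (permute p s) b
  ⟦ num x ⟧          s        y       = y ≡ x
  ⟦ skip ⟧           s        b       = ⊤
  ⟦ op o d e ⟧       u        y       =
    ∃₂ λ s t → u ≡ s ∙ t ×
    ∃₂ λ x₁ x₂ → y ≡ apply o x₁ x₂ × ⟦ d ⟧ s x₁ × ⟦ e ⟧ t x₂
  ⟦ seq _ d e ⟧      u        b       =
    ∃₂ λ s t → u ≡ s ∙ t × ⟦ d ⟧ s tt × ⟦ e ⟧ t b
  ⟦ assign d e ⟧     u        b       =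
    ∃₂ λ s t → u ≡ s ∙ t × ∃ λ x → ⟦ e ⟧ s x × ⟦ d ⟧ t (write x)
  ⟦ deref d ⟧        s        x       = ⟦ d ⟧ s (read x)
  ⟦ while d e ⟧      s        b       = Loop ⟦ d ⟧ ⟦ e ⟧ s
  ⟦ ifzero _ d e f ⟧ u        b       =
    (∃₂ λ s t → u ≡ s ∙ t × ⟦ d ⟧ s 0 × ⟦ e ⟧ t b) ⊎
    (∃₂ λ s t → u ≡ s ∙ t × (∃ λ x → x ≢ 0 × ⟦ d ⟧ s x) × ⟦ f ⟧ t b)
  ⟦ new _ d ⟧        s        b       = ∃ λ t → ⟦ d ⟧ (t ∷ s) b × CellTrace t
  ⟦ random ⟧         s        x       = s ≡ ε
  ⟦ mkvar d e ⟧      s     (write x)  = ∃ λ k → ⟦ d ⟧ s (replicate k x , tt)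
  ⟦ mkvar d e ⟧      s     (read x)   = ⟦ e ⟧ s x

  model : {Γ : Vec Ty n} {M : Tm n} {B : Ty} →
          Γ ⊢ M ∶ B → MonRel (seqs Γ) (++-monoid (α B))
  model {Γ = Γ} d = extend (seqs Γ) ⟦ d ⟧

{-# OPTIONS --safe #-}
module Submission where

-- The typed denotation is compared with a relation ⟪ M ⟫ defined by recursion on
-- the raw term M over untyped traces; it does not mention typing derivations, so
-- it is visibly compositional for arbitrary contexts.
--
-- Soundness: if M evaluates to V, turning the store σ into σ′, then a trace (t , b)
-- of V extends to a trace (s ⊕ t , b) of M, where s takes σ to σ′.  For β-reduction
-- this needs that function and argument have disjoint identifiers.  Adequacy: a
-- Kripke-style realizability relation, indexed by untyped traces instead of types,
-- shows that every trace of a term is realized by an evaluation.  Together, at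
-- ground types the denotation is the set of results, so equal denotations give
-- contextually equivalent terms.
--
-- Conversely, every a in α A has a closed test of type A ⊸ comm whose only trace is
-- [ a ] ⇒ ⋆.  At A ⊸ B, the test for (as , b) applies its argument to a term that
-- supplies the elements of as one after the other, recording its progress in a
-- cell, tests the outcome for b, and finally checks that the cell has reached
-- length as.  The supply exists because `random` provides nondeterministic choice
-- and `mkvar` makes all elements of α var definable.

open import Algebra.Bundles using (Monoid)
open import Data.Bool.Base using (Bool; true; false; not)
open import Data.Empty using (⊥; ⊥-elim)
open import Data.Fin.Base using (Fin; zero; suc; toℕ; splitAt; _↑ˡ_; _↑ʳ_)
open import Data.Fin.Permutation as Perm using (_⟨$⟩ʳ_; _⟨$⟩ˡ_; inverseˡ; inverseʳ)
open import Data.Fin.Properties using (any?; splitAt-↑ˡ; splitAt-↑ʳ; splitAt⁻¹-↑ˡ; splitAt⁻¹-↑ʳ; ↑ˡ-injective; ↑ʳ-injective) renaming (_≟_ to _≟ᶠ_)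
open import Data.List.Base as List using (List; []; _∷_; _++_; [_]; replicate; map; length; drop)
open import Data.List.Properties using (++-monoid; ++-identityʳ; ++-assoc; ++-conicalˡ; ++-conicalʳ; map-++; map-injective; map-replicate)
open import Data.List.Relation.Unary.All using (All; []; _∷_)
import Data.List.Relation.Unary.All.Properties as All
open import Data.Nat.Base using (ℕ; zero; suc; _+_; _∸_)
open import Data.Nat.Properties using (m+n≡0⇒m≡0; m+n≡0⇒n≡0; m∸n≡0⇒m≤n; ≤-antisym; n∸n≡0; +-suc; +-identityʳ)
open import Data.Product.Base using (∃; ∃₂; _×_; _,_; proj₁; proj₂)
open import Data.Sum.Base as Sum using (_⊎_; inj₁; inj₂)
open import Data.Unit.Base using (⊤; tt)
open import Data.Vec.Base as Vec using (Vec; []; _∷_; lookup; _[_]≔_)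
open import Data.Vec.Functional.Relation.Binary.Permutation using (_↭_)
open import Data.Vec.Properties using (lookup-++ˡ; lookup-++ʳ; lookup-replicate; lookup∘update; lookup∘update′; lookup∘tabulate)
import Data.Vec.Relation.Unary.All as Vec
open import Data.Vec.Relation.Unary.All.Properties using (lookup⁺; lookup⁻; ++⁺; ++⁻; ++⁺∘++⁻)
open import Function.Base using (_∘_; id; case_of_; const)
open import Function.Bundles using (_⇔_; mk⇔; Equivalence)
open import Level using (0ℓ)
open import Relation.Binary.PropositionalEquality hiding ([_]; resp)
open import Relation.Nullary using (¬_; yes; no)
import Algebra.Construct.Pointwise as Pointwise
open import Defs

open Vec.All using ([]; _∷_)

private variable
  k l m n : ℕ

-- The rules `app`, `weak` and `exch` are not syntax-directed: a derivation of a term in context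
-- need not contain the given derivation of the term in the hole. `Typed` is a syntax-directed
-- substitute that remembers for every application which identifiers go to the function.
--
-- A trace lists the actions on each identifier separately and says nothing about the order of
-- actions on different ones. Under call by name the argument runs in the midst of the function
-- body, so a store history splits into a share of the function and one of the argument only because
-- no cell belongs to both. Soundness reads this off the split in `Typed`; adequacy carries it as
-- `Apart` and `Shared`.
--
-- For definability, choice alone would supply elements in any order and number; a cell that must be
-- found at `i` and is advanced to its successor pins the sequence down. Conditionals exist at base
-- types only, so the construction treats finite families of elements and delays the choice to the
-- base result type.

module FullAbstraction (𝒜 : Arithmetic) where

  open SCI 𝒜
  open Arithmetic 𝒜


  -- Renaming and substitution

  cong₃ : {X Y Z W : Set} (f : X → Y → Z → W) {x x′ : X} {y y′ : Y} {z z′ : Z} →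
          x ≡ x′ → y ≡ y′ → z ≡ z′ → f x y z ≡ f x′ y′ z′
  cong₃ f refl refl refl = refl

  rename-id : {ρ : Fin n → Fin n} → (∀ i → ρ i ≡ i) → ∀ M → rename ρ M ≡ M
  rename-id h (` i) = cong `_ (h i)
  rename-id h (ƛ A M) = cong (ƛ A) (rename-id (λ { zero → refl ; (suc i) → cong suc (h i) }) M)
  rename-id h (M · N) = cong₂ _·_ (rename-id h M) (rename-id h N)
  rename-id h (# x) = refl
  rename-id h (op o M N) = cong₂ (op o) (rename-id h M) (rename-id h N)
  rename-id h skip = refl
  rename-id h (M ⨾ N) = cong₂ _⨾_ (rename-id h M) (rename-id h N)
  rename-id h (M ≔ N) = cong₂ _≔_ (rename-id h M) (rename-id h N)
  rename-id h (! M) = cong !_ (rename-id h M)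
  rename-id h (while M N) = cong₂ while (rename-id h M) (rename-id h N)
  rename-id h (ifzero M N₁ N₂) =
    cong₃ ifzero (rename-id h M) (rename-id h N₁) (rename-id h N₂)
  rename-id h (new M) = cong new (rename-id (λ { zero → refl ; (suc i) → cong suc (h i) }) M)
  rename-id h random = refl
  rename-id h (mkvar M N) = cong₂ mkvar (rename-id h M) (rename-id h N)

  rename-rename : {ρ₁ : Fin k → Fin l} {ρ₂ : Fin l → Fin m} {ρ : Fin k → Fin m} →
                  (∀ i → ρ₂ (ρ₁ i) ≡ ρ i) →
                  ∀ M → rename ρ₂ (rename ρ₁ M) ≡ rename ρ M
  rename-rename h (` i) = cong `_ (h i)
  rename-rename h (ƛ A M) =
    cong (ƛ A) (rename-rename (λ { zero → refl ; (suc i) → cong suc (h i) }) M)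
  rename-rename h (M · N) = cong₂ _·_ (rename-rename h M) (rename-rename h N)
  rename-rename h (# x) = refl
  rename-rename h (op o M N) = cong₂ (op o) (rename-rename h M) (rename-rename h N)
  rename-rename h skip = refl
  rename-rename h (M ⨾ N) = cong₂ _⨾_ (rename-rename h M) (rename-rename h N)
  rename-rename h (M ≔ N) = cong₂ _≔_ (rename-rename h M) (rename-rename h N)
  rename-rename h (! M) = cong !_ (rename-rename h M)
  rename-rename h (while M N) = cong₂ while (rename-rename h M) (rename-rename h N)
  rename-rename h (ifzero M N₁ N₂) =
    cong₃ ifzero (rename-rename h M) (rename-rename h N₁) (rename-rename h N₂)
  rename-rename h (new M) =
    cong new (rename-rename (λ { zero → refl ; (suc i) → cong suc (h i) }) M)
  rename-rename h random = refl
  rename-rename h (mkvar M N) = cong₂ mkvar (rename-rename h M) (rename-rename h N)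

  rename-ext-suc : (ρ : Fin m → Fin n) (M : Tm m) →
                   rename (ext ρ) (rename suc M) ≡ rename suc (rename ρ M)
  rename-ext-suc ρ M =
    trans (rename-rename (λ _ → refl) M) (sym (rename-rename (λ _ → refl) M))

  substitute-rename : {ρ : Fin k → Fin l} {θ : Fin l → Tm m} {θ′ : Fin k → Tm m} →
                      (∀ i → θ (ρ i) ≡ θ′ i) →
                      ∀ M → substitute θ (rename ρ M) ≡ substitute θ′ M
  substitute-rename h (` i) = h i
  substitute-rename h (ƛ A M) =
    cong (ƛ A) (substitute-rename (λ { zero → refl ; (suc i) → cong (rename suc) (h i) }) M)
  substitute-rename h (M · N) = cong₂ _·_ (substitute-rename h M) (substitute-rename h N)
  substitute-rename h (# x) = refl
  substitute-rename h (op o M N) = cong₂ (op o) (substitute-rename h M) (substitute-rename h N)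
  substitute-rename h skip = refl
  substitute-rename h (M ⨾ N) = cong₂ _⨾_ (substitute-rename h M) (substitute-rename h N)
  substitute-rename h (M ≔ N) = cong₂ _≔_ (substitute-rename h M) (substitute-rename h N)
  substitute-rename h (! M) = cong !_ (substitute-rename h M)
  substitute-rename h (while M N) = cong₂ while (substitute-rename h M) (substitute-rename h N)
  substitute-rename h (ifzero M N₁ N₂) =
    cong₃ ifzero (substitute-rename h M) (substitute-rename h N₁) (substitute-rename h N₂)
  substitute-rename h (new M) =
    cong new (substitute-rename (λ { zero → refl ; (suc i) → cong (rename suc) (h i) }) M)
  substitute-rename h random = refl
  substitute-rename h (mkvar M N) = cong₂ mkvar (substitute-rename h M) (substitute-rename h N)

  rename-substitute : {θ : Fin k → Tm l} {ρ : Fin l → Fin m} {θ′ : Fin k → Tm m} →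
                      (∀ i → rename ρ (θ i) ≡ θ′ i) →
                      ∀ M → rename ρ (substitute θ M) ≡ substitute θ′ M
  rename-substitute-lift : {θ : Fin k → Tm l} {ρ : Fin l → Fin m} {θ′ : Fin k → Tm m} →
                           (∀ i → rename ρ (θ i) ≡ θ′ i) →
                           ∀ i → rename (ext ρ) (exts θ i) ≡ exts θ′ i
  rename-substitute-lift h zero    = refl
  rename-substitute-lift h (suc i) =
    trans (rename-ext-suc _ _) (cong (rename suc) (h i))
  rename-substitute h (` i) = h i
  rename-substitute h (ƛ A M) = cong (ƛ A) (rename-substitute (rename-substitute-lift h) M)
  rename-substitute h (M · N) = cong₂ _·_ (rename-substitute h M) (rename-substitute h N)
  rename-substitute h (# x) = refl
  rename-substitute h (op o M N) = cong₂ (op o) (rename-substitute h M) (rename-substitute h N)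
  rename-substitute h skip = refl
  rename-substitute h (M ⨾ N) = cong₂ _⨾_ (rename-substitute h M) (rename-substitute h N)
  rename-substitute h (M ≔ N) = cong₂ _≔_ (rename-substitute h M) (rename-substitute h N)
  rename-substitute h (! M) = cong !_ (rename-substitute h M)
  rename-substitute h (while M N) = cong₂ while (rename-substitute h M) (rename-substitute h N)
  rename-substitute h (ifzero M N₁ N₂) =
    cong₃ ifzero (rename-substitute h M) (rename-substitute h N₁) (rename-substitute h N₂)
  rename-substitute h (new M) = cong new (rename-substitute (rename-substitute-lift h) M)
  rename-substitute h random = refl
  rename-substitute h (mkvar M N) = cong₂ mkvar (rename-substitute h M) (rename-substitute h N)

  substitute-substitute :
    {θ₁ : Fin k → Tm l} {θ₂ : Fin l → Tm m} {θ : Fin k → Tm m} →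
    (∀ i → substitute θ₂ (θ₁ i) ≡ θ i) →
    ∀ M → substitute θ₂ (substitute θ₁ M) ≡ substitute θ M
  substitute-substitute-lift :
    {θ₁ : Fin k → Tm l} {θ₂ : Fin l → Tm m} {θ : Fin k → Tm m} →
    (∀ i → substitute θ₂ (θ₁ i) ≡ θ i) →
    ∀ i → substitute (exts θ₂) (exts θ₁ i) ≡ exts θ i
  substitute-substitute-lift h zero = refl
  substitute-substitute-lift {θ₁ = θ₁} h (suc i) =
    trans (substitute-rename (λ _ → refl) (θ₁ i))
          (trans (sym (rename-substitute (λ _ → refl) (θ₁ i)))
                 (cong (rename suc) (h i)))
  substitute-substitute h (` i) = h i
  substitute-substitute h (ƛ A M) =
    cong (ƛ A) (substitute-substitute (substitute-substitute-lift h) M)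
  substitute-substitute h (M · N) =
    cong₂ _·_ (substitute-substitute h M) (substitute-substitute h N)
  substitute-substitute h (# x) = refl
  substitute-substitute h (op o M N) =
    cong₂ (op o) (substitute-substitute h M) (substitute-substitute h N)
  substitute-substitute h skip = refl
  substitute-substitute h (M ⨾ N) =
    cong₂ _⨾_ (substitute-substitute h M) (substitute-substitute h N)
  substitute-substitute h (M ≔ N) =
    cong₂ _≔_ (substitute-substitute h M) (substitute-substitute h N)
  substitute-substitute h (! M) = cong !_ (substitute-substitute h M)
  substitute-substitute h (while M N) =
    cong₂ while (substitute-substitute h M) (substitute-substitute h N)
  substitute-substitute h (ifzero M N₁ N₂) =
    cong₃ ifzero (substitute-substitute h M) (substitute-substitute h N₁) (substitute-substitute h N₂)
  substitute-substitute h (new M) =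
    cong new (substitute-substitute (substitute-substitute-lift h) M)
  substitute-substitute h random = refl
  substitute-substitute h (mkvar M N) =
    cong₂ mkvar (substitute-substitute h M) (substitute-substitute h N)

  substitute-vars : {θ : Fin m → Tm n} {ρ : Fin m → Fin n} → (∀ i → θ i ≡ ` ρ i) →
                    ∀ M → substitute θ M ≡ rename ρ M
  substitute-vars h (` i) = h i
  substitute-vars h (ƛ A M) =
    cong (ƛ A) (substitute-vars (λ { zero → refl ; (suc i) → cong (rename suc) (h i) }) M)
  substitute-vars h (M · N) = cong₂ _·_ (substitute-vars h M) (substitute-vars h N)
  substitute-vars h (# x) = refl
  substitute-vars h (op o M N) = cong₂ (op o) (substitute-vars h M) (substitute-vars h N)
  substitute-vars h skip = refl
  substitute-vars h (M ⨾ N) = cong₂ _⨾_ (substitute-vars h M) (substitute-vars h N)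
  substitute-vars h (M ≔ N) = cong₂ _≔_ (substitute-vars h M) (substitute-vars h N)
  substitute-vars h (! M) = cong !_ (substitute-vars h M)
  substitute-vars h (while M N) = cong₂ while (substitute-vars h M) (substitute-vars h N)
  substitute-vars h (ifzero M N₁ N₂) =
    cong₃ ifzero (substitute-vars h M) (substitute-vars h N₁) (substitute-vars h N₂)
  substitute-vars h (new M) =
    cong new (substitute-vars (λ { zero → refl ; (suc i) → cong (rename suc) (h i) }) M)
  substitute-vars h random = refl
  substitute-vars h (mkvar M N) = cong₂ mkvar (substitute-vars h M) (substitute-vars h N)

  -- Untyped traces

  infixr 6 _⇒_

  data Tr : Set where
    nm  : ℕ → Tr
    ⋆   : Tr
    acc : Access → Tr
    _⇒_ : List Tr → Tr → Tr

  infix 4 _∈_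

  data _∈_ : Tr → Ty → Set where
    nm  : ∀ {x} → nm x ∈ nat
    ⋆   : ⋆ ∈ comm
    acc : ∀ {a} → acc a ∈ var
    _⇒_ : ∀ {A B as b} → All (_∈ A) as → b ∈ B → as ⇒ b ∈ A ⊸ B

  data BaseTrace : Tr → Set where
    nm  : ∀ {x} → BaseTrace (nm x)
    ⋆   : BaseTrace ⋆
    acc : ∀ {a} → BaseTrace (acc a)

  data GroundTrace : Tr → Set where
    nm  : ∀ {x} → GroundTrace (nm x)
    ⋆   : GroundTrace ⋆

  -- Unlike `CellFrom`, it also records the final contents of the cell, so that histories can be
  -- composed end to end and matched with the stores before and after an evaluation.
  data Path : ℕ → List Tr → ℕ → Set where
    []     : ∀ {x} → Path x [] x
    read∷  : ∀ {x y t} → Path x t y → Path x (acc (read x) ∷ t) y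
    write∷ : ∀ {x y z t} → Path y t z → Path x (acc (write y) ∷ t) z

  -- Environments are functions compared pointwise, so the monoid laws hold without function
  -- extensionality and `Many` can reuse `Ext`.
  envs : ℕ → Monoid 0ℓ 0ℓ
  envs n = Pointwise.monoid (Fin n) (++-monoid Tr)

  Env : ℕ → Set
  Env n = Fin n → List Tr

  infixr 7 _⊕_
  infixr 5 _▹_

  ∅ : Env n
  ∅ _ = []

  _⊕_ : Env n → Env n → Env n
  (s ⊕ t) i = s i ++ t i

  _▹_ : List Tr → Env n → Env (suc n)
  (t ▹ s) zero    = t
  (t ▹ s) (suc i) = s i

  ▹-η : (u : Env (suc n)) → u ≗ (u zero ▹ (u ∘ suc))
  ▹-η u zero    = refl
  ▹-η u (suc i) = refl

  Single : Fin n → Tr → Env n → Set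
  Single i a s = s i ≡ [ a ] × (∀ j → j ≢ i → s j ≡ [])

  Seq : (Env n → Set) → (Env n → Set) → Env n → Set
  Seq P Q u = ∃₂ λ s t → u ≗ s ⊕ t × P s × Q t

  data Iterate (G B : Env n → Set) (E : Env n → Set) : Env n → Set where
    exit : ∀ {s} → E s → Iterate G B E s
    iter : ∀ {u s t s′} → u ≗ s ⊕ t ⊕ s′ →
           G s → B t → Iterate G B E s′ → Iterate G B E u

  Many : (Env n → Tr → Set) → Env n → List Tr → Set
  Many {n} = Ext (envs n)

  Branch : (Env n → Tr → Set) → (Env n → Set) → (Env n → Set) → Env n → Set
  Branch G P Q u =
    Seq (λ s → G s (nm 0)) P u ⊎
    Seq (λ s → ∃ λ x → x ≢ 0 × G s (nm x)) Q u

  -- The denotation of a raw term, independent of any typing derivation.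
  ⟪_⟫ : Tm n → Env n → Tr → Set
  ⟪ ` i ⟫           s b = Single i b s
  -- Without the bound by `A`, the identity function would have traces of every type.
  ⟪ ƛ A M ⟫         s c =
    ∃₂ λ as b → c ≡ as ⇒ b × All (_∈ A) as × ⟪ M ⟫ (as ▹ s) b
  ⟪ M · N ⟫         u b =
    ∃ λ as → Seq (λ s → ⟪ M ⟫ s (as ⇒ b)) (λ t → Many ⟪ N ⟫ t as) u
  ⟪ # x ⟫           s b = s ≗ ∅ × b ≡ nm x
  ⟪ op o M N ⟫      u b =
    ∃₂ λ x y → b ≡ nm (apply o x y) ×
    Seq (λ s → ⟪ M ⟫ s (nm x)) (λ t → ⟪ N ⟫ t (nm y)) u
  ⟪ skip ⟫          s b = s ≗ ∅ × b ≡ ⋆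
  -- The guards `BaseTrace` and `GroundTrace` mirror the side conditions on the result type. In
  -- `fundamental`, which assumes no typing of the environment, they are the only source of this
  -- information.
  ⟪ M ⨾ N ⟫         u b = BaseTrace b × Seq (λ s → ⟪ M ⟫ s ⋆) (λ t → ⟪ N ⟫ t b) u
  ⟪ M ≔ N ⟫         u b =
    ∃ λ x → b ≡ ⋆ ×
    Seq (λ s → ⟪ N ⟫ s (nm x)) (λ t → ⟪ M ⟫ t (acc (write x))) u
  ⟪ ! M ⟫           s b = ∃ λ x → b ≡ nm x × ⟪ M ⟫ s (acc (read x))
  ⟪ while M N ⟫     s b =
    b ≡ ⋆ × Iterate (λ s → ⟪ M ⟫ s (nm 0)) (λ t → ⟪ N ⟫ t ⋆)
                    (λ s → ∃ λ x → x ≢ 0 × ⟪ M ⟫ s (nm x)) s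
  ⟪ ifzero M N₁ N₂ ⟫ u b =
    BaseTrace b × Branch ⟪ M ⟫ (λ t → ⟪ N₁ ⟫ t b) (λ t → ⟪ N₂ ⟫ t b) u
  ⟪ new M ⟫         s b =
    GroundTrace b × ∃₂ λ t y → Path 0 t y × ⟪ M ⟫ (t ▹ s) b
  ⟪ random ⟫        s b = s ≗ ∅ × ∃ λ x → b ≡ nm x
  ⟪ mkvar M N ⟫     s b =
    (∃₂ λ x k → b ≡ acc (write x) × ⟪ M ⟫ s (replicate k (nm x) ⇒ ⋆)) ⊎
    (∃ λ x → b ≡ acc (read x) × ⟪ N ⟫ s (nm x))

  ≗-sym : {s t : Env n} → s ≗ t → t ≗ s
  ≗-sym h i = sym (h i)

  ≗-trans : {s t u : Env n} → s ≗ t → t ≗ u → s ≗ u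
  ≗-trans h h′ i = trans (h i) (h′ i)

  ▹-cong : ∀ {as} {s t : Env n} → s ≗ t → (as ▹ s) ≗ (as ▹ t)
  ▹-cong h zero    = refl
  ▹-cong h (suc i) = h i

  Seq-resp : {P Q : Env n → Set} {u u′ : Env n} → u ≗ u′ → Seq P Q u → Seq P Q u′
  Seq-resp h (s , t , e , p , q) = s , t , ≗-trans (≗-sym h) e , p , q

  Iterate-resp : {G B E : Env n → Set} →
                 (∀ {s s′} → s ≗ s′ → E s → E s′) →
                 {u u′ : Env n} → u ≗ u′ → Iterate G B E u → Iterate G B E u′
  Iterate-resp r h (exit x)       = exit (r h x)
  Iterate-resp r h (iter e g b l) = iter (≗-trans (≗-sym h) e) g b l

  resp : (M : Tm n) {s s′ : Env n} {b : Tr} → s ≗ s′ → ⟪ M ⟫ s b → ⟪ M ⟫ s′ b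
  resp (` i) h (p , q) = trans (sym (h i)) p , λ j j≢i → trans (sym (h j)) (q j j≢i)
  resp (ƛ A M) h (as , b , e , as∈A , d) = as , b , e , as∈A , resp M (▹-cong h) d
  resp (M · N) h (as , d) = as , Seq-resp h d
  resp (# x) h (e , d) = ≗-trans (≗-sym h) e , d
  resp (op o M N) h (x , y , e , d) = x , y , e , Seq-resp h d
  resp skip h (e , d) = ≗-trans (≗-sym h) e , d
  resp (M ⨾ N) h (b , d) = b , Seq-resp h d
  resp (M ≔ N) h (x , e , d) = x , e , Seq-resp h d
  resp (! M) h (x , e , d) = x , e , resp M h d
  resp (while M N) h (e , d) =
    e , Iterate-resp (λ h (x , x≢0 , d) → x , x≢0 , resp M h d) h d
  resp (ifzero M N₁ N₂) h (b , inj₁ d) = b , inj₁ (Seq-resp h d)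
  resp (ifzero M N₁ N₂) h (b , inj₂ d) = b , inj₂ (Seq-resp h d)
  resp (new M) h (g , t , y , p , d) = g , t , y , p , resp M (▹-cong h) d
  resp random h (e , d) = ≗-trans (≗-sym h) e , d
  resp (mkvar M N) h (inj₁ (x , k , e , d)) = inj₁ (x , k , e , resp M h d)
  resp (mkvar M N) h (inj₂ (x , e , d)) = inj₂ (x , e , resp N h d)

  Many-resp : (M : Tm n) {s s′ : Env n} {as : List Tr} →
              s ≗ s′ → Many ⟪ M ⟫ s as → Many ⟪ M ⟫ s′ as
  Many-resp M h ([] e)      = [] (≗-trans (≗-sym h) e)
  Many-resp M h ((e , d) ∷ ds) = (≗-trans (≗-sym h) e , d) ∷ ds

  -- Simulations

  -- The clauses of `⟪_⟫` combine environments by `∅` and `⊕` alone, so compatibility with these two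
  -- is all that is needed to carry traces along compound terms.
  record Simulation (Φ : Env m → Env n → Set) : Set where
    field
      unit : ∀ {u} → u ≗ ∅ → Φ u ∅
      mult : ∀ {u s t s′ t′} → u ≗ s ⊕ t → Φ s s′ → Φ t t′ → Φ u (s′ ⊕ t′)

  module Simulate {Φ : Env m → Env n → Set} (sim : Simulation Φ) where
    open Simulation sim

    ◇ : (Env n → Set) → Env m → Set
    ◇ P s = ∃ λ s′ → Φ s s′ × P s′

    ◇-map : ∀ {P Q : Env n → Set} {u} → (∀ {s} → P s → Q s) → ◇ P u → ◇ Q u
    ◇-map f (s , φ , p) = s , φ , f p

    pure : ∀ {X : Set} {u} → u ≗ ∅ × X → ◇ (λ u′ → u′ ≗ ∅ × X) u
    pure (e , x) = ∅ , unit e , (λ _ → refl) , x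

    seq-sim : ∀ {P Q P′ Q′} → (∀ {s} → P s → ◇ P′ s) → (∀ {s} → Q s → ◇ Q′ s) →
          ∀ {u} → Seq P Q u → ◇ (Seq P′ Q′) u
    seq-sim f g (s , t , e , p , q) with f p | g q
    ... | s′ , φ , p′ | t′ , φ′ , q′ =
      s′ ⊕ t′ , mult e φ φ′ , s′ , t′ , (λ _ → refl) , p′ , q′

    many-sim : ∀ {P P′} → (∀ {s a} → P s a → ◇ (λ s′ → P′ s′ a) s) →
           ∀ {u as} → Many P u as → ◇ (λ u′ → Many P′ u′ as) u
    many-sim f ([] e) = ∅ , unit e , [] λ _ → refl
    many-sim f ((e , p) ∷ ps) with f p | many-sim f ps
    ... | s′ , φ , p′ | t′ , φ′ , ps′ =
      s′ ⊕ t′ , mult e φ φ′ , ((λ _ → refl) , p′) ∷ ps′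

    iterate-sim : ∀ {G B E G′ B′ E′} →
              (∀ {s} → G s → ◇ G′ s) → (∀ {s} → B s → ◇ B′ s) →
              (∀ {s} → E s → ◇ E′ s) →
              ∀ {u} → Iterate G B E u → ◇ (Iterate G′ B′ E′) u
    iterate-sim f g h (exit x) = ◇-map exit (h x)
    iterate-sim f g h (iter e x y l) with f x | g y | iterate-sim f g h l
    ... | s′ , φ , x′ | t′ , φ′ , y′ | v′ , φ″ , l′ =
      s′ ⊕ t′ ⊕ v′ , mult e φ (mult (λ _ → refl) φ′ φ″) ,
      iter (λ _ → refl) x′ y′ l′

    branch-sim : ∀ {G G′ P P′ Q Q′} →
      (∀ {s a} → G s a → ◇ (λ s′ → G′ s′ a) s) →
      (∀ {s} → P s → ◇ P′ s) → (∀ {s} → Q s → ◇ Q′ s) →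
      ∀ {u} → Branch G P Q u → ◇ (Branch G′ P′ Q′) u
    branch-sim f g h (inj₁ d) = ◇-map inj₁ (seq-sim f g d)
    branch-sim f g h (inj₂ d) =
      ◇-map inj₂ (seq-sim (λ (x , x≢0 , d) → ◇-map (λ d → x , x≢0 , d) (f d)) h d)

  Lift : (Env m → Env n → Set) → Env (suc m) → Env (suc n) → Set
  Lift Φ u v = v zero ≡ u zero × Φ (u ∘ suc) (v ∘ suc)

  lift-sim : {Φ : Env m → Env n → Set} → Simulation Φ → Simulation (Lift Φ)
  lift-sim sim = record
    { unit = λ e → sym (e zero) , unit (e ∘ suc)
    ; mult = λ e (p , φ) (q , ψ) →
        trans (cong₂ _++_ p q) (sym (e zero)) , mult (e ∘ suc) φ ψ
    } where open Simulation sim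

  unlift : {Φ : Env m → Env n → Set} (M : Tm (suc n)) → ∀ {as s b} →
           (∃ λ v → Lift Φ (as ▹ s) v × ⟪ M ⟫ v b) →
           ∃ λ s′ → Φ s s′ × ⟪ M ⟫ (as ▹ s′) b
  unlift M (v , (e , φ) , d) =
    v ∘ suc , φ , resp M (λ { zero → e ; (suc i) → refl }) d

  -- Renaming in either direction, substitution and plugging into contexts differ
  -- only in what happens at the leaves.
  infix 4 _⊢_≲_

  data _⊢_≲_ {m n : ℕ} (Φ : Env m → Env n → Set) : Tm m → Tm n → Set₁ where
    leaf   : ∀ {M M′} → (∀ {s b} → ⟪ M ⟫ s b → ∃ λ s′ → Φ s s′ × ⟪ M′ ⟫ s′ b) →
             Φ ⊢ M ≲ M′
    ƛ      : ∀ A {M M′} → Lift Φ ⊢ M ≲ M′ → Φ ⊢ ƛ A M ≲ ƛ A M′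
    _·_    : ∀ {M M′ N N′} → Φ ⊢ M ≲ M′ → Φ ⊢ N ≲ N′ → Φ ⊢ M · N ≲ M′ · N′
    #_     : ∀ x → Φ ⊢ # x ≲ # x
    op     : ∀ o {M M′ N N′} → Φ ⊢ M ≲ M′ → Φ ⊢ N ≲ N′ → Φ ⊢ op o M N ≲ op o M′ N′
    skip   : Φ ⊢ skip ≲ skip
    _⨾_    : ∀ {M M′ N N′} → Φ ⊢ M ≲ M′ → Φ ⊢ N ≲ N′ → Φ ⊢ M ⨾ N ≲ M′ ⨾ N′
    _≔_    : ∀ {M M′ N N′} → Φ ⊢ M ≲ M′ → Φ ⊢ N ≲ N′ → Φ ⊢ M ≔ N ≲ M′ ≔ N′
    !_     : ∀ {M M′} → Φ ⊢ M ≲ M′ → Φ ⊢ ! M ≲ ! M′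
    while  : ∀ {M M′ N N′} → Φ ⊢ M ≲ M′ → Φ ⊢ N ≲ N′ → Φ ⊢ while M N ≲ while M′ N′
    ifzero : ∀ {M M′ N₁ N₁′ N₂ N₂′} → Φ ⊢ M ≲ M′ → Φ ⊢ N₁ ≲ N₁′ → Φ ⊢ N₂ ≲ N₂′ →
             Φ ⊢ ifzero M N₁ N₂ ≲ ifzero M′ N₁′ N₂′
    new    : ∀ {M M′} → Lift Φ ⊢ M ≲ M′ → Φ ⊢ new M ≲ new M′
    random : Φ ⊢ random ≲ random
    mkvar  : ∀ {M M′ N N′} → Φ ⊢ M ≲ M′ → Φ ⊢ N ≲ N′ → Φ ⊢ mkvar M N ≲ mkvar M′ N′

  simulate : {Φ : Env m → Env n → Set} → Simulation Φ →
             {M : Tm m} {M′ : Tm n} → Φ ⊢ M ≲ M′ →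
             ∀ {s b} → ⟪ M ⟫ s b → ∃ λ s′ → Φ s s′ × ⟪ M′ ⟫ s′ b
  simulate {Φ = Φ} sim = go
    where
    open Simulate sim
    go : ∀ {M M′} → Φ ⊢ M ≲ M′ → ∀ {s b} → ⟪ M ⟫ s b → ∃ λ s′ → Φ s s′ × ⟪ M′ ⟫ s′ b
    go (leaf f) d = f d
    go (ƛ A {M′ = M′} f) (as , b , e , as∈A , d)
      with unlift {Φ = Φ} M′ (simulate (lift-sim sim) f d)
    ... | s , φ , d′ = s , φ , as , b , e , as∈A , d′
    go (f · g) (as , d) = ◇-map (as ,_) (seq-sim (go f) (many-sim (go g)) d)
    go (# x) d = pure d
    go (op o f g) (x , y , e , d) = ◇-map (λ d → x , y , e , d) (seq-sim (go f) (go g) d)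
    go skip d = pure d
    go (f ⨾ g) (b , d) = ◇-map (b ,_) (seq-sim (go f) (go g) d)
    go (f ≔ g) (x , e , d) = ◇-map (λ d → x , e , d) (seq-sim (go g) (go f) d)
    go (! f) (x , e , d) = ◇-map (λ d → x , e , d) (go f d)
    go (while f g) (e , d) =
      ◇-map (e ,_) (iterate-sim (go f) (go g)
        (λ (x , x≢0 , d) → ◇-map (λ d → x , x≢0 , d) (go f d)) d)
    go (ifzero f g h) (b , d) = ◇-map (b ,_) (branch-sim {G = ⟪ _ ⟫} {G′ = ⟪ _ ⟫} (go f) (go g) (go h) d)
    go (new {M′ = M′} f) (g , t , y , p , d)
      with unlift {Φ = Φ} M′ (simulate (lift-sim sim) f d)
    ... | s , φ , d′ = s , φ , g , t , y , p , d′
    go random d = pure d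
    go (mkvar f g) (inj₁ (x , k , e , d)) = ◇-map (λ d → inj₁ (x , k , e , d)) (go f d)
    go (mkvar f g) (inj₂ (x , e , d)) = ◇-map (λ d → inj₂ (x , e , d)) (go g d)

  single : Fin n → Tr → Env n
  single i a j with i ≟ᶠ j
  ... | yes _ = [ a ]
  ... | no _  = []

  single-Single : (i : Fin n) (a : Tr) → Single i a (single i a)
  single-Single i a = here , there
    where
    here : single i a i ≡ [ a ]
    here with i ≟ᶠ i
    ... | yes _  = refl
    ... | no i≢i = ⊥-elim (i≢i refl)
    there : ∀ j → j ≢ i → single i a j ≡ []
    there j j≢i with i ≟ᶠ j
    ... | yes e = ⊥-elim (j≢i (sym e))
    ... | no _  = refl

  Single-unique : ∀ {i : Fin n} {a s} → Single i a s → s ≗ single i a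
  Single-unique {i = i} (p , q) j with i ≟ᶠ j
  ... | yes refl = p
  ... | no i≢j   = q j (i≢j ∘ sym)

  Single-zero : ∀ {a} {s : Env (suc n)} → Single zero a s → s zero ≡ [ a ] × s ∘ suc ≗ ∅
  Single-zero (p , q) = p , λ i → q (suc i) λ ()

  zero-Single : ∀ {a} → Single {suc n} zero a ([ a ] ▹ ∅)
  zero-Single = refl , λ { zero h → ⊥-elim (h refl) ; (suc j) h → refl }

  Single-suc : ∀ {i a} {s : Env (suc n)} → Single (suc i) a s → s zero ≡ [] × Single i a (s ∘ suc)
  Single-suc (p , q) = q zero (λ ()) , p , λ j h → q (suc j) λ { refl → h refl }

  suc-Single : ∀ {i a} {s : Env n} → Single i a s → Single (suc i) a ([] ▹ s)
  suc-Single (p , q) = p , λ { zero _ → refl ; (suc j) h → q j (h ∘ cong suc) }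

  module _ {Φ : Env m → Env n → Set} (sim : Simulation Φ) where
    open Simulation sim

    lift-zero : ∀ {a} {s : Env (suc m)} → Single zero a s →
                ∃ λ s′ → Lift Φ s s′ × Single zero a s′
    lift-zero d with Single-zero d
    ... | p , q = _ , (sym p , unit q) , zero-Single

  rename≳ : (ρ : Fin m → Fin n) {Φ : Env m → Env n → Set} → Simulation Φ →
            (∀ i {s a} → Single i a s → ∃ λ s′ → Φ s s′ × Single (ρ i) a s′) →
            ∀ M → Φ ⊢ M ≲ rename ρ M
  rename≳-lift : (ρ : Fin m → Fin n) {Φ : Env m → Env n → Set} → Simulation Φ →
            (∀ i {s a} → Single i a s → ∃ λ s′ → Φ s s′ × Single (ρ i) a s′) →
            ∀ i {s a} → Single i a s → ∃ λ s′ → Lift Φ s s′ × Single (ext ρ i) a s′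
  rename≳-lift ρ sim h zero d = lift-zero sim d
  rename≳-lift ρ sim h (suc i) d with Single-suc d
  ... | p , q with h i q
  ... | s′ , φ , q′ = [] ▹ s′ , (sym p , φ) , suc-Single q′
  rename≳ ρ sim h (` i) = leaf (h i)
  rename≳ ρ sim h (ƛ A M) = ƛ A (rename≳ (ext ρ) (lift-sim sim) (rename≳-lift ρ sim h) M)
  rename≳ ρ sim h (M · N) = rename≳ ρ sim h M · rename≳ ρ sim h N
  rename≳ ρ sim h (# x) = # x
  rename≳ ρ sim h (op o M N) = op o (rename≳ ρ sim h M) (rename≳ ρ sim h N)
  rename≳ ρ sim h skip = skip
  rename≳ ρ sim h (M ⨾ N) = rename≳ ρ sim h M ⨾ rename≳ ρ sim h N
  rename≳ ρ sim h (M ≔ N) = rename≳ ρ sim h M ≔ rename≳ ρ sim h N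
  rename≳ ρ sim h (! M) = ! rename≳ ρ sim h M
  rename≳ ρ sim h (while M N) = while (rename≳ ρ sim h M) (rename≳ ρ sim h N)
  rename≳ ρ sim h (ifzero M N₁ N₂) =
    ifzero (rename≳ ρ sim h M) (rename≳ ρ sim h N₁) (rename≳ ρ sim h N₂)
  rename≳ ρ sim h (new M) = new (rename≳ (ext ρ) (lift-sim sim) (rename≳-lift ρ sim h) M)
  rename≳ ρ sim h random = random
  rename≳ ρ sim h (mkvar M N) = mkvar (rename≳ ρ sim h M) (rename≳ ρ sim h N)

  rename≲ : (ρ : Fin m → Fin n) {Φ : Env n → Env m → Set} → Simulation Φ →
            (∀ i {s a} → Single (ρ i) a s → ∃ λ s′ → Φ s s′ × Single i a s′) →
            ∀ M → Φ ⊢ rename ρ M ≲ M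
  rename≲-lift : (ρ : Fin m → Fin n) {Φ : Env n → Env m → Set} → Simulation Φ →
            (∀ i {s a} → Single (ρ i) a s → ∃ λ s′ → Φ s s′ × Single i a s′) →
            ∀ i {s a} → Single (ext ρ i) a s → ∃ λ s′ → Lift Φ s s′ × Single i a s′
  rename≲-lift ρ sim h zero d = lift-zero sim d
  rename≲-lift ρ sim h (suc i) d with Single-suc d
  ... | p , q with h i q
  ... | s′ , φ , q′ = [] ▹ s′ , (sym p , φ) , suc-Single q′
  rename≲ ρ sim h (` i) = leaf (h i)
  rename≲ ρ sim h (ƛ A M) = ƛ A (rename≲ (ext ρ) (lift-sim sim) (rename≲-lift ρ sim h) M)
  rename≲ ρ sim h (M · N) = rename≲ ρ sim h M · rename≲ ρ sim h N
  rename≲ ρ sim h (# x) = # x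
  rename≲ ρ sim h (op o M N) = op o (rename≲ ρ sim h M) (rename≲ ρ sim h N)
  rename≲ ρ sim h skip = skip
  rename≲ ρ sim h (M ⨾ N) = rename≲ ρ sim h M ⨾ rename≲ ρ sim h N
  rename≲ ρ sim h (M ≔ N) = rename≲ ρ sim h M ≔ rename≲ ρ sim h N
  rename≲ ρ sim h (! M) = ! rename≲ ρ sim h M
  rename≲ ρ sim h (while M N) = while (rename≲ ρ sim h M) (rename≲ ρ sim h N)
  rename≲ ρ sim h (ifzero M N₁ N₂) =
    ifzero (rename≲ ρ sim h M) (rename≲ ρ sim h N₁) (rename≲ ρ sim h N₂)
  rename≲ ρ sim h (new M) = new (rename≲ (ext ρ) (lift-sim sim) (rename≲-lift ρ sim h) M)
  rename≲ ρ sim h random = random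
  rename≲ ρ sim h (mkvar M N) = mkvar (rename≲ ρ sim h M) (rename≲ ρ sim h N)

  Along : (Fin m → Fin n) → Env n → Env m → Set
  Along ρ u v = v ≗ u ∘ ρ × (∀ j → (∀ i → ρ i ≢ j) → u j ≡ [])

  Along-unit : (ρ : Fin m → Fin n) {u : Env n} → u ≗ ∅ → Along ρ u ∅
  Along-unit ρ e = (λ i → sym (e (ρ i))) , λ j _ → e j

  Along-mult : (ρ : Fin m → Fin n) {u s t : Env n} {s′ t′ : Env m} →
               u ≗ s ⊕ t → Along ρ s s′ → Along ρ t t′ → Along ρ u (s′ ⊕ t′)
  Along-mult ρ e (p , φ) (q , ψ) =
    (λ i → trans (cong₂ _++_ (p i) (q i)) (sym (e (ρ i)))) ,
    λ j h → trans (e j) (cong₂ _++_ (φ j h) (ψ j h))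

  Inj : (Fin m → Fin n) → Set
  Inj ρ = ∀ {i j} → ρ i ≡ ρ j → i ≡ j

  -- Injectivity enters at identifiers only: a single action at `ρ i` must be seen at `i` and
  -- nowhere else.
  unrename : (ρ : Fin m → Fin n) → Inj ρ → ∀ M {u b} →
             ⟪ rename ρ M ⟫ u b → ⟪ M ⟫ (u ∘ ρ) b × (∀ j → (∀ i → ρ i ≢ j) → u j ≡ [])
  unrename ρ inj M d
    with simulate sim (rename≲ ρ sim leaf′ M) d
    where
    sim : Simulation (Along ρ)
    sim = record { unit = Along-unit ρ ; mult = Along-mult ρ }
    leaf′ : ∀ i {s a} → Single (ρ i) a s → ∃ λ s′ → Along ρ s s′ × Single i a s′
    leaf′ i {s} (p , q) =
      s ∘ ρ , ((λ _ → refl) , λ j h → q j (h i ∘ sym)) , p , λ j j≢i → q (ρ j) (j≢i ∘ inj)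
  ... | v , (p , φ) , d′ = resp M p d′ , φ

  push : (Fin m → Fin n) → Env m → Env n
  push ρ u j with any? (λ i → ρ i ≟ᶠ j)
  ... | yes (i , _) = u i
  ... | no _        = []

  push-in : (ρ : Fin m → Fin n) → Inj ρ → ∀ u i → push ρ u (ρ i) ≡ u i
  push-in ρ inj u i with any? (λ k → ρ k ≟ᶠ ρ i)
  ... | yes (k , e) = cong u (inj e)
  ... | no ¬e       = ⊥-elim (¬e (i , refl))

  push-out : (ρ : Fin m → Fin n) → ∀ u j → (∀ i → ρ i ≢ j) → push ρ u j ≡ []
  push-out ρ u j h with any? (λ k → ρ k ≟ᶠ j)
  ... | yes (k , e) = ⊥-elim (h k e)
  ... | no _        = refl

  push-unique : (ρ : Fin m → Fin n) {v : Env n} {u : Env m} → Along ρ v u → v ≗ push ρ u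
  push-unique ρ {v} (p , φ) j with any? (λ k → ρ k ≟ᶠ j)
  ... | yes (k , refl) = sym (p k)
  ... | no ¬e          = φ j λ i e → ¬e (i , e)

  push-along : (ρ : Fin m → Fin n) → Inj ρ → ∀ u → Along ρ (push ρ u) u
  push-along ρ inj u = (λ i → sym (push-in ρ inj u i)) , push-out ρ u

  rename-push : (ρ : Fin m → Fin n) → Inj ρ → ∀ M {u b} →
                ⟪ M ⟫ u b → ⟪ rename ρ M ⟫ (push ρ u) b
  rename-push {m} {n} ρ inj M d
    with simulate sim (rename≳ ρ sim leaf′ M) d
    where
    Φ : Env m → Env n → Set
    Φ u v = Along ρ v u
    sim : Simulation Φ
    sim = record
      { unit = λ e → (λ i → e i) , λ _ _ → refl
      ; mult = λ e (p , φ) (q , ψ) →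
          (λ i → trans (e i) (cong₂ _++_ (p i) (q i))) , λ j h → cong₂ _++_ (φ j h) (ψ j h)
      }
    leaf′ : ∀ i {s a} → Single i a s → ∃ λ s′ → Φ s s′ × Single (ρ i) a s′
    leaf′ i {s} {a} (p , q) =
      push ρ s , push-along ρ inj s , trans (push-in ρ inj s i) p , off
      where
      off : ∀ j → j ≢ ρ i → push ρ s j ≡ []
      off j j≢ with any? (λ k → ρ k ≟ᶠ j)
      ... | yes (k , refl) = q k λ { refl → j≢ refl }
      ... | no _           = refl
  ... | v , φ , d′ = resp (rename ρ M) (push-unique ρ φ) d′

  rename-along : (ρ : Fin m → Fin n) → Inj ρ → ∀ M {u v b} → Along ρ v u →
                 ⟪ M ⟫ u b → ⟪ rename ρ M ⟫ v b
  rename-along ρ inj M φ d =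
    resp (rename ρ M) (≗-sym (push-unique ρ φ)) (rename-push ρ inj M d)

  suc-inj : Inj {m} suc
  suc-inj refl = refl

  unrename-suc : (M : Tm n) → ∀ {u b} → ⟪ rename suc M ⟫ u b → ⟪ M ⟫ (u ∘ suc) b × u zero ≡ []
  unrename-suc M d with unrename suc suc-inj M d
  ... | d′ , h = d′ , h zero λ _ ()

  rename-suc : (M : Tm n) → ∀ {u b} → ⟪ M ⟫ u b → ⟪ rename suc M ⟫ ([] ▹ u) b
  rename-suc M = rename-along suc suc-inj M
    ((λ _ → refl) , λ { zero _ → refl ; (suc i) h → ⊥-elim (h i refl) })

  -- Affine typing

  infixl 9 _⁺

  _⁺ : (Fin n → Set) → Fin (suc n) → Set
  (P ⁺) zero    = ⊤
  (P ⁺) (suc i) = P i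

  ⁺-mono : {P Q : Fin n → Set} → (∀ i → P i → Q i) → ∀ i → (P ⁺) i → (Q ⁺) i
  ⁺-mono h zero    _ = tt
  ⁺-mono h (suc i) p = h i p

  -- Syntax-directed typing in a fixed context Γ, of which only the identifiers
  -- in P may be used; an application distributes them by means of q.
  data Typed {n} (Γ : Vec Ty n) (P : Fin n → Set) : Tm n → Ty → Set where
    var    : ∀ {i B} → P i → lookup Γ i ≡ B → Typed Γ P (` i) B
    lam    : ∀ {A B M} → Typed (A ∷ Γ) (P ⁺) M B → Typed Γ P (ƛ A M) (A ⊸ B)
    app    : ∀ {A B M N} (q : Fin n → Bool) →
             Typed Γ (λ i → P i × q i ≡ true) M (A ⊸ B) →
             Typed Γ (λ i → P i × q i ≡ false) N A → Typed Γ P (M · N) B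
    num    : ∀ {x} → Typed Γ P (# x) nat
    skip   : Typed Γ P skip comm
    op     : ∀ {o M N} → Typed Γ P M nat → Typed Γ P N nat → Typed Γ P (op o M N) nat
    seq    : ∀ {B M N} → Base B → Typed Γ P M comm → Typed Γ P N B → Typed Γ P (M ⨾ N) B
    assign : ∀ {M N} → Typed Γ P M var → Typed Γ P N nat → Typed Γ P (M ≔ N) comm
    deref  : ∀ {M} → Typed Γ P M var → Typed Γ P (! M) nat
    while  : ∀ {M N} → Typed Γ P M nat → Typed Γ P N comm → Typed Γ P (while M N) comm
    ifzero : ∀ {B M N₁ N₂} → Base B → Typed Γ P M nat → Typed Γ P N₁ B →
             Typed Γ P N₂ B → Typed Γ P (ifzero M N₁ N₂) B
    new    : ∀ {B M} → Ground B → Typed (var ∷ Γ) (P ⁺) M B → Typed Γ P (new M) B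
    random : Typed Γ P random nat
    mkvar  : ∀ {M N} → Typed Γ P M (nat ⊸ comm) → Typed Γ P N nat →
             Typed Γ P (mkvar M N) var

  weaken : {Γ : Vec Ty n} {P Q : Fin n → Set} → (∀ i → P i → Q i) →
           ∀ {M B} → Typed Γ P M B → Typed Γ Q M B
  weaken h (var p e)          = var (h _ p) e
  weaken h (lam d)            = lam (weaken (⁺-mono h) d)
  weaken h (app q d e)        =
    app q (weaken (λ i (p , x) → h i p , x) d) (weaken (λ i (p , x) → h i p , x) e)
  weaken h num                = num
  weaken h skip               = skip
  weaken h (op d e)           = op (weaken h d) (weaken h e)
  weaken h (seq b d e)        = seq b (weaken h d) (weaken h e)
  weaken h (assign d e)       = assign (weaken h d) (weaken h e)
  weaken h (deref d)          = deref (weaken h d)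
  weaken h (while d e)        = while (weaken h d) (weaken h e)
  weaken h (ifzero b d e f)   = ifzero b (weaken h d) (weaken h e) (weaken h f)
  weaken h (new g d)          = new g (weaken (⁺-mono h) d)
  weaken h random             = random
  weaken h (mkvar d e)        = mkvar (weaken h d) (weaken h e)

  -- The form of injectivity that `Typed` asks for: identifiers which some split puts on different
  -- sides may not be merged, and the split must extend to the target.
  Separating : (Fin m → Fin n) → Set
  Separating {m} {n} ρ =
    (q : Fin m → Bool) → ∃ λ (q′ : Fin n → Bool) → ∀ i → q′ (ρ i) ≡ q i

  ext-separating : {ρ : Fin m → Fin n} → Separating ρ → Separating (ext ρ)
  ext-separating s q with s (q ∘ suc)
  ... | q′ , h = (λ { zero → q zero ; (suc j) → q′ j }) , λ { zero → refl ; (suc i) → h i }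

  Typed-rename : {Γ : Vec Ty m} {Δ : Vec Ty n} {P : Fin m → Set} {Q : Fin n → Set}
                 (ρ : Fin m → Fin n) → Separating ρ →
                 (∀ i → lookup Δ (ρ i) ≡ lookup Γ i) → (∀ i → P i → Q (ρ i)) →
                 ∀ {M B} → Typed Γ P M B → Typed Δ Q (rename ρ M) B
  Typed-rename-under :
    {Γ : Vec Ty m} {Δ : Vec Ty n} {P : Fin m → Set} {Q : Fin n → Set}
    (ρ : Fin m → Fin n) → Separating ρ →
    (∀ i → lookup Δ (ρ i) ≡ lookup Γ i) → (∀ i → P i → Q (ρ i)) →
    ∀ {A M B} → Typed (A ∷ Γ) (P ⁺) M B → Typed (A ∷ Δ) (Q ⁺) (rename (ext ρ) M) B
  Typed-rename-under ρ s g h = Typed-rename (ext ρ) (ext-separating s)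
    (λ { zero → refl ; (suc i) → g i }) (λ { zero _ → tt ; (suc i) p → h i p })
  Typed-rename ρ s g h (var p e)        = var (h _ p) (trans (g _) e)
  Typed-rename ρ s g h (lam d)          = lam (Typed-rename-under ρ s g h d)
  Typed-rename ρ s g h (app q d e) with s q
  ... | q′ , eq = app q′
    (Typed-rename ρ s g (λ i (p , x) → h i p , trans (eq i) x) d)
    (Typed-rename ρ s g (λ i (p , x) → h i p , trans (eq i) x) e)
  Typed-rename ρ s g h num              = num
  Typed-rename ρ s g h skip             = skip
  Typed-rename ρ s g h (op d e)         = op (Typed-rename ρ s g h d) (Typed-rename ρ s g h e)
  Typed-rename ρ s g h (seq b d e)      = seq b (Typed-rename ρ s g h d) (Typed-rename ρ s g h e)
  Typed-rename ρ s g h (assign d e)     = assign (Typed-rename ρ s g h d) (Typed-rename ρ s g h e)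
  Typed-rename ρ s g h (deref d)        = deref (Typed-rename ρ s g h d)
  Typed-rename ρ s g h (while d e)      = while (Typed-rename ρ s g h d) (Typed-rename ρ s g h e)
  Typed-rename ρ s g h (ifzero b d e f) =
    ifzero b (Typed-rename ρ s g h d) (Typed-rename ρ s g h e) (Typed-rename ρ s g h f)
  Typed-rename ρ s g h (new b d)        = new b (Typed-rename-under ρ s g h d)
  Typed-rename ρ s g h random           = random
  Typed-rename ρ s g h (mkvar d e)      = mkvar (Typed-rename ρ s g h d) (Typed-rename ρ s g h e)

  suc-separating : Separating {m} suc
  suc-separating q = (λ { zero → true ; (suc i) → q i }) , λ _ → refl

  -- Affinity: each target identifier j may be used by θ i for i = o j only.
  Typed-substitute :
    {Γ : Vec Ty m} {Δ : Vec Ty n} {P : Fin m → Set} {Q : Fin n → Set}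
    (θ : Fin m → Tm n) (o : Fin n → Fin m) →
    (∀ i → P i → Typed Δ (λ j → Q j × o j ≡ i) (θ i) (lookup Γ i)) →
    ∀ {M B} → Typed Γ P M B → Typed Δ Q (substitute θ M) B
  Typed-substitute-under :
    {Γ : Vec Ty m} {Δ : Vec Ty n} {P : Fin m → Set} {Q : Fin n → Set}
    (θ : Fin m → Tm n) (o : Fin n → Fin m) →
    (∀ i → P i → Typed Δ (λ j → Q j × o j ≡ i) (θ i) (lookup Γ i)) →
    ∀ {A M B} → Typed (A ∷ Γ) (P ⁺) M B →
    Typed (A ∷ Δ) (Q ⁺) (substitute (exts θ) M) B
  Typed-substitute-under θ o h = Typed-substitute (exts θ) (ext o)
    λ { zero _ → var (tt , refl) refl
      ; (suc i) p → Typed-rename suc suc-separating (λ _ → refl)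
                      (λ j (q , e) → q , cong suc e) (h i p) }
  Typed-substitute θ o h (var p refl)     = weaken (λ _ → proj₁) (h _ p)
  Typed-substitute θ o h (lam d)          = lam (Typed-substitute-under θ o h d)
  -- Every target identifier follows its owner to the function's or to the argument's side.
  Typed-substitute θ o h (app q d e)      = app (q ∘ o)
    (Typed-substitute θ o (λ i (p , x) →
       weaken (λ { j (y , refl) → (y , x) , refl }) (h i p)) d)
    (Typed-substitute θ o (λ i (p , x) →
       weaken (λ { j (y , refl) → (y , x) , refl }) (h i p)) e)
  Typed-substitute θ o h num              = num
  Typed-substitute θ o h skip             = skip
  Typed-substitute θ o h (op d e)         =
    op (Typed-substitute θ o h d) (Typed-substitute θ o h e)
  Typed-substitute θ o h (seq b d e)      =
    seq b (Typed-substitute θ o h d) (Typed-substitute θ o h e)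
  Typed-substitute θ o h (assign d e)     =
    assign (Typed-substitute θ o h d) (Typed-substitute θ o h e)
  Typed-substitute θ o h (deref d)        = deref (Typed-substitute θ o h d)
  Typed-substitute θ o h (while d e)      =
    while (Typed-substitute θ o h d) (Typed-substitute θ o h e)
  Typed-substitute θ o h (ifzero b d e f) =
    ifzero b (Typed-substitute θ o h d) (Typed-substitute θ o h e) (Typed-substitute θ o h f)
  Typed-substitute θ o h (new b d)        = new b (Typed-substitute-under θ o h d)
  Typed-substitute θ o h random           = random
  Typed-substitute θ o h (mkvar d e)      =
    mkvar (Typed-substitute θ o h d) (Typed-substitute θ o h e)

  Typed-β : {Γ : Vec Ty n} {P : Fin n → Set} (q : Fin n → Bool) → ∀ {A B M N} →
            Typed (A ∷ Γ) ((λ i → P i × q i ≡ true) ⁺) M B →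
            Typed Γ (λ i → P i × q i ≡ false) N A →
            Typed Γ P (M [ N /0]) B
  Typed-β {n} q d e = Typed-substitute _ owner
    (λ { zero _ → weaken (λ j (p , x) → p , owner-false j x) e
       ; (suc i) (p , x) → var (p , owner-true i x) refl }) d
    where
    -- Identifiers on the argument's side can reach the result only through the substituted term, so
    -- they belong to `zero`; the others belong to themselves.
    owner : Fin n → Fin (suc n)
    owner j with q j
    ... | true  = suc j
    ... | false = zero
    owner-true : ∀ j → q j ≡ true → owner j ≡ suc j
    owner-true j x rewrite x = refl
    owner-false : ∀ j → q j ≡ false → owner j ≡ zero
    owner-false j x rewrite x = refl

  typed : {Γ : Vec Ty n} → ∀ {M B} → Γ ⊢ M ∶ B → Typed Γ (λ _ → ⊤) M B
  typed ax = var tt refl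
  typed (lam d) = lam (weaken (λ { zero _ → tt ; (suc _) _ → tt }) (typed d))
  typed (app {m} {n} {Γ} {Δ} d e) = app left
    (Typed-rename (_↑ˡ n) sepˡ (lookup-++ˡ Γ Δ) (λ i _ → tt , leftˡ i) (typed d))
    (Typed-rename (m ↑ʳ_) sepʳ (lookup-++ʳ Γ Δ) (λ i _ → tt , leftʳ i) (typed e))
    where
    left : Fin (m + n) → Bool
    left j = Sum.[ const true , const false ] (splitAt m j)
    leftˡ : ∀ i → left (i ↑ˡ n) ≡ true
    leftˡ i rewrite splitAt-↑ˡ m i n = refl
    leftʳ : ∀ i → left (m ↑ʳ i) ≡ false
    leftʳ i rewrite splitAt-↑ʳ m n i = refl
    sepˡ : Separating (_↑ˡ n)
    sepˡ q = (λ j → Sum.[ q , const true ] (splitAt m j)) ,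
      λ i → cong Sum.[ q , const true ] (splitAt-↑ˡ m i n)
    sepʳ : Separating (m ↑ʳ_)
    sepʳ q = (λ j → Sum.[ const true , q ] (splitAt m j)) ,
      λ i → cong Sum.[ const true , q ] (splitAt-↑ʳ m n i)
  typed (weak d) = Typed-rename suc suc-separating (λ _ → refl) (λ _ _ → tt) (typed d)
  typed (exch (π , h) d) =
    Typed-rename (π ⟨$⟩ʳ_) (λ q → q ∘ (π ⟨$⟩ˡ_) , λ i → cong q (inverseˡ π)) h (λ _ _ → tt) (typed d)
  typed (num x) = num
  typed skip = skip
  typed (op o d e) = op (typed d) (typed e)
  typed (seq b d e) = seq b (typed d) (typed e)
  typed (assign d e) = assign (typed d) (typed e)
  typed (deref d) = deref (typed d)
  typed (while d e) = while (typed d) (typed e)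
  typed (ifzero b d e f) = ifzero b (typed d) (typed e) (typed f)
  typed (new g d) = new g (weaken (λ { zero _ → tt ; (suc _) _ → tt }) (typed d))
  typed random = random
  typed (mkvar d e) = mkvar (typed d) (typed e)

  -- Affinity and typing of traces

  Seq-empty : {P Q : Env n → Set} {i : Fin n} →
              (∀ {s} → P s → s i ≡ []) → (∀ {s} → Q s → s i ≡ []) →
              ∀ {u} → Seq P Q u → u i ≡ []
  Seq-empty f g (s , t , e , p , q) = trans (e _) (cong₂ _++_ (f p) (g q))

  Many-empty : {P : Env n → Tr → Set} {i : Fin n} →
               (∀ {s a} → P s a → s i ≡ []) → ∀ {u as} → Many P u as → u i ≡ []
  Many-empty f ([] e)       = e _
  Many-empty f ((e , p) ∷ ps) = trans (e _) (cong₂ _++_ (f p) (Many-empty f ps))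

  Iterate-empty : {G B E : Env n → Set} {i : Fin n} →
    (∀ {s} → G s → s i ≡ []) → (∀ {s} → B s → s i ≡ []) → (∀ {s} → E s → s i ≡ []) →
    ∀ {u} → Iterate G B E u → u i ≡ []
  Iterate-empty f g h (exit x) = h x
  Iterate-empty f g h (iter e x y l) =
    trans (e _) (cong₂ _++_ (f x) (cong₂ _++_ (g y) (Iterate-empty f g h l)))

  -- Turns the syntactic disjointness recorded by a split `q` into emptiness of histories, the form
  -- in which both `unβ` and `fundamental` use affinity.
  unused-empty : {Γ : Vec Ty n} {P : Fin n → Set} {i : Fin n} → ¬ P i →
                 ∀ {M B} → Typed Γ P M B → ∀ {s b} → ⟪ M ⟫ s b → s i ≡ []
  unused-empty ¬p (var {j} p e) (_ , h) = h _ λ { refl → ¬p p }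
  unused-empty ¬p (lam d) (_ , _ , _ , _ , x) = unused-empty ¬p d x
  unused-empty ¬p (app q d e) (_ , x) =
    Seq-empty (unused-empty (¬p ∘ proj₁) d) (Many-empty (unused-empty (¬p ∘ proj₁) e)) x
  unused-empty ¬p num (e , _) = e _
  unused-empty ¬p skip (e , _) = e _
  unused-empty ¬p (op d e) (_ , _ , _ , x) = Seq-empty (unused-empty ¬p d) (unused-empty ¬p e) x
  unused-empty ¬p (seq b d e) (_ , x) = Seq-empty (unused-empty ¬p d) (unused-empty ¬p e) x
  unused-empty ¬p (assign d e) (_ , _ , x) = Seq-empty (unused-empty ¬p e) (unused-empty ¬p d) x
  unused-empty ¬p (deref d) (_ , _ , x) = unused-empty ¬p d x
  unused-empty ¬p (while d e) (_ , x) =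
    Iterate-empty (unused-empty ¬p d) (unused-empty ¬p e)
                  (λ (_ , _ , y) → unused-empty ¬p d y) x
  unused-empty ¬p (ifzero b d e f) (_ , inj₁ x) =
    Seq-empty (unused-empty ¬p d) (unused-empty ¬p e) x
  unused-empty ¬p (ifzero b d e f) (_ , inj₂ x) =
    Seq-empty (λ (_ , _ , y) → unused-empty ¬p d y) (unused-empty ¬p f) x
  unused-empty ¬p (new g d) (_ , _ , _ , _ , x) = unused-empty ¬p d x
  unused-empty ¬p random (e , _) = e _
  unused-empty ¬p (mkvar d e) (inj₁ (_ , _ , _ , x)) = unused-empty ¬p d x
  unused-empty ¬p (mkvar d e) (inj₂ (_ , _ , x)) = unused-empty ¬p e x

  infix 4 _⊨_

  _⊨_ : Vec Ty n → Env n → Set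
  Γ ⊨ s = ∀ i → All (_∈ lookup Γ i) (s i)

  ⊨-∷ : (Γ : Vec Ty n) {s : Env n} → ∀ {A as} → All (_∈ A) as → Γ ⊨ s → A ∷ Γ ⊨ (as ▹ s)
  ⊨-∷ Γ h g zero    = h
  ⊨-∷ Γ h g (suc i) = g i

  module _ (Γ : Vec Ty n) {u s t : Env n} (e : u ≗ s ⊕ t) (h : Γ ⊨ u) where

    ⊨-left : Γ ⊨ s
    ⊨-left i = All.++⁻ˡ (s i) (subst (All _) (e i) (h i))

    ⊨-right : Γ ⊨ t
    ⊨-right i = All.++⁻ʳ (s i) (subst (All _) (e i) (h i))

  Path-∈ : ∀ {x t y} → Path x t y → All (_∈ var) t
  Path-∈ []         = []
  Path-∈ (read∷ p)  = acc ∷ Path-∈ p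
  Path-∈ (write∷ p) = acc ∷ Path-∈ p

  -- Type preservation survives the passage to raw traces because abstractions bound their arguments
  -- by the annotation and `new` supplies accesses only. It is what allows raw traces to be decoded.
  trace-∈ : {Γ : Vec Ty n} {P : Fin n → Set} → ∀ {M B} → Typed Γ P M B →
            ∀ {s b} → Γ ⊨ s → ⟪ M ⟫ s b → b ∈ B
  trace-∈ (var {i} p refl) h (x , _) with subst (All _) x (h i)
  ... | b∈B ∷ [] = b∈B
  trace-∈ (lam d) h (as , b , refl , as∈A , x) = as∈A ⇒ trace-∈ d (⊨-∷ _ as∈A h) x
  trace-∈ {Γ = Γ} (app q d e) h (as , s , t , eq , x , y) with trace-∈ d (⊨-left Γ eq h) x
  ... | _ ⇒ b∈B = b∈B
  trace-∈ num h (_ , refl) = nm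
  trace-∈ skip h (_ , refl) = ⋆
  trace-∈ (op d e) h (_ , _ , refl , _) = nm
  trace-∈ {Γ = Γ} (seq b d e) h (_ , s , t , eq , x , y) = trace-∈ e (⊨-right Γ eq h) y
  trace-∈ (assign d e) h (_ , refl , _) = ⋆
  trace-∈ (deref d) h (_ , refl , _) = nm
  trace-∈ (while d e) h (refl , _) = ⋆
  trace-∈ {Γ =
    Γ} (ifzero b d e f) h (_ , inj₁ (s , t , eq , x , y)) = trace-∈ e (⊨-right Γ eq h) y
  trace-∈ {Γ =
    Γ} (ifzero b d e f) h (_ , inj₂ (s , t , eq , x , y)) = trace-∈ f (⊨-right Γ eq h) y
  trace-∈ (new g d) h (_ , t , y , p , x) = trace-∈ d (⊨-∷ _ (Path-∈ p) h) x
  trace-∈ random h (_ , _ , refl) = nm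
  trace-∈ (mkvar d e) h (inj₁ (_ , _ , refl , _)) = acc
  trace-∈ (mkvar d e) h (inj₂ (_ , refl , _)) = acc

  Many-∈ : {Γ : Vec Ty n} {P : Fin n → Set} → ∀ {M B} → Typed Γ P M B →
           ∀ {u as} → Γ ⊨ u → Many ⟪ M ⟫ u as → All (_∈ B) as
  Many-∈ d h ([] _) = []
  Many-∈ {Γ = Γ} d h ((e , x) ∷ xs) =
    trace-∈ d (⊨-left Γ e h) x ∷ Many-∈ d (⊨-right Γ e h) xs

  -- Encoding elements of the model as untyped traces

  enc : ∀ A → α A → Tr
  enc nat     x        = nm x
  enc comm    _        = ⋆
  enc var     a        = acc a
  enc (A ⊸ B) (as , b) = map (enc A) as ⇒ enc B b

  enc-∈  : ∀ A a → enc A a ∈ A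
  encs-∈ : ∀ A as → All (_∈ A) (map (enc A) as)
  enc-∈ nat     x        = nm
  enc-∈ comm    _        = ⋆
  enc-∈ var     a        = acc
  enc-∈ (A ⊸ B) (as , b) = encs-∈ A as ⇒ enc-∈ B b
  encs-∈ A []       = []
  encs-∈ A (a ∷ as) = enc-∈ A a ∷ encs-∈ A as

  dec  : ∀ {A c} → c ∈ A → ∃ λ a → enc A a ≡ c
  decs : ∀ {A cs} → All (_∈ A) cs → ∃ λ as → map (enc A) as ≡ cs
  dec (nm {x})  = x , refl
  dec ⋆         = tt , refl
  dec (acc {a}) = a , refl
  dec (h ⇒ h′) with decs h | dec h′
  ... | as , refl | b , refl = (as , b) , refl
  decs []       = [] , refl
  decs (h ∷ hs) with dec h | decs hs
  ... | a , refl | as , refl = a ∷ as , refl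

  ⇒-injective : ∀ {as as′ : List Tr} {b b′ : Tr} → as ⇒ b ≡ as′ ⇒ b′ → as ≡ as′ × b ≡ b′
  ⇒-injective refl = refl , refl

  enc-injective : ∀ A {a a′} → enc A a ≡ enc A a′ → a ≡ a′
  enc-injective nat     refl = refl
  enc-injective comm    _    = refl
  enc-injective var     refl = refl
  enc-injective (A ⊸ B) e with ⇒-injective e
  ... | e₁ , e₂ =
    cong₂ _,_ (map-injective (enc-injective A) e₁) (enc-injective B e₂)

  env : {Γ : Vec Ty n} → Seqs Γ → Env n
  env s i = map (enc _) (lookup⁺ s i)

  env-∷ : {Γ : Vec Ty n} → ∀ {A} t (s : Seqs Γ) →
          env (t ∷ s) ≗ (map (enc A) t ▹ env s)
  env-∷ t s zero    = refl
  env-∷ t s (suc i) = refl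

  env-∙ : {Γ : Vec Ty n} (s t : Seqs Γ) → env (s ∙ t) ≗ env s ⊕ env t
  env-∙ (s ∷ ss) (t ∷ ts) zero    = map-++ (enc _) s t
  env-∙ (s ∷ ss) (t ∷ ts) (suc i) = env-∙ ss ts i

  env-ε : {Γ : Vec Ty n} → env (ε {Γ = Γ}) ≗ ∅
  env-ε {Γ = A ∷ Γ} zero    = refl
  env-ε {Γ = A ∷ Γ} (suc i) = env-ε {Γ = Γ} i

  env-injective : {Γ : Vec Ty n} (s t : Seqs Γ) → env s ≗ env t → s ≡ t
  env-injective []       []       e = refl
  env-injective (s ∷ ss) (t ∷ ts) e =
    cong₂ _∷_ (map-injective (enc-injective _) (e zero)) (env-injective ss ts (e ∘ suc))

  env-⊨ : {Γ : Vec Ty n} (s : Seqs Γ) → Γ ⊨ env s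
  env-⊨ s i = encs-∈ _ (lookup⁺ s i)

  env-surjective : (Γ : Vec Ty n) {v : Env n} → Γ ⊨ v → ∃ λ (s : Seqs Γ) → env s ≗ v
  env-surjective []      h = [] , λ ()
  env-surjective (A ∷ Γ) h with decs (h zero) | env-surjective Γ (h ∘ suc)
  ... | t , e | s , e′ = t ∷ s , λ { zero → e ; (suc i) → e′ i }

  -- Pieces of well-typed sequences are well typed, hence encodings themselves; injectivity of `env`
  -- then glues the decoded pieces back to `u`.
  env-split : (Γ : Vec Ty n) {u : Seqs Γ} {s t : Env n} → env u ≗ s ⊕ t →
              ∃₂ λ s′ t′ → u ≡ s′ ∙ t′ × env s′ ≗ s × env t′ ≗ t
  env-split Γ {u} {s} {t} e
    with env-surjective Γ {s} (⊨-left Γ e (env-⊨ u))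
       | env-surjective Γ {t} (⊨-right Γ e (env-⊨ u))
  ... | s′ , h | t′ , h′ =
    s′ , t′ , env-injective u (s′ ∙ t′) eq , h , h′
    where
    eq : env u ≗ env (s′ ∙ t′)
    eq i = trans (e i) (sym (trans (env-∙ s′ t′ i) (cong₂ _++_ (h i) (h′ i))))

  env-∅ : (Γ : Vec Ty n) {u : Seqs Γ} → env u ≗ ∅ → u ≡ ε
  env-∅ Γ {u} e = env-injective u ε λ i → trans (e i) (sym (env-ε {Γ = Γ} i))

  env-↑ˡ : {Γ : Vec Ty m} {Δ : Vec Ty n} (s : Seqs Γ) (t : Seqs Δ) →
           ∀ i → env (++⁺ s t) (i ↑ˡ n) ≡ env s i
  env-↑ˡ (s ∷ ss) t zero    = refl
  env-↑ˡ (s ∷ ss) t (suc i) = env-↑ˡ ss t i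

  env-↑ʳ : {Γ : Vec Ty m} {Δ : Vec Ty n} (s : Seqs Γ) (t : Seqs Δ) →
           ∀ i → env (++⁺ s t) (m ↑ʳ i) ≡ env t i
  env-↑ʳ []       t i = refl
  env-↑ʳ (s ∷ ss) t i = env-↑ʳ ss t i

  env-permute : (Γ : Vec Ty m) {Δ : Vec Ty n} (p : lookup Δ ↭ lookup Γ) (s : Seqs Δ) →
                env {Γ = Γ} (permute {Γ = Γ} p s) ≗ env s ∘ (proj₁ p ⟨$⟩ʳ_)
  env-permute Γ (π , eq) s i = trans (lookup-lookup⁻ Γ _ i) (strip (eq i) _)
    where
    lookup-lookup⁻ : ∀ {m} (Γ : Vec Ty m) (f : ∀ i → List (α (lookup Γ i))) →
                     env {Γ = Γ} (lookup⁻ f) ≗ λ i → map (enc _) (f i)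
    lookup-lookup⁻ (A ∷ Γ) f zero    = refl
    lookup-lookup⁻ (A ∷ Γ) f (suc i) = lookup-lookup⁻ Γ (f ∘ suc) i
    strip : ∀ {A B} (e : A ≡ B) (t : List (α A)) →
            map (enc B) (subst (List ∘ α) e t) ≡ map (enc A) t
    strip refl t = refl

  ↑ˡ≢↑ʳ : ∀ (i : Fin m) (j : Fin n) → i ↑ˡ n ≢ m ↑ʳ j
  ↑ˡ≢↑ʳ {m} {n} i j e
    with trans (sym (splitAt-↑ˡ m i n)) (trans (cong (splitAt m) e) (splitAt-↑ʳ m n j))
  ... | ()

  push-⊕ : (ρ : Fin m → Fin n) → Inj ρ → ∀ s t → push ρ (s ⊕ t) ≗ push ρ s ⊕ push ρ t
  push-⊕ ρ inj s t = ≗-sym (push-unique ρ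
    ((λ i → sym (cong₂ _++_ (push-in ρ inj s i) (push-in ρ inj t i))) ,
     λ j h → cong₂ _++_ (push-out ρ s j h) (push-out ρ t j h)))

  push-cong : (ρ : Fin m → Fin n) → Inj ρ → ∀ {s t} → s ≗ t → push ρ s ≗ push ρ t
  push-cong ρ inj {s} {t} h = push-unique ρ
    ((λ i → trans (sym (h i)) (sym (push-in ρ inj s i))) , push-out ρ s)

  push-∅ : (ρ : Fin m → Fin n) → push ρ ∅ ≗ ∅
  push-∅ ρ = ≗-sym (push-unique ρ ((λ _ → refl) , λ _ _ → refl))

  -- Reconciles the two treatments of application: juxtaposed contexts in the model, concatenation
  -- over one common context for raw terms. Each summand is empty on the other's half.
  env-++ : {Γ : Vec Ty m} {Δ : Vec Ty n} (s : Seqs Γ) (t : Seqs Δ) →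
           env (++⁺ s t) ≗ push (_↑ˡ n) (env s) ⊕ push (m ↑ʳ_) (env t)
  env-++ {m} {n} s t j with splitAt m j in eq
  ... | inj₁ i rewrite sym (splitAt⁻¹-↑ˡ {i = j} eq) =
    trans (env-↑ˡ s t i)
      (trans (sym (++-identityʳ _))
        (sym (cong₂ _++_ (push-in (_↑ˡ n) (↑ˡ-injective n _ _) (env s) i)
          (push-out (m ↑ʳ_) (env t) (i ↑ˡ n) λ k e → ↑ˡ≢↑ʳ i k (sym e)))))
  ... | inj₂ i rewrite sym (splitAt⁻¹-↑ʳ {i = j} eq) =
    trans (env-↑ʳ s t i)
      (sym (cong₂ _++_ (push-out (_↑ˡ n) (env s) (m ↑ʳ i) λ k e → ↑ˡ≢↑ʳ k i e)
        (push-in (m ↑ʳ_) (↑ʳ-injective m _ _) (env t) i)))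

  -- Agreement with the typed denotation

  base-trace : ∀ {B} → Base B → (b : α B) → BaseTrace (enc B b)
  base-trace nat  b = nm
  base-trace comm b = ⋆
  base-trace var  b = acc

  ground-trace : ∀ {B} → Ground B → (b : α B) → GroundTrace (enc B b)
  ground-trace nat  b = nm
  ground-trace comm b = ⋆

  cell-path : ∀ {x t} → CellFrom x t → ∃ λ y → Path x (map acc t) y
  cell-path []         = _ , []
  cell-path (read∷ c)  = let y , p = cell-path c in y , read∷ p
  cell-path (write∷ c) = let y , p = cell-path c in y , write∷ p

  path-cell : ∀ {x t y} → Path x (map acc t) y → CellFrom x t
  path-cell {t = []}          []         = []
  path-cell {t = read _ ∷ t}  (read∷ p)  = read∷ (path-cell p)
  path-cell {t = write _ ∷ t} (write∷ p) = write∷ (path-cell p)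

  ⟦⟧⇒⟪⟫ : {Γ : Vec Ty n} {M : Tm n} {B : Ty} (d : Γ ⊢ M ∶ B) →
          ∀ {s b} → ⟦ d ⟧ s b → ⟪ M ⟫ (env s) (enc B b)
  ⟦⟧⇒⟪⟫-many : {Γ : Vec Ty n} {M : Tm n} {B : Ty} (d : Γ ⊢ M ∶ B)
               (ρ : Fin n → Fin k) → Inj ρ → ∀ {s bs} → Ext (seqs Γ) ⟦ d ⟧ s bs →
               Many ⟪ rename ρ M ⟫ (push ρ (env s)) (map (enc B) bs)
  ⟦⟧⇒⟪⟫-seq : {Γ : Vec Ty n} {P Q : Seqs Γ → Set} {P′ Q′ : Env n → Set} →
              (∀ {s} → P s → P′ (env s)) → (∀ {s} → Q s → Q′ (env s)) →
              ∀ {u} → (∃₂ λ s t → u ≡ s ∙ t × P s × Q t) → Seq P′ Q′ (env u)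
  ⟦⟧⇒⟪⟫-seq f g (s , t , refl , p , q) = env s , env t , env-∙ s t , f p , g q
  ⟦⟧⇒⟪⟫-loop : {Γ : Vec Ty n} {M N : Tm n} (d : Γ ⊢ M ∶ nat) (e : Γ ⊢ N ∶ comm) →
               ∀ {s} → Loop ⟦ d ⟧ ⟦ e ⟧ s →
               Iterate (λ s → ⟪ M ⟫ s (nm 0)) (λ t → ⟪ N ⟫ t ⋆)
                       (λ s → ∃ λ x → x ≢ 0 × ⟪ M ⟫ s (nm x)) (env s)

  ⟦⟧⇒⟪⟫ ax {s ∷ []} refl = refl , λ { zero h → ⊥-elim (h refl) ; (suc ()) h }
  ⟦⟧⇒⟪⟫ (lam {M = M} d) {s} {t , b} x =
    map (enc _) t , enc _ b , refl , encs-∈ _ t , resp M (env-∷ t s) (⟦⟧⇒⟪⟫ d x)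
  ⟦⟧⇒⟪⟫ (app {m} {n} {M = M} d e) (s , t , refl , as , x , xs) =
    map (enc _) as , push (_↑ˡ n) (env s) , push (m ↑ʳ_) (env t) , env-++ s t ,
    rename-push (_↑ˡ n) (↑ˡ-injective n _ _) M (⟦⟧⇒⟪⟫ d x) ,
    ⟦⟧⇒⟪⟫-many e (m ↑ʳ_) (↑ʳ-injective m _ _) xs
  ⟦⟧⇒⟪⟫ (weak {M = M} d) {.[] ∷ s} (refl , x) =
    resp (rename suc M) (≗-sym (env-∷ [] s)) (rename-suc M (⟦⟧⇒⟪⟫ d x))
  ⟦⟧⇒⟪⟫ (exch {Γ = Γ} {M = M} p@(π , _) d) {s} x =
    rename-along (π ⟨$⟩ʳ_)
      (λ e → trans (sym (inverseˡ π)) (trans (cong (π ⟨$⟩ˡ_) e) (inverseˡ π))) M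
      (env-permute Γ p s , λ j h → ⊥-elim (h (π ⟨$⟩ˡ j) (inverseʳ π))) (⟦⟧⇒⟪⟫ d x)
  ⟦⟧⇒⟪⟫ (num x) refl = (λ ()) , refl
  ⟦⟧⇒⟪⟫ skip _ = (λ ()) , refl
  ⟦⟧⇒⟪⟫ (op o d e) (s , t , u , x , y , refl , a , b) =
    x , y , refl , ⟦⟧⇒⟪⟫-seq (λ {s} → ⟦⟧⇒⟪⟫ d {s}) (λ {s} → ⟦⟧⇒⟪⟫ e {s}) (s , t , u , a , b)
  ⟦⟧⇒⟪⟫ (seq B d e) {b = b} x = base-trace B b , ⟦⟧⇒⟪⟫-seq (⟦⟧⇒⟪⟫ d) (⟦⟧⇒⟪⟫ e) x
  ⟦⟧⇒⟪⟫ (assign d e) (s , t , u , x , a , b) =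
    x , refl , ⟦⟧⇒⟪⟫-seq (λ {s} → ⟦⟧⇒⟪⟫ e {s}) (λ {s} → ⟦⟧⇒⟪⟫ d {s}) (s , t , u , a , b)
  ⟦⟧⇒⟪⟫ (deref d) {b = x} a = x , refl , ⟦⟧⇒⟪⟫ d a
  ⟦⟧⇒⟪⟫ (while d e) x = refl , ⟦⟧⇒⟪⟫-loop d e x
  ⟦⟧⇒⟪⟫ (ifzero B d e f) {b = b} (inj₁ x) =
    base-trace B b , inj₁ (⟦⟧⇒⟪⟫-seq (⟦⟧⇒⟪⟫ d) (⟦⟧⇒⟪⟫ e) x)
  ⟦⟧⇒⟪⟫ (ifzero B d e f) {b = b} (inj₂ x) =
    base-trace B b , inj₂ (⟦⟧⇒⟪⟫-seq (λ (x , x≢0 , a) → x , x≢0 , ⟦⟧⇒⟪⟫ d a) (⟦⟧⇒⟪⟫ f) x)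
  ⟦⟧⇒⟪⟫ (new {M = M} B d) {s} {b} (t , x , c) with cell-path c
  ... | y , p = ground-trace B b , map acc t , y , p , resp M (env-∷ t s) (⟦⟧⇒⟪⟫ d x)
  ⟦⟧⇒⟪⟫ (random {Γ = Γ}) {b = x} refl = env-ε {Γ = Γ} , x , refl
  ⟦⟧⇒⟪⟫ (mkvar {M = M} d e) {s} {write x} (k , a) = inj₁
    (x , k , refl , subst (λ xs → ⟪ M ⟫ (env s) (xs ⇒ ⋆)) (map-replicate nm k x) (⟦⟧⇒⟪⟫ d a))
  ⟦⟧⇒⟪⟫ (mkvar d e) {b = read x} a = inj₂ (x , refl , ⟦⟧⇒⟪⟫ e a)

  ⟦⟧⇒⟪⟫-many {Γ = Γ} d ρ inj ([] refl) =
    [] (≗-trans (push-cong ρ inj (env-ε {Γ = Γ})) (push-∅ ρ))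
  ⟦⟧⇒⟪⟫-many {M = M} d ρ inj (_∷_ {p₁ = s} {p₂ = t} (refl , x) xs) =
    (≗-trans (push-cong ρ inj (env-∙ s t)) (push-⊕ ρ inj (env s) (env t)) ,
     rename-push ρ inj M (⟦⟧⇒⟪⟫ d x)) ∷ ⟦⟧⇒⟪⟫-many d ρ inj xs

  ⟦⟧⇒⟪⟫-loop d e (exit x≢0 a) = exit (_ , x≢0 , ⟦⟧⇒⟪⟫ d a)
  ⟦⟧⇒⟪⟫-loop d e (iter {s = s} {t} {s′} refl a b l) =
    iter (λ i → trans (env-∙ s (t ∙ s′) i) (cong (env s i ++_) (env-∙ t s′ i)))
         (⟦⟧⇒⟪⟫ d a) (⟦⟧⇒⟪⟫ e b) (⟦⟧⇒⟪⟫-loop d e l)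

  ⟪⟫⇒⟦⟧ : {Γ : Vec Ty n} {M : Tm n} {B : Ty} (d : Γ ⊢ M ∶ B) →
          ∀ {s b} → ⟪ M ⟫ (env s) (enc B b) → ⟦ d ⟧ s b
  ⟪⟫⇒⟦⟧-at : {Γ : Vec Ty n} {M : Tm n} {B : Ty} (d : Γ ⊢ M ∶ B) →
          ∀ {s b v} → env s ≗ v → ⟪ M ⟫ v (enc B b) → ⟦ d ⟧ s b
  ⟪⟫⇒⟦⟧-at {M = M} d h x = ⟪⟫⇒⟦⟧ d (resp M (≗-sym h) x)
  ⟪⟫⇒⟦⟧-many : {Γ : Vec Ty n} {M : Tm n} {B : Ty} (d : Γ ⊢ M ∶ B)
               (ρ : Fin n → Fin k) → Inj ρ → ∀ {s bs v} → env s ≗ v ∘ ρ →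
               Many ⟪ rename ρ M ⟫ v (map (enc B) bs) → Ext (seqs Γ) ⟦ d ⟧ s bs
  ⟪⟫⇒⟦⟧-seq : {Γ : Vec Ty n} {P Q : Seqs Γ → Set} {P′ Q′ : Env n → Set} →
              (∀ {s v} → env s ≗ v → P′ v → P s) → (∀ {s v} → env s ≗ v → Q′ v → Q s) →
              ∀ {u v} → env u ≗ v → Seq P′ Q′ v → ∃₂ λ s t → u ≡ s ∙ t × P s × Q t
  ⟪⟫⇒⟦⟧-seq {Γ = Γ} f g h (s , t , e , p , q) with env-split Γ (≗-trans h e)
  ... | s′ , t′ , eq , hs , ht = s′ , t′ , eq , f hs p , g ht q
  ⟪⟫⇒⟦⟧-loop : {Γ : Vec Ty n} {M N : Tm n} (d : Γ ⊢ M ∶ nat) (e : Γ ⊢ N ∶ comm) →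
               ∀ {s v} → env s ≗ v →
               Iterate (λ s → ⟪ M ⟫ s (nm 0)) (λ t → ⟪ N ⟫ t ⋆)
                       (λ s → ∃ λ x → x ≢ 0 × ⟪ M ⟫ s (nm x)) v → Loop ⟦ d ⟧ ⟦ e ⟧ s

  ⟪⟫⇒⟦⟧ (ax {A}) {s ∷ []} (e , _) = map-injective (enc-injective A) e
  ⟪⟫⇒⟦⟧ (lam d) {s} {t , b} (_ , _ , refl , _ , x) = ⟪⟫⇒⟦⟧-at d (env-∷ t s) x
  ⟪⟫⇒⟦⟧ (app {m} {n} {Γ} {Δ} {M = M} {N} d e) {u} {b} (as , v , w , eq , x , xs) = result
    where
    s = proj₁ (++⁻ Γ u)
    t = proj₂ (++⁻ Γ u)
    u≡ : u ≡ ++⁺ s t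
    u≡ = sym (++⁺∘++⁻ Γ u)
    x′ = unrename (_↑ˡ n) (↑ˡ-injective n _ _) M x
    -- On the left half the argument contributes nothing, being renamed into the right half; `t≗`
    -- below is the mirror image.
    s≗ : env s ≗ v ∘ (_↑ˡ n)
    s≗ i = trans (sym (env-↑ˡ s t i)) (trans (cong (λ u → env u (i ↑ˡ n)) (sym u≡))
      (trans (eq (i ↑ˡ n)) (trans (cong (v (i ↑ˡ n) ++_)
        (Many-empty (λ y → proj₂ (unrename (m ↑ʳ_) (↑ʳ-injective m _ _) N y) (i ↑ˡ n)
          λ k e → ↑ˡ≢↑ʳ i k (sym e)) xs)) (++-identityʳ _))))
    t≗ : env t ≗ w ∘ (m ↑ʳ_)
    t≗ i = trans (sym (env-↑ʳ s t i)) (trans (cong (λ u → env u (m ↑ʳ i)) (sym u≡))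
      (trans (eq (m ↑ʳ i)) (cong (_++ w (m ↑ʳ i)) (proj₂ x′ (m ↑ʳ i) λ k → ↑ˡ≢↑ʳ k i))))
    result : ⟦ app d e ⟧ u b
    -- The intermediate list `as` is a priori untyped; it decodes because it occurs in a trace of a
    -- well-typed function.
    result with trace-∈ (typed d) (env-⊨ s) (resp M (≗-sym s≗) (proj₁ x′))
    ... | as∈A ⇒ _ with decs as∈A
    ... | as′ , refl =
      s , t , u≡ , as′ , ⟪⟫⇒⟦⟧-at d s≗ (proj₁ x′) ,
      ⟪⟫⇒⟦⟧-many e (m ↑ʳ_) (↑ʳ-injective m _ _) t≗ xs
  ⟪⟫⇒⟦⟧ (weak {A = A} {M = M} d) {t ∷ s} x with unrename-suc M x
  ... | x′ , e = map-injective (enc-injective A) e , ⟪⟫⇒⟦⟧ d x′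
  ⟪⟫⇒⟦⟧ (exch {Γ = Γ} {M = M} p@(π , _) d) {s} x =
    ⟪⟫⇒⟦⟧-at d (env-permute Γ p s) (proj₁ (unrename (π ⟨$⟩ʳ_)
      (λ e → trans (sym (inverseˡ π)) (trans (cong (π ⟨$⟩ˡ_) e) (inverseˡ π))) M x))
  ⟪⟫⇒⟦⟧ (num x) (_ , e) = enc-injective nat e
  ⟪⟫⇒⟦⟧ skip _ = tt
  ⟪⟫⇒⟦⟧ (op o d e) (x , y , eq , z)
    with ⟪⟫⇒⟦⟧-seq (⟪⟫⇒⟦⟧-at d) (⟪⟫⇒⟦⟧-at e) (λ _ → refl) z
  ... | s , t , u , a , b = s , t , u , x , y , enc-injective nat eq , a , b
  ⟪⟫⇒⟦⟧ (seq B d e) (_ , x) = ⟪⟫⇒⟦⟧-seq (⟪⟫⇒⟦⟧-at d) (⟪⟫⇒⟦⟧-at e) (λ _ → refl) x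
  ⟪⟫⇒⟦⟧ (assign d e) (x , _ , z)
    with ⟪⟫⇒⟦⟧-seq (⟪⟫⇒⟦⟧-at e) (⟪⟫⇒⟦⟧-at d) (λ _ → refl) z
  ... | s , t , u , a , b = s , t , u , x , a , b
  ⟪⟫⇒⟦⟧ (deref d) (x , refl , a) = ⟪⟫⇒⟦⟧ d a
  ⟪⟫⇒⟦⟧ (while d e) (_ , x) = ⟪⟫⇒⟦⟧-loop d e (λ _ → refl) x
  ⟪⟫⇒⟦⟧ (ifzero B d e f) (_ , inj₁ x) =
    inj₁ (⟪⟫⇒⟦⟧-seq (⟪⟫⇒⟦⟧-at d) (⟪⟫⇒⟦⟧-at e) (λ _ → refl) x)
  ⟪⟫⇒⟦⟧ (ifzero B d e f) (_ , inj₂ x) =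
    inj₂ (⟪⟫⇒⟦⟧-seq (λ h (x , x≢0 , a) → x , x≢0 , ⟪⟫⇒⟦⟧-at d h a) (⟪⟫⇒⟦⟧-at f) (λ _ → refl) x)
  ⟪⟫⇒⟦⟧ (new B d) {s} (_ , _ , _ , p , x) with decs (Path-∈ p)
  ... | t , refl = t , ⟪⟫⇒⟦⟧-at d (env-∷ t s) x , path-cell p
  ⟪⟫⇒⟦⟧ (random {Γ = Γ}) (e , _) = env-∅ Γ e
  ⟪⟫⇒⟦⟧ (mkvar {M = M} d e) {s} {write x} (inj₁ (_ , k , refl , a)) =
    k , ⟪⟫⇒⟦⟧ d (subst (λ xs → ⟪ M ⟫ (env s) (xs ⇒ ⋆)) (sym (map-replicate nm k x)) a)
  ⟪⟫⇒⟦⟧ (mkvar d e) {b = read x} (inj₂ (_ , refl , a)) = ⟪⟫⇒⟦⟧ e a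

  ⟪⟫⇒⟦⟧-many {Γ = Γ} d ρ inj {bs = []} h ([] e) = [] (env-∅ Γ (≗-trans h (e ∘ ρ)))
  ⟪⟫⇒⟦⟧-many {Γ = Γ} {M = M} d ρ inj {bs = b ∷ bs} h ((e , x) ∷ xs)
    with env-split Γ (≗-trans h (e ∘ ρ))
  ... | s , t , eq , hs , ht =
    (eq , ⟪⟫⇒⟦⟧-at d hs (proj₁ (unrename ρ inj M x))) ∷ ⟪⟫⇒⟦⟧-many d ρ inj ht xs

  ⟪⟫⇒⟦⟧-loop d e h (exit (x , x≢0 , a)) = exit x≢0 (⟪⟫⇒⟦⟧-at d h a)
  ⟪⟫⇒⟦⟧-loop {Γ = Γ} d e {u} h (iter {s = s} {t} {s′} eq a b l)
    with env-split Γ {u} {s = s} {t = t ⊕ s′} (≗-trans h eq)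
  ... | s₁ , u , eq₁ , hs , hu with env-split Γ {u} {s = t} {t = s′} hu
  ... | s₂ , s₃ , eq₂ , ht , hs′ =
    iter (trans eq₁ (cong (s₁ ∙_) eq₂)) (⟪⟫⇒⟦⟧-at d hs a) (⟪⟫⇒⟦⟧-at e ht b) (⟪⟫⇒⟦⟧-loop d e hs′ l)

  -- Soundness

  -- The leaf condition is demanded of identifiers in `P` only. `unβ` depends on this restriction:
  -- its relation treats an identifier on the argument's side as part of `N`.
  substitute≲ : (θ : Fin m → Tm n) {Φ : Env n → Env m → Set} → Simulation Φ →
                {Γ : Vec Ty m} {P : Fin m → Set} →
                (∀ i → P i → ∀ {s a} → ⟪ θ i ⟫ s a → ∃ λ s′ → Φ s s′ × Single i a s′) →
                ∀ {M B} → Typed Γ P M B → Φ ⊢ substitute θ M ≲ M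
  substitute≲-under :
    (θ : Fin m → Tm n) {Φ : Env n → Env m → Set} → Simulation Φ →
    {Γ : Vec Ty m} {P : Fin m → Set} →
    (∀ i → P i → ∀ {s a} → ⟪ θ i ⟫ s a → ∃ λ s′ → Φ s s′ × Single i a s′) →
    ∀ {A M B} → Typed (A ∷ Γ) (P ⁺) M B → Lift Φ ⊢ substitute (exts θ) M ≲ M
  substitute≲-under {n = n} θ {Φ} sim {P = P} h = substitute≲ (exts θ) (lift-sim sim) leaf′
    where
    leaf′ : ∀ i → (P ⁺) i → ∀ {s a} → ⟪ exts θ i ⟫ s a → ∃ λ s′ → Lift Φ s s′ × Single i a s′
    leaf′ zero    _ d = lift-zero sim d
    leaf′ (suc i) p d with unrename-suc (θ i) d
    ... | d′ , q with h i p d′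
    ... | s′ , φ , q′ = [] ▹ s′ , (sym q , φ) , suc-Single q′
  substitute≲ θ sim h (var p _)          = leaf (h _ p)
  substitute≲ θ sim h (lam d)            = ƛ _ (substitute≲-under θ sim h d)
  substitute≲ θ sim h (app q d e)        =
    substitute≲ θ sim (λ i → h i ∘ proj₁) d · substitute≲ θ sim (λ i → h i ∘ proj₁) e
  substitute≲ θ sim h num                = # _
  substitute≲ θ sim h skip               = skip
  substitute≲ θ sim h (op d e)           = op _ (substitute≲ θ sim h d) (substitute≲ θ sim h e)
  substitute≲ θ sim h (seq b d e)        = substitute≲ θ sim h d ⨾ substitute≲ θ sim h e
  substitute≲ θ sim h (assign d e)       = substitute≲ θ sim h d ≔ substitute≲ θ sim h e
  substitute≲ θ sim h (deref d)          = ! substitute≲ θ sim h d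
  substitute≲ θ sim h (while d e)        = while (substitute≲ θ sim h d) (substitute≲ θ sim h e)
  substitute≲ θ sim h (ifzero b d e f)   =
    ifzero (substitute≲ θ sim h d) (substitute≲ θ sim h e) (substitute≲ θ sim h f)
  substitute≲ θ sim h (new b d)          = new (substitute≲-under θ sim h d)
  substitute≲ θ sim h random             = random
  substitute≲ θ sim h (mkvar d e)        = mkvar (substitute≲ θ sim h d) (substitute≲ θ sim h e)

  when : Bool → List Tr → List Tr
  when true  t = t
  when false _ = []

  when-++ : ∀ c s t → when c (s ++ t) ≡ when c s ++ when c t
  when-++ true  s t = refl
  when-++ false s t = refl

  when-[] : ∀ c → when c [] ≡ []
  when-[] true  = refl
  when-[] false = refl

  -- As M and N use disjoint identifiers, nothing has to be said about how the
  -- actions of the two are interleaved.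
  unβ : {Γ : Vec Ty n} {P : Fin n → Set} (q : Fin n → Bool) → ∀ {A B} M N →
        Typed (A ∷ Γ) ((λ i → P i × q i ≡ true) ⁺) M B →
        Typed Γ (λ i → P i × q i ≡ false) N A →
        ∀ {u b} → ⟪ M [ N /0] ⟫ u b →
        ∃ λ as → ⟪ M ⟫ (as ▹ λ j → when (q j) (u j)) b ×
                 Many ⟪ N ⟫ (λ j → when (not (q j)) (u j)) as
  unβ {n} {P = P} q M N d e {u} x with simulate sim (substitute≲ _ sim leaf′ d) x
    where
    Φ : Env n → Env (suc n) → Set
    -- The argument's share of `u` is parsed into one run of `N` per action of the bound identifier;
    -- the function's share is left alone.
    Φ u s = Many ⟪ N ⟫ (λ j → when (not (q j)) (u j)) (s zero) ×
            (∀ j → s (suc j) ≡ when (q j) (u j))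
    sim : Simulation Φ
    sim = record
      { unit = λ e →
          [] (λ j → trans (cong (when _) (e j)) (when-[] _)) ,
          λ j → sym (trans (cong (when (q j)) (e j)) (when-[] _))
      ; mult = λ {_} {s} {t} e (p , φ) (p′ , ψ) →
          Many-resp N (λ j → sym (trans (cong (when _) (e j)) (when-++ _ (s j) (t j))))
            (MonRel.multiply (extend (envs n) ⟪ N ⟫) p p′) ,
          λ j → trans (cong₂ _++_ (φ j) (ψ j))
                  (sym (trans (cong (when (q j)) (e j)) (when-++ _ (s j) (t j))))
      }
    leaf′ : ∀ i → ((λ i → P i × q i ≡ true) ⁺) i → ∀ {s a} → _ →
            ∃ λ s′ → Φ s s′ × Single i a s′
    leaf′ zero _ {s} {a} y =
      [ a ] ▹ ∅ ,
      (((λ j → trans (kept j) (sym (++-identityʳ (s j)))) , y) ∷ [] (λ _ → refl) , dropped) ,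
      zero-Single
      where
      kept : ∀ j → when (not (q j)) (s j) ≡ s j
      kept j with q j in eq
      ... | false = refl
      ... | true  = sym (unused-empty
        (λ (_ , z) → case trans (sym eq) z of λ ()) e y)
      dropped : ∀ j → [] ≡ when (q j) (s j)
      dropped j with q j in eq
      ... | false = refl
      ... | true  = sym (unused-empty
        (λ (_ , z) → case trans (sym eq) z of λ ()) e y)
    leaf′ (suc i) (_ , qi) {s} (y , z) =
      [] ▹ s , ([] dropped , kept) , suc-Single (y , z)
      where
      dropped : ∀ j → when (not (q j)) (s j) ≡ []
      dropped j with i ≟ᶠ j
      ... | yes refl rewrite qi = refl
      ... | no i≢j = trans (cong (when _) (z j (i≢j ∘ sym))) (when-[] _)
      kept : ∀ j → s j ≡ when (q j) (s j)
      kept j with i ≟ᶠ j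
      ... | yes refl rewrite qi = refl
      ... | no i≢j =
        trans (z j (i≢j ∘ sym)) (sym (trans (cong (when _) (z j (i≢j ∘ sym))) (when-[] _)))
  ... | s , (p , φ) , y =
    s zero , resp M (λ { zero → refl ; (suc j) → φ j }) y , p

  -- Store histories and the soundness invariant

  infix 4 _─_⟶_

  -- Every cell follows its own history. The relative order of actions on different cells is left
  -- out, as it is in `⟪_⟫`.
  record _─_⟶_ {n} (σ : Store n) (u : Env n) (σ′ : Store n) : Set where
    constructor paths
    field
      at : ∀ i → Path (lookup σ i) (u i) (lookup σ′ i)

  open _─_⟶_

  Path-++ : ∀ {x y z s t} → Path x s y → Path y t z → Path x (s ++ t) z
  Path-++ []         q = q
  Path-++ (read∷ p)  q = read∷ (Path-++ p q)
  Path-++ (write∷ p) q = write∷ (Path-++ p q)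

  vars : ∀ n → Vec Ty n
  vars n = Vec.replicate n var

  vars-∈ : ∀ (i : Fin n) {t} → All (_∈ var) t → All (_∈ lookup (vars n) i) t
  vars-∈ i {t} = subst (λ A → All (_∈ A) t) (sym (lookup-replicate i var))

  ⟶-⊨ : {σ σ′ : Store n} {u : Env n} → σ ─ u ⟶ σ′ → vars n ⊨ u
  ⟶-⊨ p i = vars-∈ i (Path-∈ (at p i))

  ⊕-⊨ : {Γ : Vec Ty n} {s t : Env n} → Γ ⊨ s → Γ ⊨ t → Γ ⊨ (s ⊕ t)
  ⊕-⊨ h h′ i = All.++⁺ (h i) (h′ i)

  when-⊨ : (Γ : Vec Ty n) (c : Fin n → Bool) {s : Env n} → Γ ⊨ s → Γ ⊨ (λ j → when (c j) (s j))
  when-⊨ Γ c h i with c i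
  ... | true  = h i
  ... | false = []

  single-⊨ : ∀ (i : Fin n) {a} → vars n ⊨ single i (acc a)
  single-⊨ i j with i ≟ᶠ j
  ... | no _     = []
  ... | yes refl = vars-∈ i (acc ∷ [])

  infixr 7 _⊕⟶_

  _⊕⟶_ : {σ σ′ σ″ : Store n} {s t : Env n} →
         σ ─ s ⟶ σ′ → σ′ ─ t ⟶ σ″ → σ ─ s ⊕ t ⟶ σ″
  p ⊕⟶ q = paths λ i → Path-++ (at p i) (at q i)

  written : (σ : Store n) → ∀ i x → σ ─ single i (acc (write x)) ⟶ σ [ i ]≔ x
  written σ i x = paths path
    where
    path : ∀ j → Path (lookup σ j) (single i (acc (write x)) j) (lookup (σ [ i ]≔ x) j)
    path j with i ≟ᶠ j
    ... | yes refl rewrite lookup∘update i σ x = write∷ []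
    ... | no i≢j rewrite lookup∘update′ (i≢j ∘ sym) σ x = []

  seen : (σ : Store n) → ∀ i → σ ─ single i (acc (read (lookup σ i))) ⟶ σ
  seen σ i = paths path
    where
    path : ∀ j → Path (lookup σ j) (single i (acc (read (lookup σ i))) j) (lookup σ j)
    path j with i ≟ᶠ j
    ... | yes refl = read∷ []
    ... | no _     = []

  base-∈ : ∀ {B b} → Base B → b ∈ B → BaseTrace b
  base-∈ nat  nm  = nm
  base-∈ comm ⋆   = ⋆
  base-∈ var  acc = acc

  ⇓-value : {σ σ′ : Store n} {M V : Tm n} → σ ∣ M ⇓ σ′ ∣ V → Value V
  ⇓-value (value v)            = v
  ⇓-value (app _ d)            = ⇓-value d
  ⇓-value (op _ _)             = num
  ⇓-value (assign _ _)         = skip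
  ⇓-value (deref _)            = num
  ⇓-value (seq _ d)            = ⇓-value d
  ⇓-value (while-≢0 _ _)       = skip
  ⇓-value (while-0 _ _ _)      = skip
  ⇓-value (ifzero-0 _ d)       = ⇓-value d
  ⇓-value (ifzero-≢0 _ _ d)    = ⇓-value d
  ⇓-value (new {V = V} d)      = unrename-value V (⇓-value d)
    where
    unrename-value : ∀ V → Value (rename suc V) → Value V
    unrename-value (` i) v = ident
    unrename-value (ƛ A M) v = lam
    unrename-value (# x) v = num
    unrename-value skip v = skip
    unrename-value (mkvar M N) v = mkvar
  ⇓-value (random x)           = num
  ⇓-value (assign-mkvar _ _ d) = ⇓-value d
  ⇓-value (deref-mkvar _ d)    = ⇓-value d

  numerals : ∀ {x as} {u : Env n} → Many ⟪ # x ⟫ u as →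
             u ≗ ∅ × ∃ λ k → as ≡ replicate k (nm x)
  numerals ([] e) = e , 0 , refl
  numerals ((e , (h , refl)) ∷ ds) with numerals ds
  ... | h′ , k , refl = (λ i → trans (e i) (cong₂ _++_ (h i) (h′ i))) , suc k , refl

  ground-value : ∀ {P : Fin (suc n) → Set} V {B} → Ground B →
                 Value (rename suc V) → Typed (vars (suc n)) P (rename suc V) B →
                 (∃ λ x → V ≡ # x × B ≡ nat) ⊎ (V ≡ skip × B ≡ comm)
  ground-value (# x) g v num = inj₁ (x , refl , refl)
  ground-value skip g v skip = inj₂ (refl , refl)
  ground-value (` i) g v (var _ refl) = case subst Ground (lookup-replicate i var) g of λ ()
  ground-value (ƛ A M) () v (lam d)
  ground-value (mkvar M N) () v (mkvar d e)

  infix 2 _▷_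

  -- A value may still act when it is used: `s` is what evaluation itself performs, `t` what is left
  -- to the value.
  data Run (σ : Store n) (M : Tm n) (σ′ : Store n) (t : Env n) (b : Tr) : Set where
    _▷_ : ∀ {s} → σ ─ s ⟶ σ′ → ⟪ M ⟫ (s ⊕ t) b → Run σ M σ′ t b

  data Eval (σ : Store n) (M : Tm n) (σ′ : Store n) (b : Tr) : Set where
    _▷_ : ∀ {s} → σ ─ s ⟶ σ′ → ⟪ M ⟫ s b → Eval σ M σ′ b

  -- Subject reduction is proved along with the statement on traces, because undoing a β-step needs
  -- the split typing of the contracted redex.
  record Sound (P : Fin n → Set) (σ : Store n) (M : Tm n) (σ′ : Store n) (V : Tm n)
               (B : Ty) : Set where
    constructor _,_
    field
      typing : Typed (vars n) P V B
      traces : ∀ {t b} → vars n ⊨ t → ⟪ V ⟫ t b → Run σ M σ′ t b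

  open Sound

  run : {P : Fin n → Set} → ∀ {σ M σ′ V B b} → Sound P σ M σ′ V B → ⟪ V ⟫ ∅ b →
        Eval σ M σ′ b
  run {M = M} f v with traces f (λ _ → []) v
  ... | p ▷ x = p ▷ resp M (λ i → ++-identityʳ _) x

  settle : {σ σ′ : Store n} {M : Tm n} {t : Env n} {b : Tr} → t ≗ ∅ →
           Eval σ M σ′ b → Run σ M σ′ t b
  settle {M = M} e (_▷_ {s = s} p x) =
    p ▷ resp M (λ i → sym (trans (cong (s i ++_) (e i)) (++-identityʳ (s i)))) x

  ⊕-assoc : (s t u : Env n) → (s ⊕ t) ⊕ u ≗ s ⊕ (t ⊕ u)
  ⊕-assoc s t u i = ++-assoc (s i) (t i) (u i)

  -- Induction on the evaluation, with traces going back from the value to the term. As the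
  -- remainder `t` is arbitrary, consecutive evaluations chain: what the later one performs belongs
  -- to what the earlier one leaves open.
  sound : {P : Fin n → Set} → ∀ {σ σ′ M V B} →
          Typed (vars n) P M B → σ ∣ M ⇓ σ′ ∣ V → Sound P σ M σ′ V B
  sound d (value v) = d , λ _ x → paths (λ _ → []) ▷ x
  sound {n} (app q d e) (app {σ} {σ′} {σ″} {M = M} {M′} {N} r r′) with sound d r
  ... | lam d′ , f with sound (Typed-β q d′ e) r′
  ... | dV , g = dV , λ t∈ x → result t∈ (g t∈ x)
    where
    result : ∀ {t b} → vars n ⊨ t → Run σ′ (M′ [ N /0]) σ″ t b → Run σ (M · N) σ″ t b
    -- The trace of the contractum is separated into a trace of the body and the runs of `N`.
    -- Abstracting the former gives a trace of the value of `M`, to which the induction hypothesis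
    -- applies.
    result {t} t∈ (_▷_ {s = s₂} p₂ y) with unβ q M′ N d′ e y
    ... | as , z , zs with f (when-⊨ (vars n) q u∈)
                             (as , _ , refl , Many-∈ e (when-⊨ (vars n) (not ∘ q) u∈) zs , z)
      where
      u∈ : vars n ⊨ (s₂ ⊕ t)
      u∈ = ⊕-⊨ {Γ = vars n} (⟶-⊨ p₂) t∈
    ... | _▷_ {s = s₁} p₁ y′ =
      (p₁ ⊕⟶ p₂) ▷ as , _ , _ ,
      (λ i → trans (⊕-assoc s₁ s₂ t i) (share (q i) (s₁ i) ((s₂ ⊕ t) i))) , y′ , zs
      where
      -- At each identifier `u` goes as a whole to one of the two sides, so no interleaving has to
      -- be described.
      share : ∀ c s u → s ++ u ≡ (s ++ when c u) ++ when (not c) u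
      share true  s u = sym (++-identityʳ (s ++ u))
      share false s u = cong (_++ u) (sym (++-identityʳ s))
  sound (op d e) (op r r′) with sound d r | sound e r′
  ... | f | g with run f ((λ _ → refl) , refl) | run g ((λ _ → refl) , refl)
  ... | p₁ ▷ x₁ | p₂ ▷ x₂ = num , λ { _ (e , refl) → settle e
    ((p₁ ⊕⟶ p₂) ▷ _ , _ , refl , _ , _ , (λ _ → refl) , x₁ , x₂) }
  -- Evaluation of the target stops at an identifier. The write is the action still owed by this
  -- value, and `written` lets the store perform it.
  sound (assign d e) (assign {σ″ = σ″} {i = i} {x} r r′) with sound e r | sound d r′
  ... | f | _ , g with run f ((λ _ → refl) , refl)
                     | g (single-⊨ i) (single-Single i (acc (write x)))
  ... | p₁ ▷ x₁ | p₂ ▷ x₂ = skip , λ { _ (e , refl) → settle e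
    ((p₁ ⊕⟶ (p₂ ⊕⟶ written σ″ i x)) ▷ x , refl , _ , _ , (λ _ → refl) , x₁ , x₂) }
  sound {n} (assign d e) (assign-mkvar {σ} {σ′} {σ″} {σ‴} {M} {N} {M₁} {x = x} r r′ r″)
    with sound e r | sound d r′
  ... | f | mkvar d₁ d₂ , g
    with run f ((λ _ → refl) , refl)
       -- The numeral uses no identifier, so the split gives all of them to `M₁`.
       | sound (app (λ _ → true) (weaken (λ _ p → p , refl) d₁) num) r″
  ... | _▷_ {s = s₁} p₁ x₁ | dV , h = dV , λ {t} t∈ y → result t∈ (trace-∈ dV t∈ y) (h t∈ y)
    where
    result : ∀ {t b} → vars n ⊨ t → b ∈ comm → Run σ″ (M₁ · # x) σ‴ t b → Run σ (M ≔ N) σ‴ t b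
    -- The write procedure may consult its argument any number `k` of times and always finds `x`,
    -- which is the shape required by the `write` clause of `mkvar`.
    result {t} t∈ ⋆ (_▷_ {s = s₃} p₃ (as , v , w , eq , y , ys)) with numerals ys
    ... | w≗ , k , refl with g {b = acc (write x)} (⊕-⊨ {Γ = vars n} (⟶-⊨ p₃) t∈)
      (inj₁ (x , k , refl ,
        resp M₁ (λ i → sym (trans (eq i)
          (trans (cong (v i ++_) (w≗ i)) (++-identityʳ (v i))))) y))
    ... | _▷_ {s = s₂} p₂ x₂ =
      (p₁ ⊕⟶ (p₂ ⊕⟶ p₃)) ▷ x , refl , s₁ , s₂ ⊕ (s₃ ⊕ t) ,
      (λ i → trans (⊕-assoc s₁ (s₂ ⊕ s₃) t i) (cong (s₁ i ++_) (⊕-assoc s₂ s₃ t i))) , x₁ , x₂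
  sound (deref d) (deref {σ′ = σ′} {i = i} r) with sound d r
  ... | _ , f with f (single-⊨ i) (single-Single i (acc (read (lookup σ′ i))))
  ... | p ▷ x = num , λ { _ (e , refl) → settle e ((p ⊕⟶ seen σ′ i) ▷ _ , refl , x) }
  sound {n} (deref d) (deref-mkvar {σ} {σ′} {σ″} {M} {M₁} {M₂} r r′) with sound d r
  ... | mkvar d₁ d₂ , f with sound d₂ r′
  ... | dV , g = dV , λ t∈ y → result t∈ (trace-∈ dV t∈ y) (g t∈ y)
    where
    result : ∀ {t b} → vars n ⊨ t → b ∈ nat → Run σ′ M₂ σ″ t b → Run σ (! M) σ″ t b
    result {t} t∈ (nm {x}) (_▷_ {s = s₂} p₂ y)
      with f {b = acc (read x)} (⊕-⊨ {Γ = vars n} (⟶-⊨ p₂) t∈) (inj₂ (x , refl , y))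
    ... | _▷_ {s = s₁} p₁ z =
      (p₁ ⊕⟶ p₂) ▷ x , refl , resp M (≗-sym (⊕-assoc s₁ s₂ t)) z
  sound {n} (seq {N = N} b d e) (seq {σ} {σ′} {σ″} {M} r r′) with sound d r | sound e r′
  ... | f | dV , g with run f ((λ _ → refl) , refl)
  ... | _▷_ {s = s₁} p₁ x₁ = dV , λ t∈ y → result (base-∈ b (trace-∈ dV t∈ y)) (g t∈ y)
    where
    result : ∀ {t b} → BaseTrace b → Run σ′ N σ″ t b → Run σ (M ⨾ N) σ″ t b
    result {t} b (_▷_ {s = s₂} p₂ x₂) =
      (p₁ ⊕⟶ p₂) ▷ b , s₁ , s₂ ⊕ t , ⊕-assoc s₁ s₂ t , x₁ , x₂
  sound (while d e) (while-≢0 r x≢0) with run (sound d r) ((λ _ → refl) , refl)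
  ... | p ▷ x = skip , λ { _ (e , refl) → settle e (p ▷ refl , exit (_ , x≢0 , x)) }
  sound (while d e) (while-0 r r′ r″)
    with run (sound d r) ((λ _ → refl) , refl) | run (sound e r′) ((λ _ → refl) , refl)
       | run (sound (while d e) r″) ((λ _ → refl) , refl)
  ... | p₁ ▷ x₁ | p₂ ▷ x₂ | p₃ ▷ _ , x₃ = skip , λ { _ (e , refl) → settle e
    ((p₁ ⊕⟶ (p₂ ⊕⟶ p₃)) ▷ refl , iter (λ _ → refl) x₁ x₂ x₃) }
  sound (ifzero {M = M} {N₁} {N₂} b d e f) (ifzero-0 {σ} {σ′} {σ″} r r′)
    with run (sound d r) ((λ _ → refl) , refl) | sound e r′
  ... | _▷_ {s = s₁} p₁ x₁ | dV , g = dV , λ t∈ y → result (base-∈ b (trace-∈ dV t∈ y)) (g t∈ y)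
    where
    result : ∀ {t b} → BaseTrace b → Run σ′ N₁ σ″ t b → Run σ (ifzero M N₁ N₂) σ″ t b
    result {t} b (_▷_ {s = s₂} p₂ x₂) =
      (p₁ ⊕⟶ p₂) ▷ b , inj₁ (s₁ , s₂ ⊕ t , ⊕-assoc s₁ s₂ t , x₁ , x₂)
  sound (ifzero {M = M} {N₁} {N₂} b d e f) (ifzero-≢0 {σ} {σ′} {σ″} r x≢0 r′)
    with run (sound d r) ((λ _ → refl) , refl) | sound f r′
  ... | _▷_ {s = s₁} p₁ x₁ | dV , g = dV , λ t∈ y → result (base-∈ b (trace-∈ dV t∈ y)) (g t∈ y)
    where
    result : ∀ {t b} → BaseTrace b → Run σ′ N₂ σ″ t b → Run σ (ifzero M N₁ N₂) σ″ t b
    result {t} b (_▷_ {s = s₂} p₂ x₂) =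
      (p₁ ⊕⟶ p₂) ▷ b , inj₂ (s₁ , s₂ ⊕ t , ⊕-assoc s₁ s₂ t , (_ , x≢0 , x₁) , x₂)
  sound (new {M = M} b d) (new {V = V} {x} r) with sound d r
  -- A ground value owes no further action, so the whole history of the new cell lies within the
  -- evaluation and is `s zero`.
  ... | f with ground-value V b (⇓-value r) (typing f)
  ... | inj₁ (v , refl , refl) with run f ((λ _ → refl) , refl)
  ... | _▷_ {s = s} p y = num , λ { _ (e , refl) → settle e
    (paths (at p ∘ suc) ▷ nm , s zero , x , at p zero , resp M (▹-η s) y) }
  sound (new {M = M} b d) (new {V = V} {x} r) | f | inj₂ (refl , refl)
    with run f ((λ _ → refl) , refl)
  ... | _▷_ {s = s} p y = skip , λ { _ (e , refl) → settle e
    (paths (at p ∘ suc) ▷ ⋆ , s zero , x , at p zero , resp M (▹-η s) y) }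
  sound random (random x) = num , λ { _ (e , refl) → settle e
    (paths (λ _ → []) ▷ (λ _ → refl) , x , refl) }

  -- Cutting store histories and moving evaluations to larger stores

  lookup-ext : (σ τ : Store n) → (∀ i → lookup σ i ≡ lookup τ i) → σ ≡ τ
  lookup-ext []      []      h = refl
  lookup-ext (x ∷ σ) (y ∷ τ) h = cong₂ _∷_ (h zero) (lookup-ext σ τ (h ∘ suc))

  ⟶-resp : {σ σ′ : Store n} {u v : Env n} → u ≗ v → σ ─ u ⟶ σ′ → σ ─ v ⟶ σ′
  ⟶-resp h p = paths λ i → subst (λ t → Path _ t _) (h i) (at p i)

  Path-[] : ∀ {x y t} → t ≡ [] → Path x t y → x ≡ y
  Path-[] refl [] = refl

  ⟶-∅ : {σ σ′ : Store n} {u : Env n} → u ≗ ∅ → σ ─ u ⟶ σ′ → σ ≡ σ′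
  ⟶-∅ h p = lookup-ext _ _ λ i → Path-[] (h i) (at p i)

  Path-split : ∀ s {t x z} → Path x (s ++ t) z → ∃ λ y → Path x s y × Path y t z
  Path-split []                p          = _ , [] , p
  Path-split (acc (read _) ∷ s)  (read∷ p)  = let y , q , r = Path-split s p in y , read∷ q , r
  Path-split (acc (write _) ∷ s) (write∷ p) = let y , q , r = Path-split s p in y , write∷ q , r

  ⟶-split : {σ σ′ : Store n} {u s t : Env n} → u ≗ s ⊕ t → σ ─ u ⟶ σ′ →
            ∃ λ τ → σ ─ s ⟶ τ × τ ─ t ⟶ σ′
  ⟶-split {n} {σ} {σ′} {u} {s} {t} h p =
    Vec.tabulate middle ,
    paths (λ i → subst (Path _ _) (sym (lookup∘tabulate middle i)) (proj₁ (proj₂ (pieces i)))) ,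
    paths (λ i → subst (λ y → Path y _ _) (sym (lookup∘tabulate middle i)) (proj₂ (proj₂ (pieces i))))
    where
    pieces : ∀ i → ∃ λ y → Path (lookup σ i) (s i) y × Path y (t i) (lookup σ′ i)
    pieces i = Path-split (s i) (at (⟶-resp h p) i)
    middle : Fin n → ℕ
    middle i = proj₁ (pieces i)

  Agree : (Fin m → Fin n) → Store m → Store n → Set
  Agree ρ σ τ = ∀ i → lookup τ (ρ i) ≡ lookup σ i

  Frame : (Fin m → Fin n) → Store n → Store n → Set
  Frame ρ τ τ′ = ∀ j → (∀ i → ρ i ≢ j) → lookup τ′ j ≡ lookup τ j

  rename-β : (ρ : Fin m → Fin n) (M : Tm (suc m)) (N : Tm m) →
             rename ρ (M [ N /0]) ≡ rename (ext ρ) M [ rename ρ N /0]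
  rename-β ρ M N =
    trans (rename-substitute (λ _ → refl) M)
          (sym (substitute-rename (λ { zero → refl ; (suc i) → refl }) M))

  record Renamed (ρ : Fin m → Fin n) (τ : Store n) (M : Tm m) (σ′ : Store m) (V : Tm m) : Set where
    constructor renamed
    field
      {τ′}  : Store n
      agree : Agree ρ σ′ τ′
      frame : Frame ρ τ τ′
      eval  : τ ∣ rename ρ M ⇓ τ′ ∣ rename ρ V

  ext-inj : {ρ : Fin m → Fin n} → Inj ρ → Inj (ext ρ)
  ext-inj inj {zero}  {zero}  e = refl
  ext-inj inj {suc i} {suc j} e = cong suc (inj (suc-inj e))

  Agree-update : (ρ : Fin m → Fin n) → Inj ρ → ∀ σ τ i x →
                 Agree ρ σ τ → Agree ρ (σ [ i ]≔ x) (τ [ ρ i ]≔ x)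
  Agree-update ρ inj σ τ i x a j with i ≟ᶠ j
  ... | yes refl = trans (lookup∘update (ρ i) τ x) (sym (lookup∘update i σ x))
  ... | no i≢j   = trans (lookup∘update′ (i≢j ∘ sym ∘ inj) τ x)
                         (trans (a j) (sym (lookup∘update′ (i≢j ∘ sym) σ x)))

  -- Injectivity keeps updates of distinct cells distinct; cells outside the image are inaccessible
  -- to the renamed term and so remain fixed.
  eval-rename : (ρ : Fin m → Fin n) → Inj ρ → ∀ {σ σ′ M V} → σ ∣ M ⇓ σ′ ∣ V →
                ∀ {τ} → Agree ρ σ τ → Renamed ρ τ M σ′ V
  eval-rename ρ inj (value v) a = renamed a (λ _ _ → refl) (value (rename-Value v))
    where
    rename-Value : ∀ {M} → Value M → Value (rename ρ M)
    rename-Value num   = num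
    rename-Value skip  = skip
    rename-Value ident = ident
    rename-Value lam   = lam
    rename-Value mkvar = mkvar
  eval-rename ρ inj (app {M′ = M′} {N} r r′) a with eval-rename ρ inj r a
  ... | renamed b f e with eval-rename ρ inj r′ b
  ... | renamed c g e′ = renamed c (λ j h → trans (g j h) (f j h))
    (app e (subst (λ M → _ ∣ M ⇓ _ ∣ _) (rename-β ρ M′ N) e′))
  eval-rename ρ inj (op r r′) a with eval-rename ρ inj r a
  ... | renamed b f e with eval-rename ρ inj r′ b
  ... | renamed c g e′ = renamed c (λ j h → trans (g j h) (f j h)) (op e e′)
  eval-rename ρ inj (assign {σ″ = σ″} {i = i} {x} r r′) a with eval-rename ρ inj r a
  ... | renamed b f e with eval-rename ρ inj r′ b
  ... | renamed {τ″} c g e′ = renamed (Agree-update ρ inj σ″ τ″ i x c)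
    (λ j h → trans (lookup∘update′ (h i ∘ sym) τ″ x) (trans (g j h) (f j h))) (assign e e′)
  eval-rename ρ inj (deref {σ′ = σ′} {i = i} r) a with eval-rename ρ inj r a
  ... | renamed {τ′} b f e =
    renamed b f (subst (λ x → _ ∣ _ ⇓ τ′ ∣ # x) (b i) (deref e))
  eval-rename ρ inj (seq r r′) a with eval-rename ρ inj r a
  ... | renamed b f e with eval-rename ρ inj r′ b
  ... | renamed c g e′ = renamed c (λ j h → trans (g j h) (f j h)) (seq e e′)
  eval-rename ρ inj (while-≢0 r x≢0) a with eval-rename ρ inj r a
  ... | renamed b f e = renamed b f (while-≢0 e x≢0)
  eval-rename ρ inj (while-0 r r′ r″) a with eval-rename ρ inj r a
  ... | renamed b f e with eval-rename ρ inj r′ b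
  ... | renamed c g e′ with eval-rename ρ inj r″ c
  ... | renamed d h e″ =
    renamed d (λ j x → trans (h j x) (trans (g j x) (f j x))) (while-0 e e′ e″)
  eval-rename ρ inj (ifzero-0 r r′) a with eval-rename ρ inj r a
  ... | renamed b f e with eval-rename ρ inj r′ b
  ... | renamed c g e′ = renamed c (λ j h → trans (g j h) (f j h)) (ifzero-0 e e′)
  eval-rename ρ inj (ifzero-≢0 r x≢0 r′) a with eval-rename ρ inj r a
  ... | renamed b f e with eval-rename ρ inj r′ b
  ... | renamed c g e′ = renamed c (λ j h → trans (g j h) (f j h)) (ifzero-≢0 e x≢0 e′)
  eval-rename ρ inj (new {V = V} r) a
    with eval-rename (ext ρ) (ext-inj inj) r {0 ∷ _} (λ { zero → refl ; (suc i) → a i })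
  ... | renamed {y ∷ τ′} b f e =
    renamed (b ∘ suc) (λ j h → f (suc j) λ { (suc i) refl → h i refl })
      (new (subst (λ V → _ ∣ _ ⇓ y ∷ τ′ ∣ V) (rename-ext-suc ρ V) e))
  eval-rename ρ inj (random x) a = renamed a (λ _ _ → refl) (random x)
  eval-rename ρ inj (assign-mkvar r r′ r″) a with eval-rename ρ inj r a
  ... | renamed b f e with eval-rename ρ inj r′ b
  ... | renamed c g e′ with eval-rename ρ inj r″ c
  ... | renamed d h e″ =
    renamed d (λ j x → trans (h j x) (trans (g j x) (f j x))) (assign-mkvar e e′ e″)
  eval-rename ρ inj (deref-mkvar r r′) a with eval-rename ρ inj r a
  ... | renamed b f e with eval-rename ρ inj r′ b
  ... | renamed c g e′ = renamed c (λ j h → trans (g j h) (f j h)) (deref-mkvar e e′)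

  -- The large store is restricted along `ρ`, the given evaluation is run there and carried back.
  -- Outside the image `push ρ u` is empty, so `τ` and `τ′` agree there, as the frame demands.
  transfer : (ρ : Fin m → Fin n) → Inj ρ → ∀ {M V u} →
             (∀ {σ σ′} → σ ─ u ⟶ σ′ → σ ∣ M ⇓ σ′ ∣ V) →
             ∀ {τ τ′} → τ ─ push ρ u ⟶ τ′ → τ ∣ rename ρ M ⇓ τ′ ∣ rename ρ V
  transfer {m} ρ inj {M} {V} {u} f {τ} {τ′} p with eval-rename ρ inj (f q) (agree τ)
    where
    restrict : Store _ → Store m
    restrict τ = Vec.tabulate (lookup τ ∘ ρ)
    agree : ∀ τ → Agree ρ (restrict τ) τ
    agree τ i = sym (lookup∘tabulate (lookup τ ∘ ρ) i)
    q : restrict τ ─ u ⟶ restrict τ′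
    q = paths λ i → subst₂ (λ x y → Path x (u i) y) (agree τ i) (agree τ′ i)
          (subst (λ t → Path (lookup τ (ρ i)) t (lookup τ′ (ρ i))) (push-in ρ inj u i) (at p (ρ i)))
  ... | renamed {τ″} a g e = subst (λ τ → _ ∣ _ ⇓ τ ∣ _) (lookup-ext τ″ τ′ same) e
    where
    same : ∀ j → lookup τ″ j ≡ lookup τ′ j
    same j with any? (λ i → ρ i ≟ᶠ j)
    ... | yes (i , refl) = trans (a i) (lookup∘tabulate (lookup τ′ ∘ ρ) i)
    ... | no ¬e          = trans (g j (λ i e → ¬e (i , e)))
                            (Path-[] (push-out ρ u j (λ i e → ¬e (i , e))) (at p j))

  -- Adequacy

  -- A term of type `var` may evaluate to an identifier or to a `mkvar`, so only the effect of a
  -- completed read or write is observed. The clause for functions is a placeholder: `Realize` tests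
  -- those by application.
  Observe : Tr → Tm n → Store n → Store n → Set
  Observe (nm x)          M σ σ′ = σ ∣ M ⇓ σ′ ∣ # x
  Observe ⋆               M σ σ′ = σ ∣ M ⇓ σ′ ∣ skip
  Observe (acc (read x))  M σ σ′ = σ ∣ ! M ⇓ σ′ ∣ # x
  Observe (acc (write x)) M σ σ′ = σ ∣ M ≔ # x ⇓ σ′ ∣ skip
  Observe (as ⇒ b)        M σ σ′ = ⊤

  Apart : Env n → Env n → Set
  Apart u t = ∀ j → u j ≡ [] ⊎ t j ≡ []

  Realize₀ : Tr → Tm n → Env n → Set
  Realize₀ b M u = ∀ {σ σ′} → σ ─ u ⟶ σ′ → Observe b M σ σ′

  -- Realize b M u: the term M produces b while the store cells behave as in u.
  -- The clause for functions is Kripke-style, ρ being an extension of the store.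
  Realize : Tr → Tm n → Env n → Set
  Realizes : List Tr → Tm n → Env n → Set
  Realize (nm x)  M u = Realize₀ (nm x) M u
  Realize ⋆       M u = Realize₀ ⋆ M u
  Realize (acc a) M u = Realize₀ (acc a) M u
  Realize {n} (as ⇒ b) M u =
    ∀ {k} (ρ : Fin n → Fin k) → Inj ρ → ∀ N t → Apart (push ρ u) t →
    Realizes as N t → Realize b (rename ρ M · N) (push ρ u ⊕ t)
  Realizes []       N t = t ≗ ∅
  Realizes (a ∷ as) N t = ∃₂ λ t₁ t₂ → t ≗ t₁ ⊕ t₂ × Realize a N t₁ × Realizes as N t₂

  to₀ : ∀ {b} → BaseTrace b → {M : Tm n} {u : Env n} → Realize b M u → Realize₀ b M u
  to₀ nm  r = r
  to₀ ⋆   r = r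
  to₀ acc r = r

  from₀ : ∀ {b} → BaseTrace b → {M : Tm n} {u : Env n} → Realize₀ b M u → Realize b M u
  from₀ nm  r = r
  from₀ ⋆   r = r
  from₀ acc r = r

  Realize-resp : ∀ b {M : Tm n} {u v : Env n} → u ≗ v → Realize b M u → Realize b M v
  Realize-resp (nm x)  h r p = r (⟶-resp (≗-sym h) p)
  Realize-resp ⋆       h r p = r (⟶-resp (≗-sym h) p)
  Realize-resp (acc a) h r p = r (⟶-resp (≗-sym h) p)
  Realize-resp (as ⇒ b) {u = u} {v} h r ρ inj N t ap rs =
    Realize-resp b (λ j → cong (_++ t j) (push-cong ρ inj h j))
      (r ρ inj N t (λ j → Sum.map₁ (trans (push-cong ρ inj h j)) (ap j)) rs)

  Realizes-resp : ∀ as {M : Tm n} {u v : Env n} → u ≗ v → Realizes as M u → Realizes as M v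
  Realizes-resp []       h r = ≗-trans (≗-sym h) r
  Realizes-resp (a ∷ as) h (t₁ , t₂ , e , r) = t₁ , t₂ , ≗-trans (≗-sym h) e , r

  Realizes-++⁻ : ∀ as {bs} {M : Tm n} {u : Env n} → Realizes (as ++ bs) M u →
                 ∃₂ λ s t → u ≗ s ⊕ t × Realizes as M s × Realizes bs M t
  Realizes-++⁻ [] {u = u} r = ∅ , u , (λ _ → refl) , (λ _ → refl) , r
  Realizes-++⁻ (a ∷ as) (t₁ , t₂ , e , r , rs) with Realizes-++⁻ as rs
  ... | s , t , e′ , rs₁ , rs₂ =
    t₁ ⊕ s , t ,
    (λ i → trans (e i) (trans (cong (t₁ i ++_) (e′ i)) (sym (++-assoc (t₁ i) (s i) (t i))))) ,
    (t₁ , s , (λ _ → refl) , r , rs₁) , rs₂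

  push-∘ : (ρ : Fin k → Fin l) (ρ′ : Fin l → Fin m) → Inj ρ → Inj ρ′ →
           ∀ u → push (ρ′ ∘ ρ) u ≗ push ρ′ (push ρ u)
  push-∘ ρ ρ′ inj inj′ u = ≗-sym (push-unique (ρ′ ∘ ρ)
    ((λ i → sym (trans (push-in ρ′ inj′ (push ρ u) (ρ i)) (push-in ρ inj u i))) , off))
    where
    off : ∀ j → (∀ i → ρ′ (ρ i) ≢ j) → push ρ′ (push ρ u) j ≡ []
    off j h with any? (λ i → ρ′ i ≟ᶠ j)
    ... | yes (i , refl) = push-out ρ u i λ k e → h k (cong ρ′ e)
    ... | no _           = refl

  push-id : (u : Env n) → push id u ≗ u
  push-id u = ≗-sym (push-unique id ((λ _ → refl) , λ j h → ⊥-elim (h j refl)))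

  -- Kripke monotonicity: evaluations are transferred at base traces, and at functions two
  -- successive extensions compose to one.
  Realize-rename : ∀ b {M : Tm m} {u : Env m} (ρ : Fin m → Fin n) → Inj ρ →
                   Realize b M u → Realize b (rename ρ M) (push ρ u)
  Realize-rename (nm x)          ρ inj r = transfer ρ inj r
  Realize-rename ⋆               ρ inj r = transfer ρ inj r
  Realize-rename (acc (read x))  ρ inj r = transfer ρ inj r
  Realize-rename (acc (write x)) ρ inj r = transfer ρ inj r
  Realize-rename (as ⇒ b) {M} {u} ρ inj r ρ′ inj′ N t ap rs =
    subst (λ M → Realize b (M · N) _) (sym (rename-rename (λ _ → refl) M))
      (Realize-resp b (λ j → cong (_++ t j) (push-∘ ρ ρ′ inj inj′ u j))
        (r (ρ′ ∘ ρ) (inj ∘ inj′) N t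
          (λ j → Sum.map₁ (trans (push-∘ ρ ρ′ inj inj′ u j)) (ap j)) rs))

  Realizes-rename : ∀ as {M : Tm m} {u : Env m} (ρ : Fin m → Fin n) → Inj ρ →
                    Realizes as M u → Realizes as (rename ρ M) (push ρ u)
  Realizes-rename []       ρ inj r = ≗-trans (push-cong ρ inj r) (push-∅ ρ)
  Realizes-rename (a ∷ as) ρ inj (t₁ , t₂ , e , r , rs) =
    push ρ t₁ , push ρ t₂ , ≗-trans (push-cong ρ inj e) (push-⊕ ρ inj t₁ t₂) ,
    Realize-rename a ρ inj r , Realizes-rename as ρ inj rs

  Realize-· : ∀ as b {M N : Tm n} {u t : Env n} → Realize (as ⇒ b) M u → Apart u t →
              Realizes as N t → Realize b (M · N) (u ⊕ t)
  Realize-· as b {M} {N} {u} {t} r ap rs =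
    subst (λ M → Realize b (M · N) _) (rename-id (λ _ → refl) M)
      (Realize-resp b (λ j → cong (_++ t j) (push-id u j))
        (r id id N t (λ j → Sum.map₁ (trans (push-id u j)) (ap j)) rs))

  Observe-mono : ∀ {b} → BaseTrace b → {M M′ : Tm n} {σ τ σ′ : Store n} →
                 (∀ {ω V} → σ ∣ M ⇓ ω ∣ V → τ ∣ M′ ⇓ ω ∣ V) →
                 Observe b M σ σ′ → Observe b M′ τ σ′
  Observe-mono nm f r = f r
  Observe-mono ⋆  f r = f r
  Observe-mono (acc {read x})  f (deref r)         = deref (f r)
  Observe-mono (acc {read x})  f (deref-mkvar r s) = deref-mkvar (f r) s
  Observe-mono (acc {write x}) f (assign (value num) r) = assign (value num) (f r)
  Observe-mono (acc {write x}) f (assign-mkvar (value num) r s) =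
    assign-mkvar (value num) (f r) s

  infix 4 _⊑_

  -- Closed under renaming by definition, because the function clause of `Realize` renames a term
  -- before applying it. β-expansion is the intended instance.
  _⊑_ : Tm n → Tm n → Set
  _⊑_ {n} M M′ = ∀ {k} (ρ : Fin n → Fin k) → ∀ {σ σ′ V} →
                 σ ∣ rename ρ M ⇓ σ′ ∣ V → σ ∣ rename ρ M′ ⇓ σ′ ∣ V

  ⊑-eval : {M M′ : Tm n} → M ⊑ M′ → ∀ {σ σ′ V} → σ ∣ M ⇓ σ′ ∣ V → σ ∣ M′ ⇓ σ′ ∣ V
  ⊑-eval {M = M} {M′} h r =
    subst (λ M → _ ∣ M ⇓ _ ∣ _) (rename-id (λ _ → refl) M′)
      (h id (subst (λ M → _ ∣ M ⇓ _ ∣ _) (sym (rename-id (λ _ → refl) M)) r))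

  ⊑-· : {M M′ : Tm m} → M ⊑ M′ → (ρ : Fin m → Fin n) (N : Tm n) →
        rename ρ M · N ⊑ rename ρ M′ · N
  ⊑-· {M = M} {M′} h ρ N ρ′ (app r s) =
    app (subst (λ M → _ ∣ M ⇓ _ ∣ _) (sym (rename-rename (λ _ → refl) M′))
          (h (ρ′ ∘ ρ) (subst (λ M → _ ∣ M ⇓ _ ∣ _) (rename-rename (λ _ → refl) M) r))) s

  ⊑-β : (A : Ty) (M : Tm (suc n)) (N : Tm n) → M [ N /0] ⊑ ƛ A M · N
  ⊑-β A M N ρ r = app (value lam) (subst (λ M → _ ∣ M ⇓ _ ∣ _) (rename-β ρ M N) r)

  Realize-⊑ : ∀ b {M M′ : Tm n} {u : Env n} → M ⊑ M′ → Realize b M u → Realize b M′ u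
  Realize-⊑ (nm x)   h r p = ⊑-eval h (r p)
  Realize-⊑ ⋆        h r p = ⊑-eval h (r p)
  Realize-⊑ (acc a) {M} {M′} h r p = Observe-mono acc {M = M} {M′ = M′} (⊑-eval h) (r p)
  Realize-⊑ (as ⇒ b) {M} h r ρ inj N t ap rs =
    Realize-⊑ b (⊑-· {M = M} h ρ N) (r ρ inj N t ap rs)

  -- Affinity on the side of the store: no cell is used by two of the histories `U i`, so
  -- superposing them to `u` involves no interleaving. Ownership concerns the histories at hand, not
  -- the syntax of the substituted terms.
  Shared : (Fin m → Env n) → Env n → Set
  Shared U u = ∀ j → (u j ≡ [] × (∀ i → U i j ≡ [])) ⊎
                     (∃ λ i → u j ≡ U i j × (∀ i′ → i′ ≢ i → U i′ j ≡ []))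

  record Realizer (θ : Fin m → Tm n) (s : Env m) (u : Env n) : Set where
    constructor realizer
    field
      {U}      : Fin m → Env n
      shared   : Shared U u
      realizes : ∀ i → Realizes (s i) (θ i) (U i)

  open Realizer

  realizer-∅ : {θ : Fin m → Tm n} {s : Env m} {u : Env n} → Realizer θ s u → s ≗ ∅ → u ≗ ∅
  realizer-∅ {θ = θ} (realizer {U} sh r) h j with sh j
  ... | inj₁ (e , _)     = e
  ... | inj₂ (i , e , _) =
    trans e (subst (λ as → Realizes as (θ i) (U i)) (h i) (r i) j)

  -- Each `U i` is cut where `s i` is cut, and every cell takes its pieces from its owner. If each
  -- identifier acts in one half only, so does the owner of each cell, whence apartness.
  realizer-split :
    {θ : Fin m → Tm n} {s s₁ s₂ : Env m} {u : Env n} → Realizer θ s u → s ≗ s₁ ⊕ s₂ →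
    ∃₂ λ u₁ u₂ → u ≗ u₁ ⊕ u₂ × Realizer θ s₁ u₁ × Realizer θ s₂ u₂ ×
      ((∀ i → s₁ i ≡ [] ⊎ s₂ i ≡ []) → Apart u₁ u₂)
  realizer-split {m} {n} {θ} {s} {s₁} {s₂} {u} (realizer {U} sh r) h =
    (λ j → pick U₁ (sh j)) , (λ j → pick U₂ (sh j)) , (λ j → eq (sh j)) ,
    realizer (λ j → shared₁ (sh j)) (λ i → proj₁ (proj₂ (proj₂ (proj₂ (parts i))))) ,
    realizer (λ j → shared₂ (sh j)) (λ i → proj₂ (proj₂ (proj₂ (proj₂ (parts i))))) ,
    λ a j → apart a (sh j)
    where
    parts : ∀ i → ∃₂ λ t₁ t₂ → U i ≗ t₁ ⊕ t₂ × Realizes (s₁ i) (θ i) t₁ × Realizes (s₂ i) (θ i) t₂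
    parts i = Realizes-++⁻ (s₁ i) (subst (λ as → Realizes as (θ i) (U i)) (h i) (r i))
    U₁ U₂ : Fin m → Env n
    U₁ i = proj₁ (parts i)
    U₂ i = proj₁ (proj₂ (parts i))
    U≗ : ∀ i → U i ≗ U₁ i ⊕ U₂ i
    U≗ i = proj₁ (proj₂ (proj₂ (parts i)))
    empty₁ : ∀ i j → U i j ≡ [] → U₁ i j ≡ []
    empty₁ i j e = ++-conicalˡ _ _ (trans (sym (U≗ i j)) e)
    empty₂ : ∀ i j → U i j ≡ [] → U₂ i j ≡ []
    empty₂ i j e = ++-conicalʳ (U₁ i j) _ (trans (sym (U≗ i j)) e)
    Owner : Fin n → Set
    Owner j = (u j ≡ [] × (∀ i → U i j ≡ [])) ⊎
              (∃ λ i → u j ≡ U i j × (∀ i′ → i′ ≢ i → U i′ j ≡ []))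
    pick : (Fin m → Env n) → ∀ {j} → Owner j → List Tr
    pick V {j} (inj₁ _)       = []
    pick V {j} (inj₂ (i , _)) = V i j
    eq : ∀ {j} (o : Owner j) → u j ≡ pick U₁ o ++ pick U₂ o
    eq (inj₁ (e , _))     = e
    eq (inj₂ (i , e , _)) = trans e (U≗ i _)
    shared₁ : ∀ {j} (o : Owner j) → (pick U₁ o ≡ [] × (∀ i → U₁ i j ≡ [])) ⊎
              (∃ λ i → pick U₁ o ≡ U₁ i j × (∀ i′ → i′ ≢ i → U₁ i′ j ≡ []))
    shared₁ (inj₁ (_ , f))     = inj₁ (refl , λ i → empty₁ i _ (f i))
    shared₁ (inj₂ (i , _ , f)) = inj₂ (i , refl , λ i′ i′≢i → empty₁ i′ _ (f i′ i′≢i))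
    shared₂ : ∀ {j} (o : Owner j) → (pick U₂ o ≡ [] × (∀ i → U₂ i j ≡ [])) ⊎
              (∃ λ i → pick U₂ o ≡ U₂ i j × (∀ i′ → i′ ≢ i → U₂ i′ j ≡ []))
    shared₂ (inj₁ (_ , f))     = inj₁ (refl , λ i → empty₂ i _ (f i))
    shared₂ (inj₂ (i , _ , f)) = inj₂ (i , refl , λ i′ i′≢i → empty₂ i′ _ (f i′ i′≢i))
    apart : (∀ i → s₁ i ≡ [] ⊎ s₂ i ≡ []) → ∀ {j} (o : Owner j) →
            pick U₁ o ≡ [] ⊎ pick U₂ o ≡ []
    apart a (inj₁ _) = inj₁ refl
    apart a {j} (inj₂ (i , _)) with a i | parts i
    ... | inj₁ e | _ , _ , _ , r₁ , _ =
      inj₁ (subst (λ as → Realizes as (θ i) _) e r₁ j)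
    ... | inj₂ e | _ , _ , _ , _ , r₂ =
      inj₂ (subst (λ as → Realizes as (θ i) _) e r₂ j)

  locate : (ρ : Fin m → Fin n) → ∀ j → (∃ λ i → ρ i ≡ j) ⊎ (∀ i → ρ i ≢ j)
  locate ρ j with any? (λ i → ρ i ≟ᶠ j)
  ... | yes e = inj₁ e
  ... | no ¬e = inj₂ λ i e → ¬e (i , e)

  -- Apartness of the argument from the old realizer provides a unique owner for every cell after
  -- the argument joins.
  realizer-lam : {θ : Fin m → Tm n} {s : Env m} {u : Env n} → Realizer θ s u →
                 (ρ : Fin n → Fin k) → Inj ρ → ∀ {as N t} → Apart (push ρ u) t →
                 Realizes as N t → (θ′ : Fin (suc m) → Tm k) → θ′ zero ≡ N →
                 (∀ i → θ′ (suc i) ≡ rename ρ (θ i)) →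
                 Realizer θ′ (as ▹ s) (push ρ u ⊕ t)
  realizer-lam {m} {n} {k} {θ} {s} {u} (realizer {U} sh r) ρ inj {as} {N} {t} ap rs θ′ refl hθ =
    realizer {U = V} shared′ λ
      { zero    → rs
      ; (suc i) → subst (λ M → Realizes (s i) M _) (sym (hθ i)) (Realizes-rename (s i) ρ inj (r i)) }
    where
    V : Fin (suc m) → Env k
    V zero    = t
    V (suc i) = push ρ (U i)
    Owner : Fin k → Set
    Owner j = ((push ρ u ⊕ t) j ≡ [] × (∀ i → V i j ≡ [])) ⊎
              (∃ λ i → (push ρ u ⊕ t) j ≡ V i j × (∀ i′ → i′ ≢ i → V i′ j ≡ []))
    argument : ∀ j → push ρ u j ≡ [] → (∀ i → push ρ (U i) j ≡ []) → Owner j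
    argument j e f = inj₂ (zero , cong (_++ t j) e ,
      λ { zero h → ⊥-elim (h refl) ; (suc i) h → f i })
    shared′ : ∀ j → Owner j
    shared′ j with locate ρ j
    ... | inj₂ off = argument j (push-out ρ u j off) λ i → push-out ρ (U i) j off
    ... | inj₁ (i , refl) with sh i
    ... | inj₁ (e , f) = argument (ρ i) (trans (push-in ρ inj u i) e)
                           λ i′ → trans (push-in ρ inj (U i′) i) (f i′)
    ... | inj₂ (o , e , f) with ap (ρ i)
    ... | inj₂ t[] = inj₂ (suc o ,
      trans (cong₂ _++_ (trans (push-in ρ inj u i) e) t[])
        (trans (++-identityʳ _) (sym (push-in ρ inj (U o) i))) ,
      λ { zero _ → t[] ; (suc i′) h → trans (push-in ρ inj (U i′) i) (f i′ (h ∘ cong suc)) })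
    -- The cell has an owner `o`, but its history is empty, so the argument can take it over.
    ... | inj₁ u[] = argument (ρ i) u[] λ i′ → trans (push-in ρ inj (U i′) i) (empty i′)
      where
      empty : ∀ i′ → U i′ i ≡ []
      empty i′ with i′ ≟ᶠ o
      ... | yes refl = trans (sym e) (trans (sym (push-in ρ inj u i)) u[])
      ... | no h     = f i′ h

  push-suc : (u : Env n) → push suc u ≗ ([] ▹ u)
  push-suc u = ≗-sym (push-unique suc
    ((λ _ → refl) , λ { zero _ → refl ; (suc j) h → ⊥-elim (h j refl) }))

  realizer-new : {θ : Fin m → Tm n} {s : Env m} {u : Env n} → Realizer θ s u →
                 ∀ {t} → Realizes t (` zero) (t ▹ ∅) →
                 Realizer (exts θ) (t ▹ s) (t ▹ u)
  realizer-new {m} {n} {θ} {s} {u} (realizer {U} sh r) {t} rt =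
    realizer {U = V}
      (λ { zero → inj₂ (zero , refl ,
             λ { zero h → ⊥-elim (h refl) ; (suc i) h → refl })
         ; (suc j) → under (sh j) })
      λ { zero → rt
        ; (suc i) → Realizes-resp (s i) (push-suc (U i)) (Realizes-rename (s i) suc suc-inj (r i)) }
    where
    V : Fin (suc m) → Env (suc n)
    V zero    = t ▹ ∅
    V (suc i) = [] ▹ U i
    under : ∀ {j} → (u j ≡ [] × (∀ i → U i j ≡ [])) ⊎
                    (∃ λ i → u j ≡ U i j × (∀ i′ → i′ ≢ i → U i′ j ≡ [])) →
            (u j ≡ [] × (∀ i → V i (suc j) ≡ [])) ⊎
            (∃ λ i → u j ≡ V i (suc j) × (∀ i′ → i′ ≢ i → V i′ (suc j) ≡ []))
    under (inj₁ (e , f)) = inj₁ (e , λ { zero → refl ; (suc i) → f i })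
    under (inj₂ (i , e , f)) =
      inj₂ (suc i , e , λ { zero _ → refl ; (suc i′) h → f i′ (h ∘ cong suc) })

  cell-realizes : ∀ {x t y} → Path x t y → Realizes t (` zero) (t ▹ ∅ {n})
  cell-realizes [] = λ { zero → refl ; (suc _) → refl }
  cell-realizes (read∷ {x} {t = t} p) =
    [ acc (read x) ] ▹ ∅ , t ▹ ∅ , (λ { zero → refl ; (suc _) → refl }) , reads , cell-realizes p
    where
    reads : Realize₀ (acc (read x)) (` zero) ([ acc (read x) ] ▹ ∅)
    reads {_ ∷ σ} {_ ∷ σ′} q with at q zero | ⟶-∅ {σ = σ} {σ′} (λ _ → refl) (paths (at q ∘ suc))
    ... | read∷ [] | refl = deref (value ident)
  cell-realizes (write∷ {y = y} {t = t} p) =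
    [ acc (write y) ] ▹ ∅ , t ▹ ∅ , (λ { zero → refl ; (suc _) → refl }) , writes , cell-realizes p
    where
    writes : Realize₀ (acc (write y)) (` zero) ([ acc (write y) ] ▹ ∅)
    writes {_ ∷ σ} {_ ∷ σ′} q with at q zero | ⟶-∅ {σ = σ} {σ′} (λ _ → refl) (paths (at q ∘ suc))
    ... | write∷ [] | refl = assign (value num) (value ident)

  numeral-realizes : ∀ k x → Realizes (replicate k (nm x)) (# x) (∅ {n})
  numeral-realizes zero    x = λ _ → refl
  numeral-realizes (suc k) x = ∅ , ∅ , (λ _ → refl) , constant , numeral-realizes k x
    where
    constant : Realize₀ (nm x) (# x) ∅
    constant {σ} {σ′} p with ⟶-∅ {σ = σ} {σ′} (λ _ → refl) p
    ... | refl = value num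

  -- Successive uses of one argument may touch the same cells: their histories are concatenated in
  -- the order of the list, so the splitting is used without apartness.
  many-realizes : {θ : Fin m → Tm n} {P : Env m → Tr → Set} {N : Tm n} →
                  (∀ {s u b} → Realizer θ s u → P s b → Realize b N u) →
                  ∀ {s u bs} → Realizer θ s u → Many P s bs → Realizes bs N u
  many-realizes f φ ([] e) = realizer-∅ φ e
  many-realizes f φ ((e , x) ∷ xs) with realizer-split φ e
  ... | u₁ , u₂ , eq , φ₁ , φ₂ , _ = u₁ , u₂ , eq , f φ₁ x , many-realizes f φ₂ xs

  while-realizes : {θ : Fin m → Tm n} {G B E : Env m → Set} {M N : Tm n} →
                   (∀ {s u} → Realizer θ s u → G s → Realize₀ (nm 0) M u) →
                   (∀ {s u} → Realizer θ s u → B s → Realize₀ ⋆ N u) →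
                   (∀ {s u} → Realizer θ s u → E s → ∃ λ x → x ≢ 0 × Realize₀ (nm x) M u) →
                   ∀ {s u} → Realizer θ s u → Iterate G B E s → Realize₀ ⋆ (while M N) u
  while-realizes f g h φ (exit x) p with h φ x
  ... | y , y≢0 , r = while-≢0 (r p) y≢0
  while-realizes f g h φ (iter e x y l) p with realizer-split φ e
  ... | _ , _ , eq , φ₁ , φ′ , _ with realizer-split φ′ (λ _ → refl)
  ... | _ , _ , eq′ , φ₂ , φ₃ , _ with ⟶-split eq p
  ... | _ , p₁ , p′ with ⟶-split eq′ p′
  ... | _ , p₂ , p₃ =
    while-0 (f φ₁ x p₁) (g φ₂ y p₂) (while-realizes f g h φ₃ l p₃)

  bool-split : {s t : Env n} (q : Fin n → Bool) → (∀ i → q i ≡ false → s i ≡ []) →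
               (∀ i → q i ≡ true → t i ≡ []) → ∀ i → s i ≡ [] ⊎ t i ≡ []
  bool-split q f g i with q i in eq
  ... | true  = inj₂ (g i eq)
  ... | false = inj₁ (f i eq)

  -- The basic lemma of the logical relation, stated for simultaneous substitutions so that binders
  -- can be crossed. The typing serves affinity: its split at an application yields the apartness
  -- that function traces ask for.
  fundamental : {Γ : Vec Ty m} {P : Fin m → Set} → ∀ {M B} → Typed Γ P M B →
                (θ : Fin m → Tm n) → ∀ {s u b} → Realizer θ s u → ⟪ M ⟫ s b →
                Realize b (substitute θ M) u
  fundamental (var {i} _ _) θ {b = b} (realizer {U} sh r) (e , f)
    with subst (λ as → Realizes as (θ i) (U i)) e (r i)
  ... | t₁ , t₂ , eq , x , t₂≗ = Realize-resp b
    (λ j → sym (trans (u≗ (sh j)) (trans (eq j) (trans (cong (t₁ j ++_) (t₂≗ j)) (++-identityʳ _))))) x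
    where
    others : ∀ i′ → i′ ≢ i → U i′ ≗ ∅
    others i′ h = subst (λ as → Realizes as (θ i′) (U i′)) (f i′ h) (r i′)
    u≗ : ∀ {x j} → (x ≡ [] × (∀ i → U i j ≡ [])) ⊎
                 (∃ λ i → x ≡ U i j × (∀ i′ → i′ ≢ i → U i′ j ≡ [])) → x ≡ U i j
    u≗ (inj₁ (e , f)) = trans e (sym (f i))
    u≗ {j = j} (inj₂ (o , e , f)) with i ≟ᶠ o
    ... | yes refl = e
    ... | no i≢o   = trans e (trans (others o (i≢o ∘ sym) j) (sym (f i i≢o)))
  -- The application β-expands the substituted body. The renaming, `exts θ` and the substitution of
  -- `N` fuse into one substitution fit for the induction hypothesis.
  fundamental (lam {A = A} {M = M} d) θ φ (as , b , refl , _ , x) ρ inj N t ap rs =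
    Realize-⊑ b (⊑-β A (rename (ext ρ) (substitute (exts θ) M)) N)
      (subst (λ M → Realize b M _)
        (sym (trans (substitute-rename (λ _ → refl) (substitute (exts θ) M))
                    (substitute-substitute (λ _ → refl) M)))
        (fundamental d _ (realizer-lam φ ρ inj ap rs _ refl
          λ i → trans (substitute-rename (λ _ → refl) (θ i)) (substitute-vars (λ _ → refl) (θ i))) x))
  fundamental (app {B = B} q d e) θ {b = b} φ (as , s , t , eq , x , xs) with realizer-split φ eq
  ... | u₁ , u₂ , eq′ , φ₁ , φ₂ , ap = Realize-resp b (≗-sym eq′)
    (Realize-· as b (fundamental d θ φ₁ x)
      (ap (bool-split q
        (λ i h → unused-empty (λ (_ , h′) → case trans (sym h) h′ of λ ()) d x)
        (λ i h → Many-empty (unused-empty (λ (_ , h′) → case trans (sym h) h′ of λ ()) e) xs)))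
      (many-realizes (fundamental e θ) φ₂ xs))
  fundamental num θ φ (e , refl) p with ⟶-∅ (realizer-∅ φ e) p
  ... | refl = value num
  fundamental skip θ φ (e , refl) p with ⟶-∅ (realizer-∅ φ e) p
  ... | refl = value skip
  fundamental (op d e) θ φ (x , y , refl , s , t , eq , a , b) p with realizer-split φ eq
  ... | _ , _ , eq′ , φ₁ , φ₂ , _ with ⟶-split eq′ p
  ... | _ , p₁ , p₂ = op (fundamental d θ φ₁ a p₁) (fundamental e θ φ₂ b p₂)
  fundamental (seq {M = M} {N} _ d e) θ {b = b} φ (base , s , t , eq , x , y)
    with realizer-split φ eq
  ... | _ , _ , eq′ , φ₁ , φ₂ , _ = from₀ base λ p →
    let _ , p₁ , p₂ = ⟶-split eq′ p in
    Observe-mono base {M = substitute θ N} {M′ = substitute θ (M ⨾ N)}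
      (seq (fundamental d θ φ₁ x p₁)) (to₀ base (fundamental e θ φ₂ y) p₂)
  fundamental (assign d e) θ φ (x , refl , s , t , eq , a , b) p with realizer-split φ eq
  ... | _ , _ , eq′ , φ₁ , φ₂ , _ with ⟶-split eq′ p
  ... | _ , p₁ , p₂ with fundamental d θ φ₂ b p₂
  ... | assign (value num) r         = assign (fundamental e θ φ₁ a p₁) r
  ... | assign-mkvar (value num) r r′ = assign-mkvar (fundamental e θ φ₁ a p₁) r r′
  fundamental (deref d) θ φ (x , refl , a) p = fundamental d θ φ a p
  fundamental (while {M = M} {N} d e) θ φ (refl , l) =
    while-realizes {M = substitute θ M} {N = substitute θ N}
      (λ φ x p → fundamental d θ φ x p) (λ φ x p → fundamental e θ φ x p)
      (λ φ (y , y≢0 , x) → y , y≢0 , λ p → fundamental d θ φ x p) φ l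
  fundamental (ifzero {M = M} {N₁} {N₂} _ d e f) θ {b = b} φ (base , inj₁ (s , t , eq , x , y))
    with realizer-split φ eq
  ... | _ , _ , eq′ , φ₁ , φ₂ , _ = from₀ base λ p →
    let _ , p₁ , p₂ = ⟶-split eq′ p in
    Observe-mono base {M = substitute θ N₁} {M′ = substitute θ (ifzero M N₁ N₂)}
      (ifzero-0 (fundamental d θ φ₁ x p₁)) (to₀ base (fundamental e θ φ₂ y) p₂)
  fundamental (ifzero {M = M} {N₁} {N₂} _ d e f) θ {b = b} φ
              (base , inj₂ (s , t , eq , (_ , x≢0 , x) , y))
    with realizer-split φ eq
  ... | _ , _ , eq′ , φ₁ , φ₂ , _ = from₀ base λ p →
    let _ , p₁ , p₂ = ⟶-split eq′ p in
    Observe-mono base {M = substitute θ N₂} {M′ = substitute θ (ifzero M N₁ N₂)}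
      (ifzero-≢0 (fundamental d θ φ₁ x p₁) x≢0) (to₀ base (fundamental f θ φ₂ y) p₂)
  -- The path `c` contained in the trace is the history of the fresh cell, from `0` to the discarded
  -- final contents `y`.
  fundamental (new _ d) θ φ (nm , t , y , c , x) {σ} {σ′} p =
    new (fundamental d (exts θ) (realizer-new φ (cell-realizes c)) x {0 ∷ σ} {y ∷ σ′}
      (paths λ { zero → c ; (suc i) → at p i }))
  fundamental (new _ d) θ φ (⋆ , t , y , c , x) {σ} {σ′} p =
    new (fundamental d (exts θ) (realizer-new φ (cell-realizes c)) x {0 ∷ σ} {y ∷ σ′}
      (paths λ { zero → c ; (suc i) → at p i }))
  fundamental random θ φ (e , x , refl) p with ⟶-∅ (realizer-∅ φ e) p
  ... | refl = random x
  -- A numeral answers the `k` requests of the write procedure without touching the store, which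
  -- makes apartness trivial.
  fundamental (mkvar d e) θ {u = u} φ (inj₁ (x , k , refl , a)) p =
    assign-mkvar (value num) (value mkvar)
      (Realize-· (replicate k (nm x)) ⋆ {u = u} (fundamental d θ φ a) (λ _ → inj₂ refl)
        (numeral-realizes k x) (⟶-resp (λ i → sym (++-identityʳ (u i))) p))
  fundamental (mkvar d e) θ φ (inj₂ (x , refl , a)) p =
    deref-mkvar (value mkvar) (fundamental e θ φ a p)

  -- Definability

  ⊢# : (Γ : Vec Ty n) → ∀ x → Γ ⊢ # x ∶ nat
  ⊢# []      x = num x
  ⊢# (A ∷ Γ) x = weak (⊢# Γ x)

  ⊢skip : (Γ : Vec Ty n) → Γ ⊢ skip ∶ comm
  ⊢skip []      = skip
  ⊢skip (A ∷ Γ) = weak (⊢skip Γ)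

  swap↭ : ∀ {A B} {Γ : Vec Ty n} → lookup (A ∷ B ∷ Γ) ↭ lookup (B ∷ A ∷ Γ)
  swap↭ = Perm.swap Perm.id , λ { zero → refl ; (suc zero) → refl ; (suc (suc i)) → refl }

  ⊢zero : ∀ {A} (Γ : Vec Ty n) → A ∷ Γ ⊢ ` zero ∶ A
  ⊢zero []      = ax
  ⊢zero (B ∷ Γ) = exch swap↭ (weak (⊢zero Γ))

  infixl 8 _⊙_

  -- Spelled with the renamings that the rule `app` inserts, for the empty context on the left, so
  -- that `app` types it directly.
  _⊙_ : Tm 0 → Tm n → Tm n
  F ⊙ N = rename (_↑ˡ _) F · rename (0 ↑ʳ_) N

  ⊢⊙ : {Γ : Vec Ty n} → ∀ {A B F N} → [] ⊢ F ∶ A ⊸ B → Γ ⊢ N ∶ A → Γ ⊢ F ⊙ N ∶ B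
  ⊢⊙ = app

  infix 1 _↔_

  _↔_ : Set → Set → Set
  X ↔ Y = (X → Y) × (Y → X)

  Many-singleton : (N : Tm n) → ∀ {u a} → Many ⟪ N ⟫ u [ a ] ↔ ⟪ N ⟫ u a
  Many-singleton N =
    (λ { ((e , x) ∷ [] e′) → resp N (λ i → sym (trans (e i) (trans (cong (_ ++_) (e′ i)) (++-identityʳ _)))) x }) ,
    λ x → ((λ i → sym (++-identityʳ _)) , x) ∷ [] λ _ → refl

  ⊙-traces : (F : Tm 0) (N : Tm n) → ∀ {u b} →
             ⟪ F ⊙ N ⟫ u b ↔ ∃ λ as → (∀ s → ⟪ F ⟫ s (as ⇒ b)) × Many ⟪ N ⟫ u as
  ⊙-traces {n} F N {u} {b} rewrite rename-id {ρ = 0 ↑ʳ_} (λ _ → refl) N = to , from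
    where
    to : ⟪ rename (_↑ˡ n) F · N ⟫ u b → _
    to (as , v , w , e , x , xs) with unrename (_↑ˡ n) (λ {i} → ⊥-elim (¬Fin0 i)) F x
      where
      ¬Fin0 : Fin 0 → ⊥
      ¬Fin0 ()
    ... | x′ , h = as , (λ s → resp F (λ ()) x′) ,
      Many-resp N (λ i → sym (trans (e i) (cong (_++ w i) (h i λ ())))) xs
    from : _ → ⟪ rename (_↑ˡ n) F · N ⟫ u b
    from (as , x , xs) = as , ∅ , u , (λ _ → refl) ,
      rename-along (_↑ˡ n) (λ { {()} }) F ((λ ()) , λ _ _ → refl) (x λ ()) , xs

  Ω : Tm n
  Ω = while (# 0) skip

  ⊢Ω : (Γ : Vec Ty n) → Γ ⊢ Ω ∶ comm
  ⊢Ω Γ = while (⊢# Γ 0) (⊢skip Γ)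

  Ω-traces : ∀ {s : Env n} {b} → ¬ ⟪ Ω ⟫ s b
  Ω-traces (_ , l) = diverges l
    where
    diverges : ∀ {s} → ¬ Iterate (λ s → ⟪ # 0 ⟫ s (nm 0)) (λ t → ⟪ skip ⟫ t ⋆)
                                 (λ s → ∃ λ x → x ≢ 0 × ⟪ # 0 ⟫ s (nm x)) s
    diverges (exit (_ , x≢0 , _ , refl)) = x≢0 refl
    diverges (iter _ _ _ l)              = diverges l

  stuck : ∀ {B} → Base B → Tm n
  stuck nat  = Ω ⨾ # 0
  stuck comm = Ω
  stuck var  = mkvar (ƛ nat Ω) (Ω ⨾ # 0)

  ⊢stuck : (Γ : Vec Ty n) → ∀ {B} (base : Base B) → Γ ⊢ stuck base ∶ B
  ⊢stuck Γ nat  = seq nat (⊢Ω Γ) (⊢# Γ 0)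
  ⊢stuck Γ comm = ⊢Ω Γ
  ⊢stuck Γ var  = mkvar (lam (⊢Ω _)) (⊢stuck Γ nat)

  stuck-traces : ∀ {B} (base : Base B) {s : Env n} {b} → ¬ ⟪ stuck base ⟫ s b
  stuck-traces nat  (_ , _ , _ , _ , x , _) = Ω-traces x
  stuck-traces comm x = Ω-traces x
  stuck-traces var  (inj₁ (_ , _ , _ , _ , _ , _ , _ , x)) = Ω-traces x
  stuck-traces {n} var (inj₂ (_ , _ , x)) = stuck-traces {n} nat x

  choice : ∀ {B} → Base B → (Fin k → Tm n) → Tm n
  choice {zero}  base M = stuck base
  choice {suc k} base M = ifzero random (M zero) (choice base (M ∘ suc))

  ⊢choice : {Γ : Vec Ty n} → ∀ {B} (base : Base B) {M : Fin k → Tm n} →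
            (∀ i → Γ ⊢ M i ∶ B) → Γ ⊢ choice base M ∶ B
  ⊢choice {k = zero}  base d = ⊢stuck _ base
  ⊢choice {k = suc k} base d = ifzero base random (d zero) (⊢choice base (d ∘ suc))

  choice-traces : ∀ {B} (base : Base B) (M : Fin k → Tm n) → ∀ {s b} →
                  ⟪ choice base M ⟫ s b → ∃ λ i → ⟪ M i ⟫ s b
  choice-traces {zero}  base M x = ⊥-elim (stuck-traces base x)
  choice-traces {suc k} base M (_ , inj₁ (s , t , e , (h , _) , x)) =
    zero , resp (M zero) (λ i → sym (trans (e i) (cong (_++ t i) (h i)))) x
  choice-traces {suc k} base M (_ , inj₂ (s , t , e , (_ , _ , h , _) , x)) =
    let i , y = choice-traces base (M ∘ suc) x in
    suc i , resp (M (suc i)) (λ j → sym (trans (e j) (cong (_++ t j) (h j)))) y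

  traces-choice : ∀ {B} (base : Base B) (M : Fin k → Tm n) → ∀ {s b} →
                  BaseTrace b → ∀ i → ⟪ M i ⟫ s b → ⟪ choice base M ⟫ s b
  traces-choice base M h zero x =
    h , inj₁ (∅ , _ , (λ _ → refl) , ((λ _ → refl) , 0 , refl) , x)
  traces-choice base M h (suc i) x =
    -- The outcome `1` of `random` stands for any nonzero one.
    h , inj₂ (∅ , _ , (λ _ → refl) , (1 , (λ ()) , (λ _ → refl) , 1 , refl) ,
              traces-choice base (M ∘ suc) h i x)

  -- Under call by name each occurrence of the argument would count as a use, so it is stored in a
  -- cell and used exactly once. Equality with `n` is the vanishing of both truncated differences,
  -- expressed by the two operations sure to be available.
  natTest : ℕ → Tm 0
  natTest n = ƛ nat (new ((` zero ≔ ` suc zero) ⨾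
    ifzero (op add (op sub (! ` zero) (# n)) (op sub (# n) (! ` zero))) skip Ω))

  ⊢natTest : ∀ n → [] ⊢ natTest n ∶ nat ⊸ comm
  ⊢natTest n = lam (new comm (seq comm (assign (⊢zero _) (weak ax))
    (ifzero comm (op add (op sub (deref (⊢zero _)) (⊢# _ n)) (op sub (⊢# _ n) (deref (⊢zero _))))
      (⊢skip _) (⊢Ω _))))

  distance-0 : ∀ x n → apply add (apply sub x n) (apply sub n x) ≡ 0 → x ≡ n
  distance-0 x n e rewrite apply-sub x n | apply-sub n x | apply-add (x ∸ n) (n ∸ x) =
    ≤-antisym (m∸n≡0⇒m≤n (m+n≡0⇒m≡0 (x ∸ n) e)) (m∸n≡0⇒m≤n (m+n≡0⇒n≡0 (x ∸ n) e))

  0-distance : ∀ n → apply add (apply sub n n) (apply sub n n) ≡ 0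
  0-distance n rewrite apply-sub n n | n∸n≡0 n = apply-add 0 0

  Single-cong : ∀ {i : Fin n} {a s} j {t} → Single i a s → single i a j ≡ t → s j ≡ t
  Single-cong j x e = trans (Single-unique x j) e

  ++-≡ : {s s₁ s₂ t₁ t₂ : List Tr} → s ≡ s₁ ++ s₂ → s₁ ≡ t₁ → s₂ ≡ t₂ → s ≡ t₁ ++ t₂
  ++-≡ e refl refl = e

  nm-injective : ∀ {x y} → nm x ≡ nm y → x ≡ y
  nm-injective refl = refl

  natTest-traces : ∀ n {s c} → ⟪ natTest n ⟫ s c ↔ c ≡ [ nm n ] ⇒ ⋆
  natTest-traces n {s} {c} = to , from
    where
    to : ⟪ natTest n ⟫ s c → c ≡ [ nm n ] ⇒ ⋆
    to (as , b , refl , _ , _ , t , y , path , _ , u , v , e ,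
        (x , _ , u₁ , u₂ , e′ , sx , sw) , _ , inj₂ (_ , _ , _ , _ , z)) = ⊥-elim (Ω-traces z)
    to (as , b , refl , _ , _ , t , y , path , _ , u , v , e ,
        (x , _ , u₁ , u₂ , e′ , sx , sw) , _ ,
        inj₁ (v₁ , v₂ , e₁ ,
          (p , q , eq , w₁ , w₂ , e₂ ,
           (p₁ , _ , refl , r₁ , r₂ , e₃ , (_ , refl , sr₁) , (h₁ , refl)) ,
           (_ , q₂ , refl , r₃ , r₄ , e₄ , (h₂ , refl) , (_ , refl , sr₂))) ,
          (h₃ , refl))) = result t≡ path
      where
      v≡ : v zero ≡ acc (read p₁) ∷ acc (read q₂) ∷ []
      v≡ = ++-≡ {t₂ = []} (e₁ zero)
        (++-≡ (e₂ zero) (++-≡ (e₃ zero) (Single-cong zero sr₁ refl) (h₁ zero))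
                        (++-≡ (e₄ zero) (h₂ zero) (Single-cong zero sr₂ refl)))
        (h₃ zero)
      t≡ : t ≡ acc (write x) ∷ acc (read p₁) ∷ acc (read q₂) ∷ []
      t≡ = ++-≡ (e zero)
        (++-≡ (e′ zero) (Single-cong zero sx refl) (Single-cong zero sw refl)) v≡
      v1≡ : v (suc zero) ≡ []
      v1≡ = ++-≡ {t₂ = []} (e₁ (suc zero))
        (++-≡ (e₂ (suc zero))
          (++-≡ (e₃ (suc zero)) (Single-cong (suc zero) sr₁ refl) (h₁ (suc zero)))
          (++-≡ (e₄ (suc zero)) (h₂ (suc zero)) (Single-cong (suc zero) sr₂ refl)))
        (h₃ (suc zero))
      as≡ : as ≡ [ nm x ]
      as≡ = ++-≡ (e (suc zero))
        (++-≡ (e′ (suc zero)) (Single-cong (suc zero) sx refl) (Single-cong (suc zero) sw refl)) v1≡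
      result : t ≡ acc (write x) ∷ acc (read p₁) ∷ acc (read q₂) ∷ [] → Path 0 t y →
               as ⇒ ⋆ ≡ [ nm n ] ⇒ ⋆
      -- The path forces both reads to return the value written, so the guard compares `x` with `n`.
      result refl (write∷ (read∷ (read∷ []))) =
        cong (_⇒ ⋆) (trans as≡ (cong (λ x → [ nm x ]) (distance-0 x n (sym (nm-injective eq)))))
    from : c ≡ [ nm n ] ⇒ ⋆ → ⟪ natTest n ⟫ s c
    from refl = [ nm n ] , ⋆ , refl , nm ∷ [] , ⋆ ,
      acc (write n) ∷ acc (read n) ∷ acc (read n) ∷ [] , n , write∷ (read∷ (read∷ [])) ,
      ⋆ , [ acc (write n) ] ▹ ([ nm n ] ▹ ∅) , (acc (read n) ∷ acc (read n) ∷ []) ▹ ∅ ,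
      at₂ refl refl ,
      (n , refl , [] ▹ ([ nm n ] ▹ ∅) , [ acc (write n) ] ▹ ∅ , at₂ refl refl ,
       suc-Single zero-Single , zero-Single) ,
      ⋆ , inj₁ (_ , ∅ , (λ i → sym (++-identityʳ _)) ,
        (apply sub n n , apply sub n n , cong nm (sym (0-distance n)) ,
         [ acc (read n) ] ▹ ∅ , [ acc (read n) ] ▹ ∅ , at₂ refl refl ,
         (n , n , refl , _ , ∅ , (λ i → sym (++-identityʳ _)) ,
          (n , refl , zero-Single) , ((λ _ → refl) , refl)) ,
         (n , n , refl , ∅ , _ , (λ _ → refl) , ((λ _ → refl) , refl) , (n , refl , zero-Single))) ,
        ((λ _ → refl) , refl))
      where
      at₂ : {u v : Env (suc 1)} → u zero ≡ v zero → u (suc zero) ≡ v (suc zero) → u ≗ v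
      at₂ h h′ zero = h
      at₂ h h′ (suc zero) = h′

  -- Each test accepts exactly one use of the bound argument, so the sequence of tests prescribes
  -- its whole history.
  uses : {X : Set} → (X → Tm 0) → List X → Tm (suc n)
  uses F []       = skip
  uses F (a ∷ as) = (F a ⊙ ` zero) ⨾ uses F as

  -- A variable admitting a single kind of access, at the cost `P`: the other kind diverges, and a
  -- write is accepted only if the value written passes the test for `x`.
  access : Tm n → Access → Tm n
  access P (read x)  = mkvar (ƛ nat Ω) (P ⨾ # x)
  access P (write x) = mkvar (ƛ nat (rename suc P ⨾ (natTest x ⊙ ` zero))) (Ω ⨾ # 0)

  -- Passes only if the cell holds `i`, which keeps the choice among elements from departing from
  -- the order of the list.
  tick : ℕ → Tm 1
  tick i = (natTest i ⊙ (! ` zero)) ⨾ (` zero ≔ # suc i)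

  -- guarded A P a produces the trace a i at the cost of running P i, and
  -- test A a accepts exactly one use of its argument, with trace a.
  guarded : ∀ A → (Fin k → Tm n) → (Fin k → α A) → Tm n
  test    : ∀ A → α A → Tm 0

  -- The elements of as, in this order, a cell counting how many have been supplied.
  supply : ∀ A → List (α A) → Tm 1
  supply A as = guarded A (λ i → tick (toℕ i)) (List.lookup as)

  guarded nat     P a = choice nat (λ i → P i ⨾ # a i)
  guarded comm    P a = choice comm (λ i → P i ⨾ skip)
  guarded var     P a = choice var (λ i → access (P i) (a i))
  -- The old cost, followed by tests that consume the argument part of `a i`, is the new cost at
  -- `B`; in this way the choice of `i` sinks to the base result type.
  guarded (A ⊸ B) P a =
    ƛ A (guarded B (λ i → rename suc (P i) ⨾ uses (test A) (proj₁ (a i))) (proj₂ ∘ a))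

  test nat     x         = natTest x
  test comm    _         = ƛ comm (` zero)
  test var     (read x)  = ƛ var (natTest x ⊙ (! ` zero))
  test var     (write x) = ƛ var (` zero ≔ # x)
  -- `new` puts the cell in front of the tested function, whereas `app` lists the function's
  -- identifier first; the swap is the renaming inserted by `exch`.
  test (A ⊸ B) (as , b)  = ƛ (A ⊸ B) (new
    (rename (Perm.swap {0} {0} Perm.id ⟨$⟩ʳ_)
            (test B b ⊙ (rename {1} (_↑ˡ 1) (` zero) · rename (1 ↑ʳ_) (supply A as))) ⨾
     (natTest (length as) ⊙ (! ` zero))))

  ⊢uses : {X : Set} {Γ : Vec Ty n} → ∀ {A} (F : X → Tm 0) → (∀ a → [] ⊢ F a ∶ A ⊸ comm) →
          ∀ as → A ∷ Γ ⊢ uses F as ∶ comm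
  ⊢uses F d []       = ⊢skip _
  ⊢uses F d (a ∷ as) = seq comm (⊢⊙ (d a) (⊢zero _)) (⊢uses F d as)

  ⊢access : {Γ : Vec Ty n} → ∀ {P} a → Γ ⊢ P ∶ comm → Γ ⊢ access P a ∶ var
  ⊢access (read x)  d = mkvar (lam (⊢Ω _)) (seq nat d (⊢# _ x))
  ⊢access (write x) d =
    mkvar (lam (seq comm (weak d) (⊢⊙ (⊢natTest x) (⊢zero _)))) (seq nat (⊢Ω _) (⊢# _ 0))

  ⊢tick : ∀ i → var ∷ [] ⊢ tick i ∶ comm
  ⊢tick i = seq comm (⊢⊙ (⊢natTest i) (deref ax)) (assign ax (⊢# _ (suc i)))

  ⊢guarded : ∀ A {Γ : Vec Ty n} {P : Fin k → Tm n} (a : Fin k → α A) →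
             (∀ i → Γ ⊢ P i ∶ comm) → Γ ⊢ guarded A P a ∶ A
  ⊢test    : ∀ A a → [] ⊢ test A a ∶ A ⊸ comm

  ⊢guarded nat     a d = ⊢choice nat (λ i → seq nat (d i) (⊢# _ (a i)))
  ⊢guarded comm    a d = ⊢choice comm (λ i → seq comm (d i) (⊢skip _))
  ⊢guarded var     a d = ⊢choice var (λ i → ⊢access (a i) (d i))
  ⊢guarded (A ⊸ B) a d =
    lam (⊢guarded B (proj₂ ∘ a) λ i → seq comm (weak (d i)) (⊢uses (test A) (⊢test A) (proj₁ (a i))))

  ⊢test nat     x         = ⊢natTest x
  ⊢test comm    _         = lam ax
  ⊢test var     (read x)  = lam (⊢⊙ (⊢natTest x) (deref ax))
  ⊢test var     (write x) = lam (assign ax (⊢# _ x))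
  ⊢test (A ⊸ B) (as , b)  = lam (new comm (seq comm
    (exch swap↭ (⊢⊙ (⊢test B b) (app ax (⊢guarded A (List.lookup as) (λ i → ⊢tick (toℕ i))))))
    (⊢⊙ (⊢natTest (length as)) (deref (⊢zero _)))))

  -- Traces of the tests and supplies

  Tests : Tm 0 → Tr → Set
  Tests F a = ∀ {s c} → ⟪ F ⟫ s c ↔ c ≡ [ a ] ⇒ ⋆

  ⊙-tests : ∀ F {a} → Tests F a → (N : Tm n) → ∀ {u b} →
            ⟪ F ⊙ N ⟫ u b ↔ (b ≡ ⋆ × ⟪ N ⟫ u a)
  ⊙-tests F {a} h N {u} {b} = to , from
    where
    to : ⟪ F ⊙ N ⟫ u b → b ≡ ⋆ × ⟪ N ⟫ u a
    to x with proj₁ (⊙-traces F N) x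
    ... | as , y , z with proj₁ h (y ∅)
    ... | refl = refl , proj₁ (Many-singleton N) z
    from : b ≡ ⋆ × ⟪ N ⟫ u a → ⟪ F ⊙ N ⟫ u b
    from (refl , x) =
      proj₂ (⊙-traces F N) ([ a ] , (λ s → proj₂ h refl) , proj₂ (Many-singleton N) x)

  uses-traces : {X : Set} (F : X → Tm 0) (f : X → Tr) → (∀ a → Tests (F a) (f a)) →
                ∀ as {u : Env (suc n)} →
                ⟪ uses F as ⟫ u ⋆ ↔ u ≗ (map f as ▹ ∅)
  uses-traces F f h [] = (λ (e , _) → λ { zero → e zero ; (suc i) → e (suc i) }) ,
                         λ e → (λ { zero → e zero ; (suc i) → e (suc i) }) , refl
  uses-traces {n} F f h (a ∷ as) {u} = to , from
    where
    to : ⟪ uses F (a ∷ as) ⟫ u ⋆ → u ≗ ((f a ∷ map f as) ▹ ∅)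
    to (_ , s , t , e , x , y)
      with proj₂ (proj₁ (⊙-tests (F a) (h a) (` zero)) x) | proj₁ (uses-traces F f h as) y
    ... | p , q | e′ = λ
      { zero    → trans (e zero) (cong₂ _++_ p (e′ zero))
      ; (suc i) → trans (e (suc i)) (cong₂ _++_ (q (suc i) λ ()) (e′ (suc i))) }
    from : u ≗ ((f a ∷ map f as) ▹ ∅) → ⟪ uses F (a ∷ as) ⟫ u ⋆
    from e = ⋆ , [ f a ] ▹ ∅ , map f as ▹ ∅ ,
      (λ { zero → e zero ; (suc i) → e (suc i) }) ,
      proj₂ (⊙-tests (F a) (h a) (` zero)) (refl , zero-Single) ,
      proj₂ (uses-traces F f h as) (λ _ → refl)

  tick-traces : ∀ i {u} → ⟪ tick i ⟫ u ⋆ ↔ u zero ≡ acc (read i) ∷ acc (write (suc i)) ∷ []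
  tick-traces i {u} = to , from
    where
    to : ⟪ tick i ⟫ u ⋆ → u zero ≡ acc (read i) ∷ acc (write (suc i)) ∷ []
    to (_ , s , t , e , x , _ , _ , v , w , e′ , (h , refl) , y)
      with proj₁ (⊙-tests (natTest i) (natTest-traces i) (! ` zero)) x
    ... | _ , _ , refl , z = ++-≡ (e zero) (Single-cong zero z refl)
      (++-≡ {t₁ = []} (e′ zero) (h zero) (Single-cong zero y refl))
    from : u zero ≡ acc (read i) ∷ acc (write (suc i)) ∷ [] → ⟪ tick i ⟫ u ⋆
    from e = ⋆ , [ acc (read i) ] ▹ ∅ , [ acc (write (suc i)) ] ▹ ∅ , (λ { zero → e }) ,
      proj₂ (⊙-tests (natTest i) (natTest-traces i) (! ` zero)) (refl , i , refl , zero-Single) ,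
      suc i , refl , ∅ , _ , (λ _ → refl) , ((λ _ → refl) , refl) , zero-Single

  replicate-singleton : ∀ k {a b : Tr} → replicate k a ≡ [ b ] → a ≡ b
  replicate-singleton (suc zero) refl = refl

  access-traces : (P : Tm n) → ∀ a {s c} → ⟪ access P a ⟫ s c ↔ (c ≡ acc a × ⟪ P ⟫ s ⋆)
  access-traces P (read x) = to , from
    where
    to : ∀ {s c} → ⟪ access P (read x) ⟫ s c → c ≡ acc (read x) × ⟪ P ⟫ s ⋆
    to (inj₁ (_ , _ , _ , _ , _ , _ , _ , y)) = ⊥-elim (Ω-traces y)
    to (inj₂ (_ , refl , _ , s , t , e , y , h , refl)) =
      refl , resp P (λ i → sym (trans (e i) (trans (cong (s i ++_) (h i)) (++-identityʳ _)))) y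
    from : ∀ {s c} → c ≡ acc (read x) × ⟪ P ⟫ s ⋆ → ⟪ access P (read x) ⟫ s c
    from (refl , y) =
      inj₂ (x , refl , nm , _ , ∅ , (λ i → sym (++-identityʳ _)) , y , (λ _ → refl) , refl)
  access-traces P (write x) = to , from
    where
    to : ∀ {s c} → ⟪ access P (write x) ⟫ s c → c ≡ acc (write x) × ⟪ P ⟫ s ⋆
    to (inj₂ (_ , _ , _ , _ , _ , _ , y , _)) = ⊥-elim (Ω-traces y)
    to {s} (inj₁ (x′ , k , refl , _ , _ , refl , _ , _ , u , v , e , y , z))
      with unrename-suc P y | proj₁ (⊙-tests (natTest x) (natTest-traces x) (` zero)) z
    ... | y′ , u0 | _ , z′ =
      cong (λ y → acc (write y)) (nm-injective (replicate-singleton k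
        (++-≡ {t₁ = []} (e zero) u0 (Single-cong zero z′ refl)))) ,
      resp P (λ i → sym (trans (e (suc i))
        (trans (cong (u (suc i) ++_) (proj₂ z′ (suc i) λ ())) (++-identityʳ _)))) y′
    from : ∀ {s c} → c ≡ acc (write x) × ⟪ P ⟫ s ⋆ → ⟪ access P (write x) ⟫ s c
    from {s} (refl , y) = inj₁ (x , 1 , refl , [ nm x ] , ⋆ , refl , nm ∷ [] , ⋆ ,
      [] ▹ s , [ nm x ] ▹ ∅ , (λ { zero → refl ; (suc i) → sym (++-identityʳ _) }) ,
      rename-suc P y , proj₂ (⊙-tests (natTest x) (natTest-traces x) (` zero)) (refl , zero-Single))

  Ticked : {X : Set} → (X → Tr) → List X → Tm 1 → Set
  Ticked f as S = ∀ {u c} → ⟪ S ⟫ u c ↔ ∃ λ i → c ≡ f (List.lookup as i) ×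
                  u zero ≡ acc (read (toℕ i)) ∷ acc (write (suc (toℕ i))) ∷ []

  drop-lookup : {X : Set} (as : List X) (i : Fin (length as)) →
                drop (toℕ i) as ≡ List.lookup as i ∷ drop (suc (toℕ i)) as
  drop-lookup (a ∷ as) zero    = refl
  drop-lookup (a ∷ as) (suc i) = drop-lookup as i

  drop-length : {X : Set} (as : List X) → drop (length as) as ≡ []
  drop-length []       = refl
  drop-length (a ∷ as) = drop-length as

  -- A cell holding `m` admits only the tick of the element at index `m`, so the order is forced.
  -- The concluding read of `length as` excludes stopping early.
  ticked-supplies : {X : Set} (f : X → Tr) (as : List X) (S : Tm 1) → Ticked f as S →
                    ∀ {u bs m y} → Many ⟪ S ⟫ u bs →
                    Path m (u zero ++ [ acc (read (length as)) ]) y → bs ≡ map f (drop m as)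
  ticked-supplies f as S h ([] e) p rewrite e zero with p
  ... | read∷ [] = sym (cong (map f) (drop-length as))
  ticked-supplies f as S h (_∷_ {p₂ = t} (e , x) xs) p with proj₁ h x
  ... | i , refl , e′ rewrite e zero | e′ with p
  ... | read∷ (write∷ p′) =
    trans (cong (_ ∷_) (ticked-supplies f as S h xs p′)) (sym (cong (map f) (drop-lookup as i)))

  -- The offset `m` keeps cell contents absolute while the induction strips elements off the list.
  supplies-ticked : {X : Set} (f : X → Tr) (S : Tm 1) (as : List X) (m : ℕ) →
    (∀ (i : Fin (length as)) →
       ⟪ S ⟫ ((acc (read (m + toℕ i)) ∷ acc (write (suc (m + toℕ i))) ∷ []) ▹ ∅) (f (List.lookup as i))) →
    ∃ λ t → Path m t (m + length as) × Many ⟪ S ⟫ (t ▹ ∅) (map f as)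
  supplies-ticked f S [] m h rewrite +-identityʳ m = [] , [] , [] λ { zero → refl }
  supplies-ticked f S (a ∷ as) m h
    with supplies-ticked f S as (suc m) (λ i →
           subst (λ j → ⟪ S ⟫ ((acc (read j) ∷ acc (write (suc j)) ∷ []) ▹ ∅) (f (List.lookup as i)))
                 (+-suc m (toℕ i)) (h (suc i)))
  ... | t , p , xs rewrite +-suc m (length as) =
    acc (read m) ∷ acc (write (suc m)) ∷ t , read∷ (write∷ p) ,
    ((λ { zero → refl }) ,
     subst (λ j → ⟪ S ⟫ ((acc (read j) ∷ acc (write (suc j)) ∷ []) ▹ ∅) _)
           (+-identityʳ m) (h zero)) ∷ xs

  -- Simultaneous induction on types with opposite roles at `A ⊸ B`: producing an element tests at
  -- `A` and produces at `B`, testing one supplies at `A` and tests at `B`.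
  guarded-traces : ∀ A (P : Fin k → Tm n) (a : Fin k → α A) → ∀ {s c} →
                   ⟪ guarded A P a ⟫ s c ↔ ∃ λ i → c ≡ enc A (a i) × ⟪ P i ⟫ s ⋆
  test-traces    : ∀ A a → Tests (test A a) (enc A a)

  guarded-traces nat P a = to , from
    where
    to : ∀ {s c} → ⟪ guarded nat P a ⟫ s c → ∃ λ i → c ≡ nm (a i) × ⟪ P i ⟫ s ⋆
    to x with choice-traces nat (λ i → P i ⨾ # a i) x
    ... | i , _ , s , t , e , y , h , refl =
      i , refl , resp (P i) (λ j → sym (trans (e j) (trans (cong (s j ++_) (h j)) (++-identityʳ _)))) y
    from : ∀ {s c} → ∃ (λ i → c ≡ nm (a i) × ⟪ P i ⟫ s ⋆) → ⟪ guarded nat P a ⟫ s c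
    from {s} (i , refl , x) = traces-choice nat (λ i → P i ⨾ # a i) nm i
      (nm , s , ∅ , (λ j → sym (++-identityʳ _)) , x , (λ _ → refl) , refl)
  guarded-traces comm P a = to , from
    where
    to : ∀ {s c} → ⟪ guarded comm P a ⟫ s c → ∃ λ i → c ≡ ⋆ × ⟪ P i ⟫ s ⋆
    to x with choice-traces comm (λ i → P i ⨾ skip) x
    ... | i , _ , s , t , e , y , h , refl =
      i , refl , resp (P i) (λ j → sym (trans (e j) (trans (cong (s j ++_) (h j)) (++-identityʳ _)))) y
    from : ∀ {s c} → ∃ (λ i → c ≡ ⋆ × ⟪ P i ⟫ s ⋆) → ⟪ guarded comm P a ⟫ s c
    from {s} (i , refl , x) = traces-choice comm (λ i → P i ⨾ skip) ⋆ i
      (⋆ , s , ∅ , (λ j → sym (++-identityʳ _)) , x , (λ _ → refl) , refl)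
  guarded-traces var P a = to , from
    where
    to : ∀ {s c} → ⟪ guarded var P a ⟫ s c → ∃ λ i → c ≡ acc (a i) × ⟪ P i ⟫ s ⋆
    to x = let i , y = choice-traces var (λ i → access (P i) (a i)) x in
      i , proj₁ (access-traces (P i) (a i)) y
    from : ∀ {s c} → ∃ (λ i → c ≡ acc (a i) × ⟪ P i ⟫ s ⋆) → ⟪ guarded var P a ⟫ s c
    from (i , refl , x) = traces-choice var (λ i → access (P i) (a i)) acc i
      (proj₂ (access-traces (P i) (a i)) (refl , x))
  guarded-traces {k} {n} (A ⊸ B) P a = to , from
    where
    Q : Fin k → Tm (suc n)
    Q i = rename suc (P i) ⨾ uses (test A) (proj₁ (a i))
    uses-spec : ∀ i {u} → ⟪ uses (test A) (proj₁ (a i)) ⟫ u ⋆ ↔ u ≗ (map (enc A) (proj₁ (a i)) ▹ ∅)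
    uses-spec i = uses-traces (test A) (enc A) (test-traces A) (proj₁ (a i))
    to : ∀ {s c} → ⟪ guarded (A ⊸ B) P a ⟫ s c →
         ∃ λ i → c ≡ enc (A ⊸ B) (a i) × ⟪ P i ⟫ s ⋆
    to (as , b , refl , _ , x) with proj₁ (guarded-traces B Q (proj₂ ∘ a)) x
    ... | i , refl , _ , u , v , e , y , z with unrename-suc (P i) y | proj₁ (uses-spec i) z
    ... | y′ , u0 | v≗ =
      i , cong (_⇒ _) (trans (e zero) (cong₂ _++_ u0 (v≗ zero))) ,
      resp (P i) (λ j → sym (trans (e (suc j))
        (trans (cong (u (suc j) ++_) (v≗ (suc j))) (++-identityʳ _)))) y′
    from : ∀ {s c} → ∃ (λ i → c ≡ enc (A ⊸ B) (a i) × ⟪ P i ⟫ s ⋆) →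
           ⟪ guarded (A ⊸ B) P a ⟫ s c
    from {s} (i , refl , x) =
      map (enc A) (proj₁ (a i)) , enc B (proj₂ (a i)) , refl , encs-∈ A (proj₁ (a i)) ,
      proj₂ (guarded-traces B Q (proj₂ ∘ a)) (i , refl , ⋆ , [] ▹ s ,
        map (enc A) (proj₁ (a i)) ▹ ∅ , (λ { zero → refl ; (suc j) → sym (++-identityʳ _) }) ,
        rename-suc (P i) x , proj₂ (uses-spec i) λ _ → refl)

  test-traces nat x = natTest-traces x
  test-traces comm _ = to , from
    where
    to : ∀ {s c} → ⟪ test comm tt ⟫ s c → c ≡ [ ⋆ ] ⇒ ⋆
    to (_ , _ , refl , as∈ , (e , _)) = ones as∈ e
      where
      ones : ∀ {as b} → All (_∈ comm) as → as ≡ [ b ] → as ⇒ b ≡ [ ⋆ ] ⇒ ⋆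
      ones (⋆ ∷ []) refl = refl
    from : ∀ {s c} → c ≡ [ ⋆ ] ⇒ ⋆ → ⟪ test comm tt ⟫ s c
    from refl = [ ⋆ ] , ⋆ , refl , ⋆ ∷ [] , refl ,
      λ { zero h → ⊥-elim (h refl) ; (suc ()) h }
  test-traces var (read x) = to , from
    where
    to : ∀ {s c} → ⟪ test var (read x) ⟫ s c → c ≡ [ acc (read x) ] ⇒ ⋆
    to (_ , _ , refl , _ , y) with proj₁ (⊙-tests (natTest x) (natTest-traces x) (! ` zero)) y
    ... | refl , _ , refl , e , _ = cong (_⇒ ⋆) e
    from : ∀ {s c} → c ≡ [ acc (read x) ] ⇒ ⋆ → ⟪ test var (read x) ⟫ s c
    from refl = _ , _ , refl , acc ∷ [] ,
      proj₂ (⊙-tests (natTest x) (natTest-traces x) (! ` zero))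
        (refl , x , refl , refl , λ { zero h → ⊥-elim (h refl) ; (suc ()) h })
  test-traces var (write x) = to , from
    where
    to : ∀ {s c} → ⟪ test var (write x) ⟫ s c → c ≡ [ acc (write x) ] ⇒ ⋆
    to (_ , _ , refl , _ , _ , refl , u , v , e , (h , refl) , (p , _)) =
      cong (_⇒ ⋆) (trans (e zero) (cong₂ _++_ (h zero) p))
    from : ∀ {s c} → c ≡ [ acc (write x) ] ⇒ ⋆ → ⟪ test var (write x) ⟫ s c
    from refl = _ , _ , refl , acc ∷ [] , x , refl , ∅ , _ , (λ _ → refl) ,
      ((λ _ → refl) , refl) , refl , λ { zero h → ⊥-elim (h refl) ; (suc ()) h }
  test-traces (A ⊸ B) (as , b) = to , from
    where
    π : Fin 2 → Fin 2
    π = Perm.swap {0} {0} Perm.id ⟨$⟩ʳ_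
    π-inj : Inj π
    π-inj {i} {j} e = trans (sym (inverseˡ p)) (trans (cong (p ⟨$⟩ˡ_) e) (inverseˡ p))
      where
      p = Perm.swap {0} {0} Perm.id
    S : Tm 1
    S = supply A as
    F : Tm 2
    F = rename {1} (_↑ˡ 1) (` zero) · rename (1 ↑ʳ_) S
    ticked : Ticked (enc A) as S
    ticked {u} {c} =
      (λ x → let i , e , y = proj₁ spec x in i , e , proj₁ (tick-traces (toℕ i)) y) ,
      (λ (i , e , y) → proj₂ spec (i , e , proj₂ (tick-traces (toℕ i)) y))
      where
      spec : ⟪ S ⟫ u c ↔ ∃ λ i → c ≡ enc A (List.lookup as i) × ⟪ tick (toℕ i) ⟫ u ⋆
      spec = guarded-traces A (λ i → tick (toℕ i)) (List.lookup as)
    unmany : ∀ {w bs} → Many ⟪ rename (1 ↑ʳ_) S ⟫ w bs → w zero ≡ [] × Many ⟪ S ⟫ (w ∘ suc) bs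
    unmany ([] e) = e zero , [] (e ∘ suc)
    unmany ((e , x) ∷ xs) with unrename-suc S x | unmany xs
    ... | x′ , h | h′ , xs′ = trans (e zero) (cong₂ _++_ h h′) , (e ∘ suc , x′) ∷ xs′
    many : ∀ {w bs} → Many ⟪ S ⟫ w bs → Many ⟪ rename (1 ↑ʳ_) S ⟫ ([] ▹ w) bs
    many ([] e) = [] λ { zero → refl ; (suc i) → e i }
    many ((e , x) ∷ xs) = ((λ { zero → refl ; (suc i) → e i }) , rename-suc S x) ∷ many xs
    f-test = natTest (length as)
    to : ∀ {s c} → ⟪ test (A ⊸ B) (as , b) ⟫ s c → c ≡ [ map (enc A) as ⇒ enc B b ] ⇒ ⋆
    to (fs , _ , refl , _ , _ , t , y , path , _ , u , v , e , x , z)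
      with proj₁ (⊙-tests f-test (natTest-traces (length as)) (! ` zero)) z
         | proj₁ (⊙-tests (test B b) (test-traces B b) F) (proj₁ (unrename π π-inj (test B b ⊙ F) x))
    ... | refl , _ , refl , rd | _ , as′ , p , q , e′ , (p0 , pr) , xs with unmany xs
    ... | q0 , xs′ = cong (_⇒ ⋆) (trans fs≡ (cong (λ as → [ as ⇒ enc B b ]) as≡))
      where
      fs≡ : fs ≡ [ as′ ⇒ enc B b ]
      fs≡ = ++-≡ (e (suc zero)) (trans (e′ zero) (cong₂ _++_ p0 q0)) (Single-cong (suc zero) rd refl)
      t≡ : t ≡ q (suc zero) ++ [ acc (read (length as)) ]
      t≡ = ++-≡ (e zero) (trans (e′ (suc zero)) (cong (_++ q (suc zero)) (pr (suc zero) λ ())))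
             (Single-cong zero rd refl)
      as≡ : as′ ≡ map (enc A) as
      -- The history of the cell consists of the ticks of the supply followed by the final read; its
      -- consistency from `0` on identifies the list.
      as≡ = ticked-supplies (enc A) as S ticked xs′ (subst (λ t → Path 0 t y) t≡ path)
    from : ∀ {s c} → c ≡ [ map (enc A) as ⇒ enc B b ] ⇒ ⋆ → ⟪ test (A ⊸ B) (as , b) ⟫ s c
    from {s} refl with supplies-ticked (enc A) S as 0 (λ i → proj₂ ticked (i , refl , refl))
    ... | t , path , xs =
      _ , _ , refl , encs-∈ (A ⊸ B) [ as , b ] , ⋆ , t ++ [ acc (read (length as)) ] , length as ,
      path-read path , ⋆ , u , [ acc (read (length as)) ] ▹ ∅ , (λ { zero → refl ; (suc zero) → refl }) ,
      rename-along π π-inj (test B b ⊙ F) along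
        (proj₂ (⊙-tests (test B b) (test-traces B b) F)
          (refl , map (enc A) as , [ map (enc A) as ⇒ enc B b ] ▹ ∅ , [] ▹ (t ▹ ∅) ,
           (λ { zero → refl ; (suc zero) → refl }) , zero-Single , many xs)) ,
      proj₂ (⊙-tests f-test (natTest-traces (length as)) (! ` zero))
        (refl , length as , refl , zero-Single)
      where
      f = map (enc A) as ⇒ enc B b
      u : Env 2
      u = t ▹ ([ f ] ▹ ∅)
      along : Along π u ([ f ] ▹ (t ▹ ∅))
      along = (λ { zero → refl ; (suc zero) → refl }) ,
        λ { zero h → ⊥-elim (h (suc zero) refl) ; (suc zero) h → ⊥-elim (h zero refl) }
      path-read : ∀ {x t y} → Path x t y → Path x (t ++ [ acc (read y) ]) y
      path-read []         = read∷ []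
      path-read (read∷ p)  = read∷ (path-read p)
      path-read (write∷ p) = write∷ (path-read p)

  -- Full abstraction

  data Result : Tm 0 → Tr → Set where
    num  : ∀ x → Result (# x) (nm x)
    skip : Result skip ⋆

  result : ∀ {P B V} → Ground B → Value V → Typed [] P V B → ∃ (Result V)
  result g num   num                = _ , num _
  result g skip  skip               = _ , skip
  result g ident (var {()} _ _)
  result () lam   (lam d)
  result () mkvar (mkvar d e)

  Result-traces : ∀ {V b s} → Result V b → ⟪ V ⟫ s b
  Result-traces (num x) = (λ ()) , refl
  Result-traces skip    = (λ ()) , refl

  ⇓⇒traces : ∀ {P M B V b s} → Typed [] P M B → M ⇓ V → Result V b → ⟪ M ⟫ s b
  ⇓⇒traces {M = M} d r v with run (sound d r) (Result-traces v)
  ... | _ ▷ x = resp M (λ ()) x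

  -- The instance of `fundamental` at the empty substitution, which fixes closed terms, and the
  -- empty store.
  traces⇒⇓ : ∀ {P M B V b s} → Typed [] P M B → Result V b → ⟪ M ⟫ s b → M ⇓ V
  traces⇒⇓ {M = M} d v x = observe v
    (subst (λ M → Realize _ M _)
      (trans (substitute-vars {ρ = λ ()} (λ ()) M) (rename-id (λ ()) M))
      (fundamental d (λ ()) {u = ∅} (realizer {U = λ ()} (λ ()) (λ ())) x))
    where
    observe : ∀ {V b} → Result V b → Realize b M ∅ → M ⇓ V
    observe (num x) f = f (paths λ ())
    observe skip    f = f (paths λ ())

  ≗-simulation : Simulation {n} _≗_
  ≗-simulation = record
    { unit = id
    ; mult = λ e h h′ i → trans (e i) (cong₂ _++_ (h i) (h′ i))
    }

  module _ {M N : Tm 0} (M⊆N : ∀ {s b} → ⟪ M ⟫ s b → ⟪ N ⟫ s b) where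

    reflexive : {Φ : Env n → Env n → Set} → (∀ s → Φ s s) → (M : Tm n) → Φ ⊢ M ≲ M
    reflexive h M = leaf λ x → _ , h _ , x

    -- Stated for any reflexive relation because binders replace the relation by its `Lift`, which
    -- stays reflexive.
    context≲ : {Φ : Env n → Env n → Set} → (∀ s → Φ s s) → (C : Context 0 n) →
               Φ ⊢ C ⟨ M ⟩ ≲ C ⟨ N ⟩
    -- The term in the hole is closed, so its trace is empty at every identifier in scope and can be
    -- exchanged for one of `N` in the same environment.
    context≲ h (□ ρ inj) = leaf λ x →
      let y , off = unrename ρ inj M x in
      _ , h _ , rename-along ρ inj N ((λ ()) , off) (M⊆N y)
    context≲ h (ƛ A C)           = ƛ A (context≲ (λ s → refl , h _) C)
    context≲ h (C ·ˡ N)          = context≲ h C · reflexive h N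
    context≲ h (N ·ʳ C)          = reflexive h N · context≲ h C
    context≲ h (opˡ o C N)       = op o (context≲ h C) (reflexive h N)
    context≲ h (opʳ o N C)       = op o (reflexive h N) (context≲ h C)
    context≲ h (C ⨾ˡ N)          = context≲ h C ⨾ reflexive h N
    context≲ h (N ⨾ʳ C)          = reflexive h N ⨾ context≲ h C
    context≲ h (C ≔ˡ N)          = context≲ h C ≔ reflexive h N
    context≲ h (N ≔ʳ C)          = reflexive h N ≔ context≲ h C
    context≲ h (! C)             = ! context≲ h C
    context≲ h (whileˡ C N)      = while (context≲ h C) (reflexive h N)
    context≲ h (whileʳ N C)      = while (reflexive h N) (context≲ h C)
    context≲ h (ifzero₁ C N₁ N₂) = ifzero (context≲ h C) (reflexive h N₁) (reflexive h N₂)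
    context≲ h (ifzero₂ N C N₂)  = ifzero (reflexive h N) (context≲ h C) (reflexive h N₂)
    context≲ h (ifzero₃ N N₁ C)  = ifzero (reflexive h N) (reflexive h N₁) (context≲ h C)
    context≲ h (new C)           = new (context≲ (λ s → refl , h _) C)
    context≲ h (mkvarˡ C N)      = mkvar (context≲ h C) (reflexive h N)
    context≲ h (mkvarʳ N C)      = mkvar (reflexive h N) (context≲ h C)

    congruent : (C : Context 0 n) → ∀ {s b} → ⟪ C ⟨ M ⟩ ⟫ s b → ⟪ C ⟨ N ⟩ ⟫ s b
    congruent C x with simulate ≗-simulation (context≲ (λ _ _ → refl) C) x
    ... | _ , e , y = resp (C ⟨ N ⟩) (≗-sym e) y

    preserves-⇓ : (C : Context 0 0) → ∀ {B V} → Ground B →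
                  [] ⊢ C ⟨ M ⟩ ∶ B → [] ⊢ C ⟨ N ⟩ ∶ B → Value V → [] ⊢ V ∶ B →
                  C ⟨ M ⟩ ⇓ V → C ⟨ N ⟩ ⇓ V
    preserves-⇓ C g d e v v∶B r with result g v (typed v∶B)
    ... | _ , w = traces⇒⇓ (typed e) w (congruent C (⇓⇒traces {s = ∅} (typed d) r w))

  module _ {A : Ty} {M N : Tm 0} (d : [] ⊢ M ∶ A) (e : [] ⊢ N ∶ A) where

    -- Typing puts every raw trace of `M` into the image of the encoding, where the agreement of
    -- both denotations applies.
    model⇒traces : (∀ {a} → ⟦ d ⟧ [] a → ⟦ e ⟧ [] a) → ∀ {s b} → ⟪ M ⟫ s b → ⟪ N ⟫ s b
    model⇒traces h {s} x with dec (trace-∈ (typed d) {s} (λ ()) x)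
    ... | a , refl =
      resp N (λ ()) (⟦⟧⇒⟪⟫ e {[]} (h (⟪⟫⇒⟦⟧ d {[]} (resp M (λ ()) x))))

    ≅⇒model : M ≅ N → ∀ {a} → ⟦ d ⟧ [] a → ⟦ e ⟧ [] a
    ≅⇒model M≅N {a} x = ⟪⟫⇒⟦⟧ e (proj₂ (proj₁ (⊙-tests (test A a) (test-traces A a) N)
      (⇓⇒traces (typed ⊢N) (Equivalence.to (M≅N C comm ⊢M ⊢N skip skip skip)
        (traces⇒⇓ (typed ⊢M) skip
          (proj₂ (⊙-tests (test A a) (test-traces A a) M) (refl , ⟦⟧⇒⟪⟫ d x)))) skip)))
      where
      C : Context 0 0
      -- The renamings out of empty scopes make `C ⟨ M ⟩` literally `test A a ⊙ M`.
      C = rename (_↑ˡ 0) (test A a) ·ʳ □ (0 ↑ʳ_) id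
      ⊢M : [] ⊢ C ⟨ M ⟩ ∶ comm
      ⊢M = ⊢⊙ (⊢test A a) d
      ⊢N : [] ⊢ C ⟨ N ⟩ ∶ comm
      ⊢N = ⊢⊙ (⊢test A a) e

    Ext-mono : (∀ {a} → ⟦ d ⟧ [] a → ⟦ e ⟧ [] a) →
               ∀ {p as} → Ext (seqs []) ⟦ d ⟧ p as → Ext (seqs []) ⟦ e ⟧ p as
    Ext-mono h ([] eq) = [] eq
    Ext-mono h (_∷_ {p₁ = []} (eq , x) xs) = (eq , h x) ∷ Ext-mono h xs

    -- A morphism into a free monoid is determined by its values on generators, here one-element
    -- lists.
    Ext-singleton : (∀ p as → Ext (seqs []) ⟦ d ⟧ p as → Ext (seqs []) ⟦ e ⟧ p as) →
                    ∀ {a} → ⟦ d ⟧ [] a → ⟦ e ⟧ [] a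
    Ext-singleton h x with h [] (_ ∷ []) ((refl , x) ∷ [] refl)
    ... | _∷_ {p₁ = []} (_ , y) _ = y

  ≅-sym : {M N : Tm 0} → M ≅ N → N ≅ M
  ≅-sym h C g x y V v v∶B =
    mk⇔ (Equivalence.from (h C g y x V v v∶B)) (Equivalence.to (h C g y x V v v∶B))

  traces⇒≅ : {M N : Tm 0} → (∀ {s b} → ⟪ M ⟫ s b → ⟪ N ⟫ s b) →
             (∀ {s b} → ⟪ N ⟫ s b → ⟪ M ⟫ s b) → M ≅ N
  traces⇒≅ h h′ C g x y V v v∶B =
    mk⇔ (preserves-⇓ h C g x y v v∶B) (preserves-⇓ h′ C g y x v v∶B)

  full-abstraction : {A : Ty} {M N : Tm 0} (d : [] ⊢ M ∶ A) (e : [] ⊢ N ∶ A) →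
                     (model d ≋ model e) ⇔ (M ≅ N)
  full-abstraction {A} {M} {N} d e = mk⇔ sound-model complete
    where
    sound-model : model d ≋ model e → M ≅ N
    sound-model h = traces⇒≅
      (model⇒traces d e (Ext-singleton d e λ p as → Equivalence.to (h p as)))
      (model⇒traces e d (Ext-singleton e d λ p as → Equivalence.from (h p as)))
    complete : M ≅ N → model d ≋ model e
    complete h p as = mk⇔ (Ext-mono d e (≅⇒model d e h)) (Ext-mono e d (≅⇒model e d (≅-sym h)))

theorem7p3 : (𝒜 : Arithmetic) → let open SCI 𝒜 in
    {A : Ty} {M N : Tm 0} (d : [] ⊢ M ∶ A) (e : [] ⊢ N ∶ A) →
    (model d ≋ model e) ⇔ (M ≅ N)
theorem7p3 𝒜 d e = FullAbstraction.full-abstraction 𝒜 d e
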